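{- Let $K=\mathbb{F}_q$ be a finite field. Let $\mathcal{G}$ be a bipartite simple graph with a perfect matching, with $2k$ vertices and $s$ edges, and let $\mathbb{X}\subseteq\mathbb{P}^{s-1}$ be the toric set over $K$ parameterized by its edges, with vanishing ideal $I_{\mathbb{X}}\subseteq S=K[X_1,\ldots,X_s]$. Let $I_{\mathbb{T}_{k-1}}\subseteq R$ be the vanishing ideal of the projective torus $\mathbb{T}_{k-1}$, where $R$ is the polynomial ring over $K$ in $k$ variables. Then $$\mathrm{reg}(S/I_{\mathbb{X}})\geq \mathrm{reg}(R/I_{\mathbb{T}_{k-1}})=(q-2)(k-1),$$ and this lower bound is tight: it is attained when $\mathcal{G}$ is an even cycle, and when $\mathcal{G}$ is a complete bipartite graph of the form $\mathcal{K}_{m,m}$.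
   Context: Let $K^*=K\setminus\{0\}$. For a simple graph $\mathcal{G}$ with vertices $v_1,\ldots,v_n$ and edges $e_1,\ldots,e_s$, the toric set parameterized by the edges of $\mathcal{G}$ is the set $\mathbb{X}\subseteq\mathbb{P}^{s-1}$ of all points, for $(t_1,\ldots,t_n)\in(K^*)^n$, whose $i$-th coordinate is $t_jt_l$ when $e_i=\{v_j,v_l\}$. The projective torus is $\mathbb{T}_{k-1}=\{[t_1,\ldots,t_k]\in\mathbb{P}^{k-1}: t_i\in K^*\}$. For a finite set of points $\mathbb{Z}\subseteq\mathbb{P}^{r-1}$ and $A=K[X_1,\ldots,X_r]=\oplus_{d\ge0}A_d$ with the standard grading, $I_{\mathbb{Z}}\subseteq A$ is the ideal generated by the homogeneous polynomials vanishing at all points of $\mathbb{Z}$, $H_{\mathbb{Z}}(d)=\dim_K(A_d/(I_{\mathbb{Z}}\cap A_d))$, and the regularity index $\mathrm{reg}(A/I_{\mathbb{Z}})$ is the least integer $d\ge0$ such that $H_{\mathbb{Z}}(d)=|\mathbb{Z}|$. -}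

module Defs where

open import Algebra.Apartness.Bundles using (HeytingCommutativeRing; HeytingField)
open import Algebra.Bundles using (CommutativeRing; Semiring)
open import Algebra.Module.Bundles.Raw using (RawLeftModule)
import Algebra.Apartness.Properties.HeytingCommutativeRing as HCR
import Algebra.Properties.Ring as RingProperties
import Algebra.Definitions.RawMonoid as RawMonoidDefs
import Algebra.Definitions.RawSemiring as RawSemiringDefs
open import Data.Bool using (Bool; if_then_else_)
open import Data.Fin using (Fin; toℕ)
open import Data.Fin.Subset using (Subset; _∈_)
open import Data.List as List using (List; []; _∷_; _++_; cartesianProductWith)
open import Data.Nat as ℕ using (ℕ; suc; _≤_)
import Data.Nat.Properties as ℕₚ
open import Data.Product using (Σ; ∃; ∃!; ∃-syntax; _×_; _,_; proj₁; map₁)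
open import Data.Sum using (_⊎_; inj₁; inj₂)
open import Data.Vec as Vec using (Vec)
open import Data.Vec.Functional using (Vector)
open import Data.Vec.Properties using (≡-dec)
open import Function.Bundles using (Inverse; _↔_; _⇔_)
open import Level using (Level; 0ℓ; _⊔_)
open import Relation.Binary.Bundles using (Setoid)
open import Relation.Binary.Core using (Rel)
open import Relation.Binary.Definitions using (DecidableEquality)
import Relation.Binary.Construct.On as On
open import Relation.Binary.PropositionalEquality as ≡ using (_≡_; _≢_)
open import Relation.Nullary using (does; yes; no)
open import Relation.Unary using (Pred)

private
  variable
    a ℓ : Level

HasCardinality : Setoid a ℓ → ℕ → Set (a ⊔ ℓ)
HasCardinality S n = Inverse S (≡.setoid (Fin n))

-- Vertices v₁,…,vₙ and edges e₁,…,eₛ.  The order of the two ends of an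
-- edge carries no meaning, so `simple` compares unordered pairs.
record SimpleGraph (n s : ℕ) : Set where
  field
    end₁ end₂ : Fin s → Fin n

  Joins : Fin s → Fin n → Fin n → Set
  Joins e u v = (end₁ e ≡ u × end₂ e ≡ v) ⊎ (end₁ e ≡ v × end₂ e ≡ u)

  field
    loopless : ∀ e → end₁ e ≢ end₂ e
    simple   : ∀ {e f u v} → Joins e u v → Joins f u v → e ≡ f

  Incident : Fin s → Fin n → Set
  Incident e v = end₁ e ≡ v ⊎ end₂ e ≡ v

  Adjacent : Rel (Fin n) _
  Adjacent u v = ∃[ e ] Joins e u v

CyclicSuccessor : ∀ {n} → Rel (Fin n) 0ℓ
CyclicSuccessor {n} i j = toℕ j ≡ suc (toℕ i) ⊎ (suc (toℕ i) ≡ n × toℕ j ≡ 0)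

data Across {l m : ℕ} : Rel (Fin l ⊎ Fin m) 0ℓ where
  left-right : ∀ {i j} → Across (inj₁ i) (inj₂ j)
  right-left : ∀ {i j} → Across (inj₂ j) (inj₁ i)

module _ {n s : ℕ} (G : SimpleGraph n s) where

  open SimpleGraph G

  Bipartite : Set
  Bipartite = Σ (Fin n → Bool) λ side → ∀ e → side (end₁ e) ≢ side (end₂ e)

  HasPerfectMatching : Set
  HasPerfectMatching =
    Σ (Subset s) λ M → ∀ v → ∃! _≡_ λ e → e ∈ M × Incident e v

  IsomorphicTo : {V : Set} → Rel V 0ℓ → Set
  IsomorphicTo {V} _∼_ =
    Σ (V ↔ Fin n) λ φ → ∀ x y → (x ∼ y) ⇔ Adjacent (Inverse.to φ x) (Inverse.to φ y)

  IsCycle : Set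
  IsCycle = 3 ≤ n × IsomorphicTo {Fin n} λ i j → CyclicSuccessor i j ⊎ CyclicSuccessor j i

  IsCompleteBipartite : ℕ → ℕ → Set
  IsCompleteBipartite l m = IsomorphicTo (Across {l} {m})

module _ {c ℓ₁ ℓ₂ : Level} (K : HeytingField c ℓ₁ ℓ₂) where

  open HeytingField K
  open HCR heytingCommutativeRing
  private
    module R = CommutativeRing (HeytingCommutativeRing.commutativeRing heytingCommutativeRing)
  open RawSemiringDefs (Semiring.rawSemiring R.semiring) using (product; _^_)
  open RingProperties R.ring using (-0#≈0#; -‿+-comm)

  -- A raw module is enough to state dimension: only the operations and
  -- the equality enter, not the laws.
  module _ (V : RawLeftModule Carrier a ℓ) where

    open RawLeftModule V

    linearCombination : ∀ {n} → Vector Carrier n → Vector Carrierᴹ n → Carrierᴹ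
    linearCombination κ v = RawMonoidDefs.sum +ᴹ-rawMonoid (λ i → κ i *ₗ v i)

    LinearlyIndependent : ∀ {n} → Vector Carrierᴹ n → Set (c ⊔ ℓ₁ ⊔ ℓ)
    LinearlyIndependent v =
      ∀ κ → linearCombination κ v ≈ᴹ 0ᴹ → ∀ i → κ i ≈ 0#

    Spanning : ∀ {n} → Vector Carrierᴹ n → Set (c ⊔ a ⊔ ℓ)
    Spanning v = ∀ x → ∃[ κ ] x ≈ᴹ linearCombination κ v

    HasDimension : ℕ → Set (c ⊔ ℓ₁ ⊔ a ⊔ ℓ)
    HasDimension n =
      Σ (Vector Carrierᴹ n) λ v → LinearlyIndependent v × Spanning v

  -- K* is {x | x # 0} throughout; when K is finite, x # 0 is equivalent
  -- to ¬ (x ≈ 0).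
  module _ {r : ℕ} where

    infix 4 _∼_

    _∼_ : Rel (Vector Carrier r) (c ⊔ ℓ₁ ⊔ ℓ₂)
    x ∼ y = ∃[ κ ] κ # 0# × (∀ i → x i ≈ κ * y i)

    ∼-refl : ∀ {x} → x ∼ x
    ∼-refl = 1# , 1#0 , λ i → sym (*-identityˡ _)

    ∼-trans : ∀ {x y z} → x ∼ y → y ∼ z → x ∼ z
    ∼-trans (κ , κ#0 , p) (μ , μ#0 , q) =
      κ * μ , x#0y#0→xy#0 κ#0 μ#0 ,
      λ i → trans (p i) (trans (*-congˡ (q i)) (sym (*-assoc κ μ _)))

    ∼-sym : ∀ {x y} → x ∼ y → y ∼ x
    ∼-sym {x} {y} (κ , κ#0 , p) with #⇒invertible κ#0
    ... | μ , μκ≈1 , κμ≈1 =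
      μ , invertibleˡ⇒# (κ - 0# , trans (*-congˡ (x-0≈x μ)) κμ≈1) ,
      λ i → sym (trans (*-congˡ (p i)) (trans (sym (*-assoc μ κ _))
        (trans (*-congʳ (trans (*-congˡ (sym (x-0≈x κ))) μκ≈1)) (*-identityˡ _))))

  -- r counts homogeneous coordinates: these represent points of ℙʳ⁻¹.
  Point : ℕ → Set (c ⊔ ℓ₂)
  Point r = Σ (Vector Carrier r) λ x → ∃[ i ] x i # 0#

  projectiveSpace : ℕ → Setoid (c ⊔ ℓ₂) (c ⊔ ℓ₁ ⊔ ℓ₂)
  projectiveSpace r = record
    { Carrier       = Point r
    ; _≈_           = λ P Q → proj₁ P ∼ proj₁ Q
    ; isEquivalence = record { refl = ∼-refl ; sym = ∼-sym ; trans = ∼-trans }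
    }

  PointSet : ℕ → Set _
  PointSet r = Pred (Point r) (c ⊔ ℓ₁ ⊔ ℓ₂)

  pointSetoid : ∀ {r} → PointSet r → Setoid _ _
  pointSetoid {r} Z = On.setoid (projectiveSpace r) (proj₁ {B = Z})

  toricSet : ∀ {n s} → SimpleGraph n s → PointSet s
  toricSet {n} G (x , _) =
    Σ (Vector Carrier n) λ t →
      (∀ v → t v # 0#) × x ∼ (λ e → t (end₁ e) * t (end₂ e))
    where open SimpleGraph G

  -- k counts homogeneous coordinates, so this is 𝕋ₖ₋₁ ⊆ ℙᵏ⁻¹.
  projectiveTorus : ∀ k → PointSet k
  projectiveTorus k (x , _) =
    Σ (Vector Carrier k) λ t → (∀ i → t i # 0#) × x ∼ t

  Monomial : ℕ → Set
  Monomial r = Vec ℕ r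

  degree : ∀ {r} → Monomial r → ℕ
  degree = Vec.sum

  _≟ᴹ_ : ∀ {r} → DecidableEquality (Monomial r)
  _≟ᴹ_ = ≡-dec ℕₚ._≟_

  -- A polynomial is written as a formal sum of terms κ·Xᵅ; monomials may
  -- repeat and coefficients may vanish, and _≈ᴾ_ compares the collected
  -- coefficients.
  Poly : ℕ → Set c
  Poly r = List (Carrier × Monomial r)

  module _ {r : ℕ} where

    infix  8 -ᴾ_
    infixl 7 _*ᴾ_
    infixr 7 _·ᴾ_
    infixl 6 _+ᴾ_
    infix  4 _≈ᴾ_

    coeff : Poly r → Monomial r → Carrier
    coeff []            α = 0#
    coeff ((κ , β) ∷ f) α = (if does (β ≟ᴹ α) then κ else 0#) + coeff f α

    _≈ᴾ_ : Rel (Poly r) ℓ₁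
    f ≈ᴾ g = ∀ α → coeff f α ≈ coeff g α

    0ᴾ : Poly r
    0ᴾ = []

    _+ᴾ_ : Poly r → Poly r → Poly r
    _+ᴾ_ = _++_

    _·ᴾ_ : Carrier → Poly r → Poly r
    κ ·ᴾ f = List.map (map₁ (κ *_)) f

    -ᴾ_ : Poly r → Poly r
    -ᴾ f = List.map (map₁ (λ κ → - κ)) f

    _*ᴾ_ : Poly r → Poly r → Poly r
    _*ᴾ_ = cartesianProductWith
      λ (κ , α) (μ , β) → κ * μ , Vec.zipWith ℕ._+_ α β

    evalMonomial : Monomial r → Vector Carrier r → Carrier
    evalMonomial α x = product (λ i → x i ^ Vec.lookup α i)

    eval : Poly r → Vector Carrier r → Carrier
    eval []            x = 0#
    eval ((κ , α) ∷ f) x = κ * evalMonomial α x + eval f x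

    Homogeneous : ℕ → Pred (Poly r) ℓ₁
    Homogeneous d f = ∀ α → degree α ≢ d → coeff f α ≈ 0#

    data Ideal⟨_⟩ (G : Pred (Poly r) ℓ) : Pred (Poly r) (c ⊔ ℓ₁ ⊔ ℓ) where
      generator : ∀ {f} → G f → Ideal⟨ G ⟩ f
      zeroᴵ     : Ideal⟨ G ⟩ 0ᴾ
      +-closed  : ∀ {f g} → Ideal⟨ G ⟩ f → Ideal⟨ G ⟩ g → Ideal⟨ G ⟩ (f +ᴾ g)
      *-closed  : ∀ h {f} → Ideal⟨ G ⟩ f → Ideal⟨ G ⟩ (h *ᴾ f)
      respects  : ∀ {f g} → f ≈ᴾ g → Ideal⟨ G ⟩ f → Ideal⟨ G ⟩ g

    coeff-+ : ∀ f g α → coeff (f +ᴾ g) α ≈ coeff f α + coeff g α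
    coeff-+ []      g α = sym (+-identityˡ _)
    coeff-+ (_ ∷ f) g α = trans (+-congˡ (coeff-+ f g α)) (sym (+-assoc _ _ _))

    coeff-map : (h : Carrier → Carrier) → h 0# ≈ 0# →
      (∀ x y → h (x + y) ≈ h x + h y) →
      ∀ f α → coeff (List.map (map₁ h) f) α ≈ h (coeff f α)
    coeff-map h h0 h+ []            α = sym h0
    coeff-map h h0 h+ ((κ , β) ∷ f) α =
      trans (+-cong term (coeff-map h h0 h+ f α)) (sym (h+ _ _))
      where
      term : (if does (β ≟ᴹ α) then h κ else 0#) ≈ h (if does (β ≟ᴹ α) then κ else 0#)
      term with β ≟ᴹ α
      ... | yes _ = refl
      ... | no  _ = sym h0

  module _ {r : ℕ} where

    -- A_d / (I ∩ A_d): elements of A_d, two of them being identified when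
    -- their difference lies in I (it automatically lies in A_d).
    gradedQuotient : Pred (Poly r) ℓ → ℕ → RawLeftModule Carrier (c ⊔ ℓ₁) ℓ
    gradedQuotient I d = record
      { Carrierᴹ = ∃ (Homogeneous d)
      ; _≈ᴹ_     = λ (f , _) (g , _) → I (f +ᴾ -ᴾ g)
      ; _+ᴹ_     = λ (f , hf) (g , hg) → f +ᴾ g , λ α α≢d →
          trans (coeff-+ f g α)
            (trans (+-cong (hf α α≢d) (hg α α≢d)) (+-identityˡ 0#))
      ; _*ₗ_     = λ κ (f , hf) → κ ·ᴾ f , λ α α≢d →
          trans (coeff-map (κ *_) (zeroʳ κ) (distribˡ κ) f α)
            (trans (*-congˡ (hf α α≢d)) (zeroʳ κ))
      ; 0ᴹ       = 0ᴾ , λ _ _ → refl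
      ; -ᴹ_      = λ (f , hf) → -ᴾ f , λ α α≢d →
          trans (coeff-map (λ κ → - κ) -0#≈0# (λ x y → sym (-‿+-comm x y)) f α)
            (trans (-‿cong (hf α α≢d)) -0#≈0#)
      }

    VanishesOn : PointSet r → Pred (Poly r) _
    VanishesOn Z f = ∀ P → Z P → eval f (proj₁ P) ≈ 0#

    vanishingIdeal : PointSet r → Pred (Poly r) _
    vanishingIdeal Z = Ideal⟨ (λ f → ∃[ d ] Homogeneous d f × VanishesOn Z f) ⟩

    -- The graph of the function: HilbertFunction Z d N says H_Z(d) = N.
    HilbertFunction : PointSet r → ℕ → ℕ → Set _
    HilbertFunction Z d N = HasDimension (gradedQuotient (vanishingIdeal Z) d) N

    -- reg(A/I_Z) = d: d is least with H_Z(d) = |Z|.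
    IsRegularityIndex : PointSet r → ℕ → Set _
    IsRegularityIndex Z d = ∃[ N ]
      HasCardinality (pointSetoid Z) N ×
      HilbertFunction Z d N ×
      (∀ d′ → HilbertFunction Z d′ N → d ≤ d′)

-- H_Z(d) = |Z| holds iff forms of degree d separate the points of Z, that is,
-- iff each point of Z has a form of degree d that vanishes on all other points
-- but not on it: evaluation at the points embeds A_d / I_d in K^Z.
--
-- Lower bound.  Let 𝕋 be the torus with k coordinates.  Sending y to the point
-- whose coordinate at an edge is the coordinate of y attached to the end of the
-- edge on a fixed side with k vertices embeds 𝕋 linearly in the toric set.  On
-- 𝕋, a form f that vanishes outside (1,…,1) has
--   Σ f(1,t) t₁⋯tₖ₋₁ = f(1,…,1) ≠ 0   (t ranging over (K*)ᵏ⁻¹),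
-- whereas Σ tᵃ⁺¹ over K* is 0 for a < q − 2; hence some monomial of f has
-- degree at least q − 2 in each of the k − 1 variables t.
--
-- Upper bound.  For 𝕋 and for K_{m,m}, products of (q − 2)(k − 1) linear factors
-- (for K_{m,m}, of factors (aᵢ − c a₀)(bᵢ − c′ b₀), linear in the products aᵢ bⱼ)
-- separate points.  On the toric set of an even cycle, the even and the odd edges
-- have equal products, so adding r to the exponents on even edges, subtracting r
-- on odd edges, and reducing modulo q − 1 does not change a monomial function.
-- Averaged over r, the new degree is k(q − 2); some r is at most average, and the
-- congruence modulo q − 1 then brings the degree down to (q − 2)(k − 1).

module Submission where

open import Defs
open import Algebra.Apartness.Bundles using (HeytingCommutativeRing; HeytingField)
import Algebra.Apartness.Properties.HeytingCommutativeRing as HCR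
open import Algebra.Bundles using (CommutativeMonoid; CommutativeRing)
open import Algebra.Module.Bundles.Raw using (module RawLeftModule)
import Algebra.Properties.CommutativeMonoid.Sum as MonoidSum
import Algebra.Properties.CommutativeSemigroup as SemigroupProperties
import Algebra.Properties.CommutativeSemiring.Exp as CommutativeExp
import Algebra.Properties.Ring as RingProperties
import Algebra.Properties.Semiring.Exp as Exp
import Algebra.Properties.Semiring.Sum as SemiringSum
open import Data.Bool using (Bool; true; false; if_then_else_; not)
import Data.Bool.Properties as Boolₚ
open import Data.Fin as Fin using (Fin; zero; suc; toℕ; punchIn; punchOut)
import Data.Fin.Permutation as Perm
import Data.Fin.Properties as Finₚ
open import Data.Fin.Subset using (Subset; _∈_)
open import Data.List as List using (List; []; _∷_; _++_; length; concatMap; upTo)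
import Data.List.Properties as Listₚ
open import Data.List.Membership.Propositional using (lose) renaming (_∈_ to _∈ᴸ_)
import Data.List.Membership.Propositional.Properties as ∈ₚ
open import Data.List.Relation.Unary.All as All using (All; []; _∷_)
import Data.List.Relation.Unary.All.Properties as Allₚ
open import Data.List.Relation.Unary.Any using (here; there)
open import Data.Nat as ℕ using (ℕ; zero; suc)
open import Data.Nat.DivMod using (_/_; _%_; _mod_; m≡m%n+[m/n]*n; m%n<n; m<n⇒m%n≡m; n%n≡0; [m+n]%n≡m%n)
open import Data.Nat.Divisibility using (_∣_; divides; ∣m+n∣m⇒∣n; ∣⇒≤; m∣m*n)
import Data.Nat.Properties as ℕₚ
open import Data.Nat.Solver using (module +-*-Solver)
open import Data.Product using (Σ; ∃; ∃₂; ∃-syntax; _×_; _,_; proj₁; proj₂)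
open import Data.Sum using (_⊎_; inj₁; inj₂)
open import Data.Vec as Vec using (Vec; []; _∷_; lookup)
open import Data.Vec.Functional as VF using (Vector)
import Data.Vec.Properties as Vecₚ
open import Function.Base using (_∘_; id; case_of_)
open import Function.Bundles using (Equivalence; Injection; Inverse)
import Function.Construct.Symmetry as Symmetry
open import Function.Properties.Inverse using (Inverse⇒Injection)
open import Level using (Level; Lift; lift; lower; _⊔_)
open import Relation.Binary.Bundles using (Setoid)
open import Relation.Binary.PropositionalEquality as ≡ using (_≡_; _≢_)
import Relation.Binary.Reasoning.Setoid as ≈-Reasoning
open import Relation.Nullary using (¬_; Dec; yes; no; contradiction; does; map′)
open import Relation.Nullary.Decidable using (dec-true; dec-false)

-- The index is defined by dimensions of quotients of formal sums, whereas the geometric arguments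
-- concern values at points. The bridge is interpolation by forms at chosen representatives. From
-- dimension to interpolation no elimination is carried out: evaluation of N independent forms is an
-- injective self-map of the finite set K^N, hence onto. For a general bipartite graph the value of
-- the index is not computed, so its existence needs a degree where separation surely holds, taken
-- from the ambient torus, and a decidable condition, obtained by searching coefficients in the
-- finite field.
--
-- On a cycle the obstacle is homogeneity. Reducing exponents modulo q - 1 preserves functions on
-- units but controls the degree only up to multiples of q - 1. The ambient separating form is
-- therefore first moved into the residue class of the target by a power of one variable, and after
-- the reduction the missing multiple of q - 1 is put back. The average k(q - 2) exceeds the target
-- by q - 2, one less than the modulus; this is why a shift that is merely average suffices.

private
  module ℕΣ = SemiringSum ℕₚ.+-*-semiring
  module ℕ₊ = SemigroupProperties ℕₚ.+-commutativeSemigroup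

open ℕΣ using () renaming (sum to ∑)

private
  variable
    a ℓ : Level

-- Field arithmetic and roots of monic polynomial functions.

module Field {c ℓ₁ ℓ₂} (K : HeytingField c ℓ₁ ℓ₂) where

  open HeytingField K hiding (zero) public
  open HCR heytingCommutativeRing public
  R : CommutativeRing c ℓ₁
  R = HeytingCommutativeRing.commutativeRing heytingCommutativeRing
  open CommutativeRing R public
    using (semiring; commutativeSemiring; ring; +-commutativeMonoid; *-commutativeMonoid)
  open Exp semiring public
  open CommutativeExp commutativeSemiring public using (^-distrib-*)
  open RingProperties ring public hiding (//-rightDivides)
  open SemiringSum semiring public using (sum; *-distribˡ-sum; *-distribʳ-sum)
  module Sum = MonoidSum +-commutativeMonoid
  module Prod = MonoidSum *-commutativeMonoid
  open Prod public using () renaming (sum to prod)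
  open ≈-Reasoning setoid public

  module +ₛ = SemigroupProperties (CommutativeMonoid.commutativeSemigroup +-commutativeMonoid)
  module *ₛ = SemigroupProperties (CommutativeMonoid.commutativeSemigroup *-commutativeMonoid)

  #⇒≉0 : ∀ {x} → x # 0# → ¬ x ≈ 0#
  #⇒≉0 x#0 x≈0 = proj₂ (tight _ _) x≈0 x#0

  #-resp-≈ : ∀ {x y} → x ≈ y → x # 0# → y # 0#
  #-resp-≈ = #-congʳ

  inverse : ∀ {x} → x # 0# → ∃[ y ] y * x ≈ 1#
  inverse {x} x#0 with #⇒invertible x#0
  ... | y , yx≈1 , _ = y , trans (*-congˡ (sym (x-0≈x x))) yx≈1

  inverse-# : ∀ {x y} → y * x ≈ 1# → y # 0#
  inverse-# {x} {y} yx≈1 =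
    invertibleˡ⇒# (x , trans (*-congˡ (x-0≈x y)) (trans (*-comm x y) yx≈1))

  *-cancelˡ-# : ∀ {x} → x # 0# → ∀ {y z} → x * y ≈ x * z → y ≈ z
  *-cancelˡ-# {x} x#0 {y} {z} xy≈xz with inverse x#0
  ... | w , wx≈1 = begin
    y            ≈⟨ *-identityˡ y ⟨
    1# * y       ≈⟨ *-congʳ wx≈1 ⟨
    w * x * y    ≈⟨ *-assoc w x y ⟩
    w * (x * y)  ≈⟨ *-congˡ xy≈xz ⟩
    w * (x * z)  ≈⟨ *-assoc w x z ⟨
    w * x * z    ≈⟨ *-congʳ wx≈1 ⟩
    1# * z       ≈⟨ *-identityˡ z ⟩
    z            ∎

  *-cancelʳ-# : ∀ {x} → x # 0# → ∀ {y z} → y * x ≈ z * x → y ≈ z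
  *-cancelʳ-# {x} x#0 yx≈zx =
    *-cancelˡ-# x#0 (trans (*-comm x _) (trans yx≈zx (*-comm _ x)))

  xy≈0⇒y≈0 : ∀ {x y} → x # 0# → x * y ≈ 0# → y ≈ 0#
  xy≈0⇒y≈0 {x} x#0 xy≈0 = *-cancelˡ-# x#0 (trans xy≈0 (sym (zeroʳ x)))

  ^-# : ∀ {x} n → x # 0# → x ^ n # 0#
  ^-# zero    x#0 = 1#0
  ^-# (suc n) x#0 = x#0y#0→xy#0 x#0 (^-# n x#0)

  1^n≈1 : ∀ n → 1# ^ n ≈ 1#
  1^n≈1 zero    = refl
  1^n≈1 (suc n) = trans (*-identityˡ _) (1^n≈1 n)

  prod-# : ∀ {n} (f : Vector Carrier n) → (∀ i → f i # 0#) → prod f # 0#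
  prod-# {zero}  f f#0 = 1#0
  prod-# {suc n} f f#0 = x#0y#0→xy#0 (f#0 zero) (prod-# (f ∘ suc) (f#0 ∘ suc))

  prod-zero : ∀ {n} (f : Vector Carrier n) i → f i ≈ 0# → prod f ≈ 0#
  prod-zero {suc n} f zero    fi≈0 = trans (*-congʳ fi≈0) (zeroˡ _)
  prod-zero {suc n} f (suc i) fi≈0 =
    trans (*-congˡ (prod-zero (f ∘ suc) i fi≈0)) (zeroʳ _)

  sum-zero : ∀ {n} (f : Vector Carrier n) → (∀ i → f i ≈ 0#) → sum f ≈ 0#
  sum-zero {n} f f≈0 = trans (Sum.sum-cong-≋ f≈0) (Sum.sum-replicate-zero n)

  sum-single : ∀ {n} (f : Vector Carrier n) i → (∀ j → j ≢ i → f j ≈ 0#) → sum f ≈ f i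
  sum-single {suc n} f i f≈0 = begin
    sum f                        ≈⟨ Sum.sum-remove {i = i} f ⟩
    f i + sum (VF.removeAt f i)  ≈⟨ +-congˡ (sum-zero _ λ j → f≈0 _ (Finₚ.punchInᵢ≢i i j)) ⟩
    f i + 0#                     ≈⟨ +-identityʳ _ ⟩
    f i                          ∎

  -- Horner's scheme builds the function and puts the leading coefficient 1 into the base case; the
  -- index is the degree. Working with functions avoids any comparison of coefficients.
  data MonicOf : ℕ → (Carrier → Carrier) → Set (c ⊔ ℓ₁) where
    constant : ∀ {φ} → (∀ x → φ x ≈ 1#) → MonicOf 0 φ
    horner   : ∀ {n φ ψ} y → MonicOf n φ → (∀ x → ψ x ≈ x * φ x + y) → MonicOf (suc n) ψ

  monic-^ : ∀ n → MonicOf n (_^ n)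
  monic-^ zero    = constant λ _ → refl
  monic-^ (suc n) = horner 0# (monic-^ n) λ x → sym (+-identityʳ _)

  x≈y+[x-y] : ∀ x y → x ≈ y + (x - y)
  x≈y+[x-y] x y = sym (begin
    y + (x - y)    ≈⟨ +-comm _ _ ⟩
    x - y + y      ≈⟨ +-assoc _ _ _ ⟩
    x + (- y + y)  ≈⟨ +-congˡ (-‿inverseˡ y) ⟩
    x + 0#         ≈⟨ +-identityʳ x ⟩
    x              ∎)

  -- Synthetic division: the outer factor x of the Horner step is split as r + (x - r), and the
  -- inner function is divided recursively.
  monic-divides : ∀ {n φ} → MonicOf (suc n) φ → ∀ r →
    ∃[ ψ ] MonicOf n ψ × (∀ x → φ x ≈ φ r + (x - r) * ψ x)
  monic-divides {zero} {φ} (horner {φ = ψ} y (constant ψ≈1) φ≈) r =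
    ψ , constant ψ≈1 , λ x → begin
      φ x                              ≈⟨ φ≈ x ⟩
      x * ψ x + y                      ≈⟨ +-congʳ (*-cong (x≈y+[x-y] x r) (trans (ψ≈1 x) (sym (ψ≈1 r)))) ⟩
      (r + (x - r)) * ψ r + y          ≈⟨ +-congʳ (distribʳ _ _ _) ⟩
      r * ψ r + (x - r) * ψ r + y      ≈⟨ +ₛ.xy∙z≈xz∙y _ _ _ ⟩
      r * ψ r + y + (x - r) * ψ r      ≈⟨ +-cong (φ≈ r) (*-congˡ (trans (ψ≈1 x) (sym (ψ≈1 r)))) ⟨
      φ r + (x - r) * ψ x              ∎
  monic-divides {suc n} {φ} (horner {φ = ψ} y ψ-monic φ≈) r
    with monic-divides ψ-monic r
  ... | χ , χ-monic , ψ≈ = (λ x → x * χ x + ψ r) , horner (ψ r) χ-monic (λ _ → refl) , λ x → begin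
      φ x                                                    ≈⟨ φ≈ x ⟩
      x * ψ x + y                                            ≈⟨ +-congʳ (*-congˡ (ψ≈ x)) ⟩
      x * (ψ r + (x - r) * χ x) + y                          ≈⟨ +-congʳ (distribˡ _ _ _) ⟩
      x * ψ r + x * ((x - r) * χ x) + y                      ≈⟨ +-congʳ (+-cong (*-congʳ (x≈y+[x-y] x r)) (*ₛ.x∙yz≈y∙xz _ _ _)) ⟩
      (r + (x - r)) * ψ r + (x - r) * (x * χ x) + y          ≈⟨ +-congʳ (+-congʳ (distribʳ _ _ _)) ⟩
      r * ψ r + (x - r) * ψ r + (x - r) * (x * χ x) + y      ≈⟨ +-congʳ (+-assoc _ _ _) ⟩
      r * ψ r + ((x - r) * ψ r + (x - r) * (x * χ x)) + y    ≈⟨ +ₛ.xy∙z≈xz∙y _ _ _ ⟩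
      r * ψ r + y + ((x - r) * ψ r + (x - r) * (x * χ x))    ≈⟨ +-cong (φ≈ r) (trans (distribˡ _ _ _) (+-comm _ _)) ⟨
      φ r + (x - r) * (x * χ x + ψ r)                        ∎

  -- Each root splits off a linear factor that is invertible at the other roots, so n + 1 roots
  -- would leave the constant 1 with a root.
  monic-roots : ∀ {n φ} → MonicOf n φ → (r : Vector Carrier (suc n)) →
    (∀ {i j} → i ≢ j → r i - r j # 0#) → ¬ (∀ i → φ (r i) ≈ 0#)
  monic-roots (constant φ≈1) r _ φr≈0 = #⇒≉0 1#0 (trans (sym (φ≈1 (r zero))) (φr≈0 zero))
  monic-roots {suc n} {φ} φ-monic@(horner _ _ _) r r-distinct φr≈0
    with monic-divides φ-monic (r zero)
  ... | ψ , ψ-monic , φ≈ =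
    monic-roots ψ-monic (r ∘ suc) (λ i≢j → r-distinct (i≢j ∘ Finₚ.suc-injective)) λ i →
      xy≈0⇒y≈0 (r-distinct {suc i} {zero} λ ()) (begin
        (r (suc i) - r zero) * ψ (r (suc i))               ≈⟨ +-identityˡ _ ⟨
        0# + (r (suc i) - r zero) * ψ (r (suc i))          ≈⟨ +-congʳ (φr≈0 zero) ⟨
        φ (r zero) + (r (suc i) - r zero) * ψ (r (suc i))  ≈⟨ φ≈ _ ⟨
        φ (r (suc i))                                      ≈⟨ φr≈0 (suc i) ⟩
        0#                                                 ∎)

-- Units and power sums of a finite field.

-- The field has q = n + 2 elements, so that n = q − 2 and there are n + 1 units.
module Finite {c ℓ₁ ℓ₂} (K : HeytingField c ℓ₁ ℓ₂) (n : ℕ)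
              (card : HasCardinality (HeytingField.setoid K) (suc (suc n))) where

  open Field K public
  private
    module card = Inverse card
    to-injective : ∀ {x y} → card.to x ≡ card.to y → x ≈ y
    to-injective = Injection.injective (Inverse⇒Injection card)

  infix 4 _≟_
  _≟_ : ∀ x y → Dec (x ≈ y)
  x ≟ y = map′ to-injective card.to-cong (card.to x Finₚ.≟ card.to y)

  -- Apartness from 0 means having an inverse, which a search through the finitely many elements
  -- decides; tightness turns a failed search into equality with 0.
  #0⊎≈0 : ∀ x → x # 0# ⊎ x ≈ 0#
  #0⊎≈0 x with Finₚ.any? (λ i → card.from i * x ≟ 1#)
  ... | yes (i , yx≈1) = inj₁ (inverse-# (trans (*-comm x _) yx≈1))
  ... | no  x-singular = inj₂ (proj₁ (tight x 0#) λ x#0 → case inverse x#0 of λ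
    { (y , yx≈1) → x-singular (card.to y , trans (*-congʳ (card.strictlyInverseʳ y)) yx≈1) })

  ≉0⇒# : ∀ {x} → ¬ x ≈ 0# → x # 0#
  ≉0⇒# {x} x≉0 with #0⊎≈0 x
  ... | inj₁ x#0 = x#0
  ... | inj₂ x≈0 = contradiction x≈0 x≉0

  #? : ∀ x → Dec (x # 0#)
  #? x with #0⊎≈0 x
  ... | inj₁ x#0 = yes x#0
  ... | inj₂ x≈0 = no λ x#0 → #⇒≉0 x#0 x≈0

  x≉y⇒x-y#0 : ∀ {x y} → ¬ x ≈ y → x - y # 0#
  x≉y⇒x-y#0 x≉y = ≉0⇒# (x≉y ∘ x∙y⁻¹≈ε⇒x≈y _ _)

  unit : Fin (suc n) → Carrier
  unit i = card.from (punchIn (card.to 0#) i)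

  unit-# : ∀ i → unit i # 0#
  unit-# i = ≉0⇒# λ u≈0 → Finₚ.punchInᵢ≢i (card.to 0#) i
    (≡.trans (≡.sym (card.strictlyInverseˡ _)) (card.to-cong u≈0))

  unit-injective : ∀ {i j} → unit i ≈ unit j → i ≡ j
  unit-injective =
    Finₚ.punchIn-injective (card.to 0#) _ _ ∘ Injection.injective (Inverse⇒Injection (Symmetry.inverse card))

  private
    to≢ : ∀ {x} → x # 0# → card.to 0# ≢ card.to x
    to≢ x#0 0≡x = #⇒≉0 x#0 (sym (to-injective 0≡x))

  index : ∀ {x} → x # 0# → Fin (suc n)
  index x#0 = punchOut (to≢ x#0)

  unit-index : ∀ {x} (x#0 : x # 0#) → unit (index x#0) ≈ x
  unit-index {x} x#0 = trans (card.from-cong (Finₚ.punchIn-punchOut (to≢ x#0))) (card.strictlyInverseʳ x)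

  scale : ∀ {x} → x # 0# → Fin (suc n) → Fin (suc n)
  scale x#0 i = index (x#0y#0→xy#0 x#0 (unit-# i))

  unit-scale : ∀ {x} (x#0 : x # 0#) i → unit (scale x#0 i) ≈ x * unit i
  unit-scale x#0 i = unit-index (x#0y#0→xy#0 x#0 (unit-# i))

  scale-inverse : ∀ {x y} (x#0 : x # 0#) (y#0 : y # 0#) → x * y ≈ 1# → ∀ i →
    scale x#0 (scale y#0 i) ≡ i
  scale-inverse {x} {y} x#0 y#0 xy≈1 i = unit-injective (begin
    unit (scale x#0 (scale y#0 i))  ≈⟨ unit-scale x#0 _ ⟩
    x * unit (scale y#0 i)          ≈⟨ *-congˡ (unit-scale y#0 i) ⟩
    x * (y * unit i)                ≈⟨ *-assoc x y _ ⟨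
    x * y * unit i                  ≈⟨ *-congʳ xy≈1 ⟩
    1# * unit i                     ≈⟨ *-identityˡ _ ⟩
    unit i                          ∎)

  module _ (M : CommutativeMonoid a ℓ) where

    private
      module M = CommutativeMonoid M
      module M-Sum = MonoidSum M

    -- Multiplication by a unit permutes the units. The monoid is arbitrary because `fermat` needs
    -- products and `power-sum` needs sums.
    sum-scale : (f : Carrier → M.Carrier) → (∀ {x y} → x ≈ y → f x M.≈ f y) →
      ∀ {x} → x # 0# → M-Sum.sum (f ∘ unit) M.≈ M-Sum.sum (λ i → f (x * unit i))
    sum-scale f f-cong {x} x#0 with inverse x#0
    ... | y , yx≈1 = M.trans (M-Sum.sum-permute (f ∘ unit) π)
      (M-Sum.sum-cong-≋ λ i → f-cong (unit-scale x#0 i))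
      where
      y#0 : y # 0#
      y#0 = inverse-# yx≈1
      π : Perm.Permutation (suc n) (suc n)
      π = Perm.permutation (scale x#0) (scale y#0)
        (scale-inverse x#0 y#0 (trans (*-comm x y) yx≈1)) (scale-inverse y#0 x#0 yx≈1)

  -- Replacing each unit u by x u multiplies the product of all units by x^(q - 1), yet only
  -- reorders it.
  fermat : ∀ {x} → x # 0# → x ^ suc n ≈ 1#
  fermat {x} x#0 = *-cancelʳ-# (prod-# unit unit-#) (begin
    x ^ suc n * prod unit                 ≈⟨ *-congʳ (Prod.sum-replicate (suc n)) ⟨
    prod {suc n} (λ _ → x) * prod unit    ≈⟨ Prod.∑-distrib-+ (λ _ → x) unit ⟨
    prod (λ i → x * unit i)               ≈⟨ sum-scale *-commutativeMonoid id id x#0 ⟨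
    prod unit                             ≈⟨ *-identityˡ _ ⟨
    1# * prod unit                        ∎)

  -- Some unit x has x^(e+1) ≠ 1, because X^(e+1) - 1 has at most e + 1 ≤ q - 2 roots. Scaling by x
  -- multiplies the sum by x^(e+1) and leaves it unchanged.
  power-sum : ∀ {e} → suc e ℕ.≤ n → sum (λ i → unit i ^ suc e) ≈ 0#
  power-sum {e} e<n with Finₚ.all? (λ i → unit i ^ suc e ≟ 1#)
  -- The bound e + 1 ≤ n supplies e + 2 units, one more than the degree allows.
  ... | yes all-roots = contradiction
    (λ i → trans (+-congʳ (all-roots (roots i))) (-‿inverseʳ 1#))
    (monic-roots (horner (- 1#) (monic-^ e) (λ _ → refl)) (unit ∘ roots)
      λ i≢j → x≉y⇒x-y#0 (i≢j ∘ Finₚ.inject≤-injective _ _ _ _ ∘ unit-injective))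
    where
    roots : Fin (suc (suc e)) → Fin (suc n)
    roots i = Fin.inject≤ i (ℕ.s≤s e<n)
  ... | no ¬all-roots with Finₚ.¬∀⟶∃¬ (suc n) _ (λ i → unit i ^ suc e ≟ 1#) ¬all-roots
  ... | j , x^e≉1 = xy≈0⇒y≈0 (x≉y⇒x-y#0 x^e≉1) (begin
    (x ^ suc e - 1#) * S              ≈⟨ [y-z]x≈yx-zx _ _ _ ⟩
    x ^ suc e * S - 1# * S            ≈⟨ +-cong invariant (-‿cong (*-identityˡ S)) ⟩
    S - S                             ≈⟨ -‿inverseʳ S ⟩
    0#                                ∎)
    where
    x S : Carrier
    x = unit j
    S = sum (λ i → unit i ^ suc e)
    invariant : x ^ suc e * S ≈ S
    invariant = begin
      x ^ suc e * S                             ≈⟨ *-distribˡ-sum (x ^ suc e) (λ i → unit i ^ suc e) ⟩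
      sum (λ i → x ^ suc e * unit i ^ suc e)    ≈⟨ Sum.sum-cong-≋ (λ i → ^-distrib-* x (unit i) (suc e)) ⟨
      sum (λ i → (x * unit i) ^ suc e)          ≈⟨ sum-scale +-commutativeMonoid (_^ suc e) (^-congˡ (suc e)) (unit-# j) ⟨
      S                                         ∎

-- Evaluation of formal polynomials, forms and substitutions.

module Polynomial {c ℓ₁ ℓ₂} (K : HeytingField c ℓ₁ ℓ₂) where

  open Field K

  private
    variable
      r d e : ℕ

  ⟦_⟧ᴹ : Vec ℕ r → Vector Carrier r → Carrier
  ⟦_⟧ᴹ = evalMonomial K

  ⟦_⟧ : Poly K r → Vector Carrier r → Carrier
  ⟦_⟧ = eval K

  ⟦⟧ᴹ-cong : (α : Vec ℕ r) → ∀ {x y} → (∀ i → x i ≈ y i) → ⟦ α ⟧ᴹ x ≈ ⟦ α ⟧ᴹ y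
  ⟦⟧ᴹ-cong α x≈y = Prod.sum-cong-≋ λ i → ^-congˡ (lookup α i) (x≈y i)

  ⟦⟧ᴹ-zero : ∀ r (x : Vector Carrier r) → ⟦ Vec.replicate r 0 ⟧ᴹ x ≈ 1#
  ⟦⟧ᴹ-zero zero    x = refl
  ⟦⟧ᴹ-zero (suc r) x = trans (*-identityˡ _) (⟦⟧ᴹ-zero r (x ∘ suc))

  ⟦⟧ᴹ-+ : (α β : Vec ℕ r) → ∀ x → ⟦ Vec.zipWith ℕ._+_ α β ⟧ᴹ x ≈ ⟦ α ⟧ᴹ x * ⟦ β ⟧ᴹ x
  ⟦⟧ᴹ-+ []      []      x = sym (*-identityˡ 1#)
  ⟦⟧ᴹ-+ (a ∷ α) (b ∷ β) x =
    trans (*-cong (^-homo-* (x zero) a b) (⟦⟧ᴹ-+ α β (x ∘ suc))) (*ₛ.interchange _ _ _ _)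

  ⟦⟧ᴹ-raise : (α : Vec ℕ r) → ∀ i a x →
    ⟦ Vec.updateAt α i (a ℕ.+_) ⟧ᴹ x ≈ x i ^ a * ⟦ α ⟧ᴹ x
  ⟦⟧ᴹ-raise (b ∷ α) zero    a x = trans (*-congʳ (^-homo-* (x zero) a b)) (*-assoc _ _ _)
  ⟦⟧ᴹ-raise (b ∷ α) (suc i) a x =
    trans (*-congˡ (⟦⟧ᴹ-raise α i a (x ∘ suc))) (*ₛ.x∙yz≈y∙xz _ _ _)

  ⟦⟧ᴹ-scale : (α : Vec ℕ r) → ∀ {κ x y} → (∀ i → x i ≈ κ * y i) →
    ⟦ α ⟧ᴹ x ≈ κ ^ Vec.sum α * ⟦ α ⟧ᴹ y
  ⟦⟧ᴹ-scale []      x≈κy = sym (*-identityˡ 1#)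
  ⟦⟧ᴹ-scale (a ∷ α) {κ} {x} {y} x≈κy = begin
    x zero ^ a * ⟦ α ⟧ᴹ (x ∘ suc)                              ≈⟨ *-cong (^-congˡ a (x≈κy zero)) (⟦⟧ᴹ-scale α (x≈κy ∘ suc)) ⟩
    (κ * y zero) ^ a * (κ ^ Vec.sum α * ⟦ α ⟧ᴹ (y ∘ suc))      ≈⟨ *-congʳ (^-distrib-* κ (y zero) a) ⟩
    κ ^ a * y zero ^ a * (κ ^ Vec.sum α * ⟦ α ⟧ᴹ (y ∘ suc))    ≈⟨ *ₛ.interchange _ _ _ _ ⟩
    κ ^ a * κ ^ Vec.sum α * (y zero ^ a * ⟦ α ⟧ᴹ (y ∘ suc))    ≈⟨ *-congʳ (^-homo-* κ a (Vec.sum α)) ⟨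
    κ ^ (a ℕ.+ Vec.sum α) * (y zero ^ a * ⟦ α ⟧ᴹ (y ∘ suc))    ∎

  sum-raise : (α : Vec ℕ r) → ∀ i a → Vec.sum (Vec.updateAt α i (a ℕ.+_)) ≡ a ℕ.+ Vec.sum α
  sum-raise (b ∷ α) zero    a = ℕₚ.+-assoc a b _
  sum-raise (b ∷ α) (suc i) a = ≡.trans (≡.cong (b ℕ.+_) (sum-raise α i a))
    (ℕ₊.x∙yz≈y∙xz b a _)

  sum-zeros : ∀ r → Vec.sum (Vec.replicate r 0) ≡ 0
  sum-zeros zero    = ≡.refl
  sum-zeros (suc r) = sum-zeros r

  sum-zipWith : (α β : Vec ℕ r) → Vec.sum (Vec.zipWith ℕ._+_ α β) ≡ Vec.sum α ℕ.+ Vec.sum β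
  sum-zipWith []      []      = ≡.refl
  sum-zipWith (a ∷ α) (b ∷ β) = ≡.trans (≡.cong (a ℕ.+ b ℕ.+_) (sum-zipWith α β))
    (ℕ₊.interchange a b _ _)

  ⟦⟧-cong : (f : Poly K r) → ∀ {x y} → (∀ i → x i ≈ y i) → ⟦ f ⟧ x ≈ ⟦ f ⟧ y
  ⟦⟧-cong []            x≈y = refl
  ⟦⟧-cong ((κ , α) ∷ f) x≈y = +-cong (*-congˡ (⟦⟧ᴹ-cong α x≈y)) (⟦⟧-cong f x≈y)

  ⟦⟧-+ : (f g : Poly K r) → ∀ x → ⟦ f ++ g ⟧ x ≈ ⟦ f ⟧ x + ⟦ g ⟧ x
  ⟦⟧-+ []      g x = sym (+-identityˡ _)
  ⟦⟧-+ (_ ∷ f) g x = trans (+-congˡ (⟦⟧-+ f g x)) (sym (+-assoc _ _ _))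

  ⟦⟧-· : ∀ κ (f : Poly K r) x → ⟦ _·ᴾ_ K κ f ⟧ x ≈ κ * ⟦ f ⟧ x
  ⟦⟧-· κ []      x = sym (zeroʳ κ)
  ⟦⟧-· κ (_ ∷ f) x = trans (+-cong (*-assoc _ _ _) (⟦⟧-· κ f x)) (sym (distribˡ _ _ _))

  ⟦⟧-neg : (f : Poly K r) → ∀ x → ⟦ -ᴾ_ K f ⟧ x ≈ - ⟦ f ⟧ x
  ⟦⟧-neg []      x = sym -0#≈0#
  ⟦⟧-neg (_ ∷ f) x =
    trans (+-cong (sym (-‿distribˡ-* _ _)) (⟦⟧-neg f x)) (-‿+-comm _ _)

  ⟦⟧-* : (f g : Poly K r) → ∀ x → ⟦ _*ᴾ_ K f g ⟧ x ≈ ⟦ f ⟧ x * ⟦ g ⟧ x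
  ⟦⟧-* []            g x = sym (zeroˡ _)
  ⟦⟧-* ((κ , α) ∷ f) g x = begin
    ⟦ row g ++ _*ᴾ_ K f g ⟧ x                        ≈⟨ ⟦⟧-+ (row g) _ x ⟩
    ⟦ row g ⟧ x + ⟦ _*ᴾ_ K f g ⟧ x                   ≈⟨ +-cong (row-eval g) (⟦⟧-* f g x) ⟩
    κ * ⟦ α ⟧ᴹ x * ⟦ g ⟧ x + ⟦ f ⟧ x * ⟦ g ⟧ x       ≈⟨ distribʳ _ _ _ ⟨
    (κ * ⟦ α ⟧ᴹ x + ⟦ f ⟧ x) * ⟦ g ⟧ x               ∎
    where
    row = List.map λ (μ , β) → κ * μ , Vec.zipWith ℕ._+_ α β
    row-eval : ∀ g → ⟦ row g ⟧ x ≈ κ * ⟦ α ⟧ᴹ x * ⟦ g ⟧ x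
    row-eval []            = sym (zeroʳ _)
    row-eval ((μ , β) ∷ g) = begin
      κ * μ * ⟦ Vec.zipWith ℕ._+_ α β ⟧ᴹ x + ⟦ row g ⟧ x       ≈⟨ +-cong (*-congˡ (⟦⟧ᴹ-+ α β x)) (row-eval g) ⟩
      κ * μ * (⟦ α ⟧ᴹ x * ⟦ β ⟧ᴹ x) + κ * ⟦ α ⟧ᴹ x * ⟦ g ⟧ x   ≈⟨ +-congʳ (*ₛ.interchange _ _ _ _) ⟩
      κ * ⟦ α ⟧ᴹ x * (μ * ⟦ β ⟧ᴹ x) + κ * ⟦ α ⟧ᴹ x * ⟦ g ⟧ x   ≈⟨ distribˡ _ _ _ ⟨
      κ * ⟦ α ⟧ᴹ x * (μ * ⟦ β ⟧ᴹ x + ⟦ g ⟧ x)                  ∎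

  -- Formal sums may list a monomial several times with cancelling coefficients; deleting all its
  -- terms at once leaves the other collected coefficients intact.
  without : Vec ℕ r → Poly K r → Poly K r
  without β []            = []
  without β ((κ , α) ∷ f) = if does (_≟ᴹ_ K α β) then without β f else (κ , α) ∷ without β f

  ⟦⟧-without : ∀ β (f : Poly K r) x → ⟦ f ⟧ x ≈ coeff K f β * ⟦ β ⟧ᴹ x + ⟦ without β f ⟧ x
  ⟦⟧-without β []            x = sym (trans (+-identityʳ _) (zeroˡ _))
  ⟦⟧-without β ((κ , α) ∷ f) x with _≟ᴹ_ K α β
  ... | yes ≡.refl = trans (+-congˡ (⟦⟧-without β f x))
    (trans (sym (+-assoc _ _ _)) (+-congʳ (sym (distribʳ _ _ _))))
  ... | no _ = begin
    κ * ⟦ α ⟧ᴹ x + ⟦ f ⟧ x                                           ≈⟨ +-congˡ (⟦⟧-without β f x) ⟩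
    κ * ⟦ α ⟧ᴹ x + (coeff K f β * ⟦ β ⟧ᴹ x + ⟦ without β f ⟧ x)      ≈⟨ +ₛ.x∙yz≈y∙xz _ _ _ ⟩
    coeff K f β * ⟦ β ⟧ᴹ x + (κ * ⟦ α ⟧ᴹ x + ⟦ without β f ⟧ x)      ≈⟨ +-congʳ (*-congʳ (+-identityˡ _)) ⟨
    (0# + coeff K f β) * ⟦ β ⟧ᴹ x + (κ * ⟦ α ⟧ᴹ x + ⟦ without β f ⟧ x)  ∎

  length-without : ∀ β (f : Poly K r) → length (without β f) ℕ.≤ length f
  length-without β []            = ℕ.z≤n
  length-without β ((κ , α) ∷ f) with _≟ᴹ_ K α β
  ... | yes _ = ℕₚ.m≤n⇒m≤1+n (length-without β f)
  ... | no  _ = ℕ.s≤s (length-without β f)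

  coeff-without-≡ : ∀ β (f : Poly K r) → coeff K (without β f) β ≈ 0#
  coeff-without-≡ β []            = refl
  coeff-without-≡ β ((κ , α) ∷ f) with _≟ᴹ_ K α β in eq
  ... | yes _ = coeff-without-≡ β f
  ... | no  _ rewrite eq = trans (+-identityˡ _) (coeff-without-≡ β f)

  coeff-without-≢ : ∀ {β} (f : Poly K r) {α} → α ≢ β → coeff K (without β f) α ≈ coeff K f α
  coeff-without-≢ []                         α≢β = refl
  coeff-without-≢ {β = β} ((κ , γ) ∷ f) {α} α≢β with _≟ᴹ_ K γ β
  ... | no _ = +-congˡ (coeff-without-≢ f α≢β)
  ... | yes ≡.refl with _≟ᴹ_ K γ α
  ...   | yes ≡.refl = contradiction ≡.refl α≢β
  ...   | no _       = trans (coeff-without-≢ f α≢β) (sym (+-identityˡ _))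

  -- Collecting the terms of one monomial at a time shortens the list of
  -- terms without changing the value.
  ⟦⟧-0 : ∀ n (f : Poly K r) → length f ℕ.≤ n → _≈ᴾ_ K f (0ᴾ K) → ∀ x → ⟦ f ⟧ x ≈ 0#
  ⟦⟧-0 n       []               _            f≈0 x = refl
  ⟦⟧-0 (suc n) f@((κ , β) ∷ f′) (ℕ.s≤s f′≤n) f≈0 x = begin
    ⟦ f ⟧ x                                         ≈⟨ ⟦⟧-without β f x ⟩
    coeff K f β * ⟦ β ⟧ᴹ x + ⟦ without β f ⟧ x      ≈⟨ +-cong (trans (*-congʳ (f≈0 β)) (zeroˡ _)) (⟦⟧-0 n (without β f) shorter rest≈0 x) ⟩
    0# + 0#                                         ≈⟨ +-identityˡ 0# ⟩
    0#                                              ∎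
    where
    shorter : length (without β f) ℕ.≤ n
    shorter with _≟ᴹ_ K β β
    ... | yes _  = ℕₚ.≤-trans (length-without β f′) f′≤n
    ... | no β≢β = contradiction ≡.refl β≢β
    rest≈0 : _≈ᴾ_ K (without β f) (0ᴾ K)
    rest≈0 α with _≟ᴹ_ K α β
    ... | yes ≡.refl = coeff-without-≡ β f
    ... | no  α≢β    = trans (coeff-without-≢ f α≢β) (f≈0 α)

  ⟦⟧-≈ᴾ : (f g : Poly K r) → _≈ᴾ_ K f g → ∀ x → ⟦ f ⟧ x ≈ ⟦ g ⟧ x
  ⟦⟧-≈ᴾ f g f≈g x = x∙y⁻¹≈ε⇒x≈y _ _ (begin
    ⟦ f ⟧ x - ⟦ g ⟧ x        ≈⟨ +-congˡ (⟦⟧-neg g x) ⟨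
    ⟦ f ⟧ x + ⟦ -ᴾ_ K g ⟧ x  ≈⟨ ⟦⟧-+ f (-ᴾ_ K g) x ⟨
    ⟦ f-g ⟧ x                ≈⟨ ⟦⟧-0 (length f-g) f-g ℕₚ.≤-refl f-g≈0 x ⟩
    0#                       ∎)
    where
    f-g = f ++ -ᴾ_ K g
    f-g≈0 : _≈ᴾ_ K f-g (0ᴾ K)
    f-g≈0 α = begin
      coeff K f-g α                       ≈⟨ coeff-+ K f (-ᴾ_ K g) α ⟩
      coeff K f α + coeff K (-ᴾ_ K g) α   ≈⟨ +-cong (f≈g α) (coeff-map K -_ -0#≈0# (λ _ _ → sym (-‿+-comm _ _)) g α) ⟩
      coeff K g α - coeff K g α           ≈⟨ -‿inverseʳ _ ⟩
      0#                                  ∎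

  -- Stricter than `Homogeneous`, which tolerates listed terms of other degrees that cancel; this
  -- version admits induction over the list of terms.
  Form : ℕ → Poly K r → Set c
  Form d = All λ (κ , α) → Vec.sum α ≡ d

  form-homogeneous : {f : Poly K r} → Form d f → Homogeneous K d f
  form-homogeneous []                                 α |α|≢d = refl
  form-homogeneous {f = (κ , β) ∷ f} (|β|≡d ∷ f-form) α |α|≢d with _≟ᴹ_ K β α
  ... | yes ≡.refl = contradiction |β|≡d |α|≢d
  ... | no _       = trans (+-identityˡ _) (form-homogeneous f-form α |α|≢d)

  form-++ : {f g : Poly K r} → Form d f → Form d g → Form d (f ++ g)
  form-++ = Allₚ.++⁺

  form-· : ∀ κ {f : Poly K r} → Form d f → Form d (_·ᴾ_ K κ f)
  form-· κ f-form = Allₚ.map⁺ f-form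

  form-neg : {f : Poly K r} → Form d f → Form d (-ᴾ_ K f)
  form-neg f-form = Allₚ.map⁺ f-form

  form-* : {f g : Poly K r} → Form d f → Form e g → Form (d ℕ.+ e) (_*ᴾ_ K f g)
  form-* []                                   g-form = []
  form-* {f = (κ , α) ∷ f} (|α|≡d ∷ f-form)   g-form = Allₚ.++⁺
    (Allₚ.map⁺ (All.map (λ {(_ , β)} |β|≡e → ≡.trans (sum-zipWith α β) (≡.cong₂ ℕ._+_ |α|≡d |β|≡e)) g-form))
    (form-* f-form g-form)

  ⟦⟧-scale : (f : Poly K r) → Form d f → ∀ {κ x y} → (∀ i → x i ≈ κ * y i) → ⟦ f ⟧ x ≈ κ ^ d * ⟦ f ⟧ y
  ⟦⟧-scale []            []                x≈κy = sym (zeroʳ _)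
  ⟦⟧-scale ((μ , α) ∷ f) (≡.refl ∷ f-form) x≈κy = trans
    (+-cong (trans (*-congˡ (⟦⟧ᴹ-scale α x≈κy)) (*ₛ.x∙yz≈y∙xz _ _ _)) (⟦⟧-scale f f-form x≈κy))
    (sym (distribˡ _ _ _))

  -- Passes from `Homogeneous` to `Form`: in a homogeneous sum the deleted terms cancel among
  -- themselves, so the values survive.
  truncate : ℕ → Poly K r → Poly K r
  truncate d []            = []
  truncate d ((κ , α) ∷ f) with Vec.sum α ℕₚ.≟ d
  ... | yes _ = (κ , α) ∷ truncate d f
  ... | no  _ = truncate d f

  truncate-form : ∀ d (f : Poly K r) → Form d (truncate d f)
  truncate-form d []            = []
  truncate-form d ((κ , α) ∷ f) with Vec.sum α ℕₚ.≟ d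
  ... | yes |α|≡d = |α|≡d ∷ truncate-form d f
  ... | no  _     = truncate-form d f

  coeff-truncate : (f : Poly K r) → ∀ {α} → Vec.sum α ≡ d → coeff K (truncate d f) α ≈ coeff K f α
  coeff-truncate         []            |α|≡d = refl
  coeff-truncate {d = d} ((κ , β) ∷ f) {α} |α|≡d with Vec.sum β ℕₚ.≟ d
  ... | yes _ = +-congˡ (coeff-truncate f |α|≡d)
  ... | no |β|≢d with _≟ᴹ_ K β α
  ...   | yes ≡.refl = contradiction |α|≡d |β|≢d
  ...   | no _       = trans (coeff-truncate f |α|≡d) (sym (+-identityˡ _))

  ⟦⟧-truncate : (f : Poly K r) → Homogeneous K d f → ∀ x → ⟦ truncate d f ⟧ x ≈ ⟦ f ⟧ x
  ⟦⟧-truncate {d = d} f f-hom = ⟦⟧-≈ᴾ (truncate d f) f λ α → case Vec.sum α ℕₚ.≟ d of λ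
    { (yes |α|≡d) → coeff-truncate f |α|≡d
    ; (no  |α|≢d) → trans (form-homogeneous (truncate-form d f) α |α|≢d) (sym (f-hom α |α|≢d)) }

  ⟦⟧-homogeneous : (f : Poly K r) → Homogeneous K d f → ∀ {κ x y} → (∀ i → x i ≈ κ * y i) →
    ⟦ f ⟧ x ≈ κ ^ d * ⟦ f ⟧ y
  ⟦⟧-homogeneous {d = d} f f-hom x≈κy = trans (sym (⟦⟧-truncate f f-hom _))
    (trans (⟦⟧-scale (truncate d f) (truncate-form d f) x≈κy) (*-congˡ (⟦⟧-truncate f f-hom _)))

  1ᴾ : Poly K r
  1ᴾ = (1# , Vec.replicate _ 0) ∷ []

  var : Fin r → Poly K r
  var i = (1# , Vec.updateAt (Vec.replicate _ 0) i (1 ℕ.+_)) ∷ []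

  form-1 : Form 0 (1ᴾ {r})
  form-1 {r} = sum-zeros r ∷ []

  form-var : (i : Fin r) → Form 1 (var i)
  form-var {r} i = ≡.trans (sum-raise (Vec.replicate r 0) i 1) (≡.cong suc (sum-zeros r)) ∷ []

  ⟦⟧-1 : (x : Vector Carrier r) → ⟦ 1ᴾ ⟧ x ≈ 1#
  ⟦⟧-1 {r} x = trans (+-identityʳ _) (trans (*-identityˡ _) (⟦⟧ᴹ-zero r x))

  ⟦⟧-var : ∀ i (x : Vector Carrier r) → ⟦ var i ⟧ x ≈ x i
  ⟦⟧-var {r} i x = begin
    1# * ⟦ Vec.updateAt (Vec.replicate r 0) i suc ⟧ᴹ x + 0#  ≈⟨ +-identityʳ _ ⟩
    1# * ⟦ Vec.updateAt (Vec.replicate r 0) i suc ⟧ᴹ x       ≈⟨ *-identityˡ _ ⟩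
    ⟦ Vec.updateAt (Vec.replicate r 0) i suc ⟧ᴹ x            ≈⟨ ⟦⟧ᴹ-raise (Vec.replicate r 0) i 1 x ⟩
    x i ^ 1 * ⟦ Vec.replicate r 0 ⟧ᴹ x                       ≈⟨ *-cong (*-identityʳ _) (⟦⟧ᴹ-zero r x) ⟩
    x i * 1#                                                 ≈⟨ *-identityʳ _ ⟩
    x i                                                      ∎

  -- Separating forms arise as products of linear factors; recording only the function and its
  -- degree spares their expansion into terms.
  Representable : ℕ → (Vector Carrier r → Carrier) → Set (c ⊔ ℓ₁)
  Representable {r} d φ = Σ (Poly K r) λ f → Form d f × (∀ x → ⟦ f ⟧ x ≈ φ x)

  representable-var : (i : Fin r) → Representable 1 (λ x → x i)
  representable-var i = var i , form-var i , ⟦⟧-var i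

  representable-· : ∀ κ {φ : Vector Carrier r → Carrier} → Representable d φ → Representable d (λ x → κ * φ x)
  representable-· κ (f , f-form , f≈φ) =
    _·ᴾ_ K κ f , form-· κ f-form , λ x → trans (⟦⟧-· κ f x) (*-congˡ (f≈φ x))

  representable-- : {φ ψ : Vector Carrier r → Carrier} →
    Representable d φ → Representable d ψ → Representable d (λ x → φ x - ψ x)
  representable-- (f , f-form , f≈φ) (g , g-form , g≈ψ) = f ++ -ᴾ_ K g , form-++ f-form (form-neg g-form) , λ x →
    trans (⟦⟧-+ f (-ᴾ_ K g) x) (+-cong (f≈φ x) (trans (⟦⟧-neg g x) (-‿cong (g≈ψ x))))

  representable-* : {φ ψ : Vector Carrier r → Carrier} →
    Representable d φ → Representable e ψ → Representable (d ℕ.+ e) (λ x → φ x * ψ x)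
  representable-* (f , f-form , f≈φ) (g , g-form , g≈ψ) = _*ᴾ_ K f g , form-* f-form g-form , λ x →
    trans (⟦⟧-* f g x) (*-cong (f≈φ x) (g≈ψ x))

  representable-∏ : ∀ {m} {φ : Fin m → Vector Carrier r → Carrier} →
    (∀ i → Representable d (φ i)) → Representable (m ℕ.* d) (λ x → prod λ i → φ i x)
  representable-∏ {m = zero}  φ-rep = 1ᴾ , form-1 , ⟦⟧-1
  representable-∏ {m = suc m} φ-rep = representable-* (φ-rep zero) (representable-∏ (φ-rep ∘ suc))

  -- Exponent vector after replacing the variable i by the variable σ i: exponents over the same
  -- target add up, which keeps the degree.
  substitute : ∀ {k} → (Fin r → Fin k) → Vec ℕ r → Vec ℕ k
  substitute σ []      = Vec.replicate _ 0
  substitute σ (a ∷ α) = Vec.updateAt (substitute (σ ∘ suc) α) (σ zero) (a ℕ.+_)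

  sum-substitute : ∀ {k} (σ : Fin r → Fin k) α → Vec.sum (substitute σ α) ≡ Vec.sum α
  sum-substitute {k = k} σ []      = sum-zeros k
  sum-substitute         σ (a ∷ α) = ≡.trans (sum-raise (substitute (σ ∘ suc) α) (σ zero) a)
    (≡.cong (a ℕ.+_) (sum-substitute (σ ∘ suc) α))

  ⟦⟧ᴹ-substitute : ∀ {k} (σ : Fin r → Fin k) α x → ⟦ substitute σ α ⟧ᴹ x ≈ ⟦ α ⟧ᴹ (x ∘ σ)
  ⟦⟧ᴹ-substitute {k = k} σ []      x = ⟦⟧ᴹ-zero k x
  ⟦⟧ᴹ-substitute         σ (a ∷ α) x = trans (⟦⟧ᴹ-raise (substitute (σ ∘ suc) α) (σ zero) a x)
    (*-congˡ (⟦⟧ᴹ-substitute (σ ∘ suc) α x))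

  -- Serves both to pull forms back to a torus and to lower degrees on a cycle, where the exchanged
  -- monomials agree only at points satisfying the relation recorded in `Good`.
  replaceMonomials : ∀ {k p} (h : Vector Carrier k → Vector Carrier r) (Good : Vector Carrier k → Set p) →
    (∀ α → Vec.sum α ≡ d → ∃[ γ ] Vec.sum γ ≡ e × (∀ x → Good x → ⟦ γ ⟧ᴹ x ≈ ⟦ α ⟧ᴹ (h x))) →
    (f : Poly K r) → Form d f → Σ (Poly K k) λ g → Form e g × (∀ x → Good x → ⟦ g ⟧ x ≈ ⟦ f ⟧ (h x))
  replaceMonomials h Good replace []            []                = [] , [] , λ _ _ → refl
  replaceMonomials h Good replace ((κ , α) ∷ f) (|α|≡d ∷ f-form)
    with replace α |α|≡d | replaceMonomials h Good replace f f-form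
  ... | γ , |γ|≡e , γ≈α | g , g-form , g≈f = (κ , γ) ∷ g , |γ|≡e ∷ g-form ,
    λ x x-good → +-cong (*-congˡ (γ≈α x x-good)) (g≈f x x-good)

  ideal-vanishes : (Z : PointSet K r) {f : Poly K r} → vanishingIdeal K Z f → VanishesOn K Z f
  ideal-vanishes Z (generator (_ , _ , f-vanishes)) P P∈Z = f-vanishes P P∈Z
  ideal-vanishes Z zeroᴵ P P∈Z = refl
  ideal-vanishes Z (+-closed {f} {g} f∈I g∈I) P P∈Z = trans (⟦⟧-+ f g _)
    (trans (+-cong (ideal-vanishes Z f∈I P P∈Z) (ideal-vanishes Z g∈I P P∈Z)) (+-identityˡ 0#))
  ideal-vanishes Z (*-closed h {f} f∈I) P P∈Z = trans (⟦⟧-* h f _)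
    (trans (*-congˡ (ideal-vanishes Z f∈I P P∈Z)) (zeroʳ _))
  ideal-vanishes Z (respects {f} {g} f≈g f∈I) P P∈Z =
    trans (sym (⟦⟧-≈ᴾ f g f≈g _)) (ideal-vanishes Z f∈I P P∈Z)

  ⟦⟧-linearCombination : ∀ (I : Poly K r → Set (c ⊔ ℓ₁ ⊔ ℓ₂)) {n} κ (v : Fin n → ∃ (Homogeneous K d)) x →
    ⟦ proj₁ (linearCombination K (gradedQuotient K I d) κ v) ⟧ x ≈ sum λ i → κ i * ⟦ proj₁ (v i) ⟧ x
  ⟦⟧-linearCombination I {zero}  κ v x = refl
  ⟦⟧-linearCombination I {suc n} κ v x =
    trans (⟦⟧-+ (_·ᴾ_ K (κ zero) (proj₁ (v zero))) _ x)
      (+-cong (⟦⟧-· (κ zero) (proj₁ (v zero)) x) (⟦⟧-linearCombination I (κ ∘ suc) (v ∘ suc) x))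

-- Counting, least witnesses and monomials of a given degree.

injective⇒surjective : ∀ {n} (f : Fin n → Fin n) → (∀ {i j} → f i ≡ f j → i ≡ j) →
  ∀ j → ∃[ i ] f i ≡ j
injective⇒surjective {suc n} f f-inj j with Finₚ.any? (λ i → f i Finₚ.≟ j)
... | yes hit = hit
-- Punching out the missed value would inject `Fin (suc n)` into `Fin n`.
... | no miss = contradiction
  (Finₚ.injective⇒≤ {f = λ i → punchOut (avoid i)} λ eq → f-inj (Finₚ.punchOut-injective (avoid _) (avoid _) eq))
  ℕₚ.1+n≰n
  where
  avoid : ∀ i → j ≢ f i
  avoid i j≡fi = miss (i , ≡.sym j≡fi)

funToFin-cong : ∀ {m n} {f g : Fin m → Fin n} → (∀ i → f i ≡ g i) → Fin.funToFin f ≡ Fin.funToFin g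
funToFin-cong {zero}  f≗g = ≡.refl
funToFin-cong {suc m} f≗g = ≡.cong₂ Fin.combine (f≗g zero) (funToFin-cong (f≗g ∘ suc))

module _ (S : Setoid a ℓ) (_≟_ : ∀ x y → Dec (Setoid._≈_ S x y)) where

  open Setoid S

  distinct-representatives : ∀ {m} (f : Fin m → Carrier) →
    ∃[ n ] Σ (Fin n → Carrier) λ g → (∀ {i j} → g i ≈ g j → i ≡ j) × (∀ i → ∃[ j ] g j ≈ f i)
  distinct-representatives {zero}  f = 0 , (λ ()) , (λ {i} → case i of λ ()) , λ ()
  distinct-representatives {suc m} f with distinct-representatives (f ∘ suc)
  ... | n , g , g-inj , g-hits with Finₚ.any? (λ j → g j ≟ f zero)
  ...   | yes hit = n , g , g-inj , λ { zero → hit ; (suc i) → g-hits i }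
  ...   | no miss = suc n , f zero VF.∷ g , inj , λ { zero → zero , refl ; (suc i) → let (j , eq) = g-hits i in suc j , eq }
    where
    inj : ∀ {i j} → (f zero VF.∷ g) i ≈ (f zero VF.∷ g) j → i ≡ j
    inj {zero}  {zero}  _  = ≡.refl
    inj {zero}  {suc j} eq = contradiction (j , sym eq) miss
    inj {suc i} {zero}  eq = contradiction (i , eq) miss
    inj {suc i} {suc j} eq = ≡.cong suc (g-inj eq)

  -- A parametrization may hit a projective point many times; repetitions are sieved out by
  -- decidable equality before counting.
  enumerated⇒cardinality : ∀ {m} (f : Fin m → Carrier) → (∀ x → ∃[ i ] f i ≈ x) → ∃[ n ] HasCardinality S n
  enumerated⇒cardinality f f-hits with distinct-representatives f
  ... | n , g , g-inj , g-hits = n , record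
    { to        = proj₁ ∘ hits
    ; from      = g
    ; to-cong   = λ {x} {y} x≈y → g-inj (trans (proj₂ (hits x)) (trans x≈y (sym (proj₂ (hits y)))))
    ; from-cong = λ { ≡.refl → refl }
    ; inverse   = (λ {j} {x} x≈gj → g-inj (trans (proj₂ (hits x)) x≈gj))
                , (λ { {x} ≡.refl → proj₂ (hits x) })
    }
    where
    hits : ∀ x → ∃[ j ] g j ≈ x
    hits x with f-hits x
    ... | i , fi≈x = let (j , gj≈fi) = g-hits i in j , trans gj≈fi fi≈x

least : (P : ℕ → Set a) → (∀ d → Dec (P d)) → ∀ b → P b → ∃[ d ] P d × (∀ d′ → P d′ → d ℕ.≤ d′)
least P P? zero    p = 0 , p , λ _ _ → ℕ.z≤n
least P P? (suc b) p with P? 0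
... | yes p₀ = 0 , p₀ , λ _ _ → ℕ.z≤n
... | no ¬p₀ with least (P ∘ suc) (P? ∘ suc) b p
...   | d , p-d , d-least = suc d , p-d , λ
  { zero p₀ → contradiction p₀ ¬p₀ ; (suc d′) p′ → ℕ.s≤s (d-least d′ p′) }

-- Makes the search for a form with given values finite: besides coefficients in a finite field,
-- only these exponent vectors occur.
monomials : ∀ r → ℕ → List (Vec ℕ r)
monomials zero    zero    = [] ∷ []
monomials zero    (suc d) = []
monomials (suc r) d       = concatMap (λ a → List.map (a ∷_) (monomials r (d ℕ.∸ a))) (upTo (suc d))

∈-monomials : ∀ {r} (α : Vec ℕ r) → α ∈ᴸ monomials r (Vec.sum α)
∈-monomials []      = here ≡.refl
∈-monomials (a ∷ α) = ∈ₚ.∈-concatMap⁺ _ (lose (∈ₚ.∈-upTo⁺ (ℕ.s≤s (ℕₚ.m≤m+n a _)))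
  (∈ₚ.∈-map⁺ (a ∷_) (≡.subst (λ d → α ∈ᴸ monomials _ d) (≡.sym (ℕₚ.m+n∸m≡n a (Vec.sum α))) (∈-monomials α))))

monomials-degree : ∀ r d → All (λ α → Vec.sum α ≡ d) (monomials r d)
monomials-degree zero    zero    = ≡.refl ∷ []
monomials-degree zero    (suc d) = []
monomials-degree (suc r) d       = Allₚ.concat⁺ (Allₚ.map⁺ (All.map degree-row (Allₚ.applyUpTo⁺₁ id (suc d) id)))
  where
  degree-row : ∀ {a} → a ℕ.< suc d → All (λ α → Vec.sum α ≡ d) (List.map (a ∷_) (monomials r (d ℕ.∸ a)))
  degree-row {a} (ℕ.s≤s a≤d) = Allₚ.map⁺ (All.map (λ |α|≡d-a → ≡.trans (≡.cong (a ℕ.+_) |α|≡d-a) (ℕₚ.m+[n∸m]≡n a≤d))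
    (monomials-degree r (d ℕ.∸ a)))

-- Hilbert function, interpolation and separation of points.

module Hilbert {c ℓ₁ ℓ₂} (K : HeytingField c ℓ₁ ℓ₂) (n : ℕ)
               (card : HasCardinality (HeytingField.setoid K) (suc (suc n))) where

  open Finite K n card
  open Polynomial K

  private
    variable
      r d : ℕ

  infix 4 _∼′_
  _∼′_ : Vector Carrier r → Vector Carrier r → Set _
  _∼′_ = _∼_ K

  ∼? : (x y : Vector Carrier r) → Dec (x ∼′ y)
  ∼? x y = map′
    (λ (j , x≈uy) → unit j , unit-# j , x≈uy)
    (λ (κ , κ#0 , x≈κy) → index κ#0 , λ i → trans (x≈κy i) (*-congʳ (sym (unit-index κ#0))))
    (Finₚ.any? λ j → Finₚ.all? λ i → x i ≟ unit j * y i)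

  Separates : ℕ → PointSet K r → Vector Carrier r → Set _
  Separates d Z x = ∃[ f ] Form d f × ¬ ⟦ f ⟧ x ≈ 0# × (∀ Q → Z Q → ¬ proj₁ Q ∼′ x → ⟦ f ⟧ (proj₁ Q) ≈ 0#)

  Separated : ℕ → PointSet K r → Set _
  Separated d Z = ∀ P → Z P → Separates d Z (proj₁ P)

  private
    module card = Inverse card

  module _ {m : ℕ} where

    decode : Fin (suc (suc n) ℕ.^ m) → Vector Carrier m
    decode c i = card.from (Fin.finToFun c i)

    encode : Vector Carrier m → Fin (suc (suc n) ℕ.^ m)
    encode x = Fin.funToFin (card.to ∘ x)

    encode-cong : ∀ {x y} → (∀ i → x i ≈ y i) → encode x ≡ encode y
    encode-cong x≈y = funToFin-cong (card.to-cong ∘ x≈y)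

    decode-encode : ∀ x i → decode (encode x) i ≈ x i
    decode-encode x i =
      trans (card.from-cong (Finₚ.finToFun-funToFin (card.to ∘ x) i)) (card.strictlyInverseʳ (x i))

    encode-decode : ∀ c → encode (decode c) ≡ c
    encode-decode c = ≡.trans
      (funToFin-cong {m} λ i → card.strictlyInverseˡ (Fin.finToFun c i))
      (Finₚ.funToFin-finToFin {m} c)

    encode-injective : ∀ {x y} → encode x ≡ encode y → ∀ i → x i ≈ y i
    encode-injective {x} {y} eq i = trans (sym (decode-encode x i))
      (trans (reflexive (≡.cong (λ c → decode c i) eq)) (decode-encode y i))

    -- By counting, since the field is finite; linearity plays no role.
    endo-surjective : (φ : Vector Carrier m → Vector Carrier m) →
      (∀ {x y} → (∀ i → φ x i ≈ φ y i) → ∀ i → x i ≈ y i) →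
      ∀ y → ∃[ x ] (∀ i → φ x i ≈ y i)
    endo-surjective φ φ-inj y
      with injective⇒surjective (encode ∘ φ ∘ decode)
             (λ {c} {c′} eq → ≡.trans (≡.sym (encode-decode c))
               (≡.trans (encode-cong (φ-inj (encode-injective eq))) (encode-decode c′)))
             (encode y)
    ... | c , eq = decode c , encode-injective eq

  kronecker : ∀ {m} → Fin m → Fin m → Carrier
  kronecker j i = if does (i Finₚ.≟ j) then 1# else 0#

  kronecker-≡ : ∀ {m} (j : Fin m) → kronecker j j ≈ 1#
  kronecker-≡ j = reflexive (≡.cong (λ b → if b then 1# else 0#) (dec-true (j Finₚ.≟ j) ≡.refl))

  kronecker-≢ : ∀ {m} {i j : Fin m} → i ≢ j → kronecker j i ≈ 0#
  kronecker-≢ {i = i} {j} i≢j = reflexive (≡.cong (λ b → if b then 1# else 0#) (dec-false (i Finₚ.≟ j) i≢j))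

  module _ {r N : ℕ} {Z : PointSet K r} (Z-card : HasCardinality (pointSetoid K Z) N) where

    private
      module Z = Inverse Z-card

    rep : Fin N → Vector Carrier r
    rep j = proj₁ (proj₁ (Z.from j))

    rep-injective : ∀ {i j} → rep i ∼′ rep j → i ≡ j
    rep-injective = Injection.injective (Inverse⇒Injection (Symmetry.inverse Z-card))

    rep-hits : ∀ P → Z P → ∃[ j ] proj₁ P ∼′ rep j
    rep-hits P P∈Z = Z.to (P , P∈Z) , ∼-sym K (Z.strictlyInverseʳ (P , P∈Z))

    vanishes-on-reps : (f : Poly K r) → Homogeneous K d f → (∀ j → ⟦ f ⟧ (rep j) ≈ 0#) → VanishesOn K Z f
    vanishes-on-reps f f-hom f≈0 P P∈Z with rep-hits P P∈Z
    ... | j , κ , _ , P≈κrep = trans (⟦⟧-homogeneous f f-hom P≈κrep)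
      (trans (*-congˡ (f≈0 j)) (zeroʳ _))

    -- Forms dual to evaluation at the representatives. Compared with `Separates`, the value 1 is
    -- fixed and the points are a finite index set, which makes the condition decidable.
    Interpolating : ℕ → Set (c ⊔ ℓ₁)
    Interpolating d = ∀ j → ∃[ f ] Form d f × (∀ i → ⟦ f ⟧ (rep i) ≈ kronecker j i)

    -- The scalar between a point and its representative enters as its d-th power, again a unit, so
    -- vanishing and nonvanishing both transfer.
    interpolating⇒separated : Interpolating d → Separated d Z
    interpolating⇒separated {d} interpolating P P∈Z with rep-hits P P∈Z
    ... | j , P∼rep@(κ , κ#0 , P≈κrep) with interpolating j
    ...   | δ , δ-form , δ≈ = δ , δ-form , δP≉0 , δQ≈0
      where
      value : ∀ i {κ x} → (∀ l → x l ≈ κ * rep i l) → ⟦ δ ⟧ x ≈ κ ^ d * kronecker j i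
      value i x≈κrep = trans (⟦⟧-scale δ δ-form x≈κrep) (*-congˡ (δ≈ i))
      δP≉0 : ¬ ⟦ δ ⟧ (proj₁ P) ≈ 0#
      δP≉0 δP≈0 = #⇒≉0 (^-# d κ#0) (begin
        κ ^ d                    ≈⟨ *-identityʳ _ ⟨
        κ ^ d * 1#               ≈⟨ *-congˡ (kronecker-≡ j) ⟨
        κ ^ d * kronecker j j    ≈⟨ value j P≈κrep ⟨
        ⟦ δ ⟧ (proj₁ P)          ≈⟨ δP≈0 ⟩
        0#                       ∎)
      δQ≈0 : ∀ Q → Z Q → ¬ proj₁ Q ∼′ proj₁ P → ⟦ δ ⟧ (proj₁ Q) ≈ 0#
      δQ≈0 Q Q∈Z Q≁P with rep-hits Q Q∈Z
      ... | i , Q∼rep@(μ , _ , Q≈μrep) =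
        trans (value i Q≈μrep) (trans (*-congˡ (kronecker-≢ i≢j)) (zeroʳ _))
        where
        i≢j : i ≢ j
        i≢j ≡.refl = Q≁P (∼-trans K Q∼rep (∼-sym K P∼rep))

    separated⇒interpolating : Separated d Z → Interpolating d
    separated⇒interpolating separated j with separated (proj₁ (Z.from j)) (proj₂ (Z.from j))
    ... | f , f-form , fj≉0 , f≈0 with inverse (≉0⇒# fj≉0)
    ...   | κ , κf≈1 = _·ᴾ_ K κ f , form-· κ f-form , λ i → trans (⟦⟧-· κ f (rep i)) (value i)
      where
      value : ∀ i → κ * ⟦ f ⟧ (rep i) ≈ kronecker j i
      value i with i Finₚ.≟ j
      ... | yes ≡.refl = κf≈1
      ... | no i≢j     = trans (*-congˡ (f≈0 _ (proj₂ (Z.from i)) (i≢j ∘ rep-injective))) (zeroʳ κ)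

    -- Evaluation at the representatives reads off the coefficients of a combination of
    -- interpolating forms, hence independence. A form f minus the combination with coefficients
    -- f(`rep` j) vanishes on all points, hence spanning.
    interpolating⇒hilbert : Interpolating d → HilbertFunction K Z d N
    interpolating⇒hilbert {d} interpolating = v , independent , spanning
      where
      v : Fin N → ∃ (Homogeneous K d)
      v j = proj₁ (interpolating j) , form-homogeneous (proj₁ (proj₂ (interpolating j)))
      V = gradedQuotient K (vanishingIdeal K Z) d
      open RawLeftModule V using (_+ᴹ_; -ᴹ_)
      value : ∀ κ i → ⟦ proj₁ (linearCombination K V κ v) ⟧ (rep i) ≈ κ i
      value κ i = begin
        ⟦ proj₁ (linearCombination K V κ v) ⟧ (rep i)  ≈⟨ ⟦⟧-linearCombination (vanishingIdeal K Z) κ v (rep i) ⟩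
        sum (λ j → κ j * ⟦ proj₁ (v j) ⟧ (rep i))      ≈⟨ Sum.sum-cong-≋ (λ j → *-congˡ (proj₂ (proj₂ (interpolating j)) i)) ⟩
        sum (λ j → κ j * kronecker j i)                ≈⟨ sum-single _ i (λ j j≢i → trans (*-congˡ (kronecker-≢ (j≢i ∘ ≡.sym))) (zeroʳ _)) ⟩
        κ i * kronecker i i                            ≈⟨ *-congˡ (kronecker-≡ i) ⟩
        κ i * 1#                                       ≈⟨ *-identityʳ _ ⟩
        κ i                                            ∎
      independent : LinearlyIndependent K V v
      independent κ comb∈I i = begin
        κ i                                                   ≈⟨ value κ i ⟨
        -- Equality with `0ᴹ` unfolds to membership of the combination with an empty list appended.
        ⟦ proj₁ (linearCombination K V κ v) ⟧ (rep i)         ≡⟨ ≡.cong (λ f → ⟦ f ⟧ (rep i)) (Listₚ.++-identityʳ (proj₁ (linearCombination K V κ v))) ⟨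
        ⟦ proj₁ (linearCombination K V κ v) ++ [] ⟧ (rep i)   ≈⟨ ideal-vanishes Z comb∈I _ (proj₂ (Z.from i)) ⟩
        0#                                                    ∎
      spanning : Spanning K V v
      spanning (f , f-hom) = κ , generator (d , proj₂ difference ,
        vanishes-on-reps (proj₁ difference) (proj₂ difference) λ i → begin
          ⟦ proj₁ difference ⟧ (rep i)                             ≈⟨ ⟦⟧-+ f _ (rep i) ⟩
          ⟦ f ⟧ (rep i) + ⟦ -ᴾ_ K (proj₁ combination) ⟧ (rep i)    ≈⟨ +-congˡ (⟦⟧-neg (proj₁ combination) (rep i)) ⟩
          ⟦ f ⟧ (rep i) - ⟦ proj₁ combination ⟧ (rep i)            ≈⟨ +-congˡ (-‿cong (value κ i)) ⟩
          ⟦ f ⟧ (rep i) - ⟦ f ⟧ (rep i)                            ≈⟨ -‿inverseʳ _ ⟩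
          0#                                                       ∎)
        where
        κ : Vector Carrier N
        κ j = ⟦ f ⟧ (rep j)
        combination difference : ∃ (Homogeneous K d)
        combination = linearCombination K V κ v
        difference = (f , f-hom) +ᴹ (-ᴹ combination)

    -- A combination of basis forms that vanishes at all representatives lies in the ideal, so
    -- evaluation is injective on coefficient vectors. It maps K^N to itself, hence is onto, and a
    -- preimage of the Kronecker vector gives the form.
    hilbert⇒interpolating : HilbertFunction K Z d N → Interpolating d
    hilbert⇒interpolating {d} (v , independent , _) j = truncate d f , truncate-form d f , λ i →
      trans (⟦⟧-truncate f (proj₂ (comb x)) (rep i)) (trans (φ-comb x i) (φx≈ i))
      where
      V = gradedQuotient K (vanishingIdeal K Z) d
      φ : Vector Carrier N → Vector Carrier N
      φ x i = sum λ l → x l * ⟦ proj₁ (v l) ⟧ (rep i)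
      comb : Vector Carrier N → ∃ (Homogeneous K d)
      comb x = linearCombination K V x v
      φ-comb : ∀ x i → ⟦ proj₁ (comb x) ⟧ (rep i) ≈ φ x i
      φ-comb x i = ⟦⟧-linearCombination (vanishingIdeal K Z) x v (rep i)
      φ-injective : ∀ {x y} → (∀ i → φ x i ≈ φ y i) → ∀ i → x i ≈ y i
      φ-injective {x} {y} φx≈φy i = x∙y⁻¹≈ε⇒x≈y _ _ (independent (λ l → x l - y l)
        (≡.subst (vanishingIdeal K Z) (≡.sym (Listₚ.++-identityʳ _))
          (generator (d , proj₂ (comb _) , vanishes-on-reps (proj₁ (comb _)) (proj₂ (comb _)) λ i → begin
            ⟦ proj₁ (comb (λ l → x l - y l)) ⟧ (rep i)                  ≈⟨ φ-comb _ i ⟩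
            sum (λ l → (x l - y l) * ⟦ proj₁ (v l) ⟧ (rep i))           ≈⟨ Sum.sum-cong-≋ {N} (λ l → trans (distribʳ _ (x l) _) (+-congˡ (trans (sym (-‿distribˡ-* _ _)) (sym (-1*x≈-x _))))) ⟩
            sum (λ l → x l * ⟦ proj₁ (v l) ⟧ (rep i) + - 1# * (y l * ⟦ proj₁ (v l) ⟧ (rep i)))  ≈⟨ Sum.∑-distrib-+ _ (λ l → - 1# * (y l * ⟦ proj₁ (v l) ⟧ (rep i))) ⟩
            φ x i + sum (λ l → - 1# * (y l * ⟦ proj₁ (v l) ⟧ (rep i)))  ≈⟨ +-congˡ (*-distribˡ-sum (- 1#) (λ l → y l * ⟦ proj₁ (v l) ⟧ (rep i))) ⟨
            φ x i + - 1# * φ y i                                        ≈⟨ +-congˡ (-1*x≈-x _) ⟩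
            φ x i - φ y i                                               ≈⟨ x≈y⇒x∙y⁻¹≈ε (φx≈φy i) ⟩
            0#                                                          ∎))) i)
      solution : ∃[ x ] (∀ i → φ x i ≈ kronecker j i)
      solution = endo-surjective φ φ-injective (kronecker j)
      x = proj₁ solution
      φx≈ = proj₂ solution
      f = proj₁ (comb x)

    -- Membership in the span of the monomial evaluations, one coefficient at a time: a multiple of
    -- the head is subtracted and the tail must account for the rest. Recursion with a finite search
    -- at each step decides it.
    Spanned : List (Vec ℕ r) → Vector Carrier N → Set (c ⊔ ℓ₁)
    Spanned []       v = Lift c (∀ i → v i ≈ 0#)
    Spanned (α ∷ αs) v = ∃[ κ ] Spanned αs (λ i → v i - κ * ⟦ α ⟧ᴹ (rep i))

    spanned-resp : ∀ αs {v w} → (∀ i → v i ≈ w i) → Spanned αs v → Spanned αs w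
    spanned-resp []       v≈w (lift v≈0) = lift λ i → trans (sym (v≈w i)) (v≈0 i)
    spanned-resp (α ∷ αs) v≈w (κ , s)          = κ , spanned-resp αs (λ i → +-congʳ (v≈w i)) s

    spanned? : ∀ αs v → Dec (Spanned αs v)
    spanned? []       v = map′ lift lower (Finₚ.all? λ i → v i ≟ 0#)
    spanned? (α ∷ αs) v = map′ (λ (j , s) → card.from j , s)
      (λ (κ , s) → card.to κ , spanned-resp αs (λ i → +-congˡ (-‿cong (*-congʳ (sym (card.strictlyInverseʳ κ))))) s)
      (Finₚ.any? λ j → spanned? αs (λ i → v i - card.from j * ⟦ α ⟧ᴹ (rep i)))

    spanned⇒form : ∀ {αs} → All (λ α → Vec.sum α ≡ d) αs → ∀ {v} → Spanned αs v →
      ∃[ f ] Form d f × (∀ i → ⟦ f ⟧ (rep i) ≈ v i)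
    spanned⇒form []                      (lift v≈0) = [] , [] , λ i → sym (v≈0 i)
    spanned⇒form {αs = α ∷ _} (|α|≡d ∷ αs-degree) {v} (κ , s) with spanned⇒form αs-degree s
    ... | f , f-form , f≈ = (κ , α) ∷ f , |α|≡d ∷ f-form , λ i → trans (+-congˡ (f≈ i)) (sym (x≈y+[x-y] (v i) _))

    zero-spanned : ∀ αs {v} → (∀ i → v i ≈ 0#) → Spanned αs v
    zero-spanned []       v≈0 = lift v≈0
    zero-spanned (α ∷ αs) v≈0 = 0# , zero-spanned αs λ i →
      trans (+-cong (v≈0 i) (trans (-‿cong (zeroˡ _)) -0#≈0#)) (+-identityˡ 0#)

    -- A repeated monomial is absorbed into the scalar already chosen for it.
    term-spanned : ∀ {αs α} → α ∈ᴸ αs → ∀ κ {v} → Spanned αs v → Spanned αs (λ i → κ * ⟦ α ⟧ᴹ (rep i) + v i)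
    term-spanned {α = α} (here {xs = βs} ≡.refl) κ {v} (μ , s) = κ + μ , spanned-resp βs (λ i → sym (begin
      κ * m i + v i - (κ + μ) * m i                ≈⟨ +-congˡ (-‿cong (distribʳ _ _ _)) ⟩
      κ * m i + v i - (κ * m i + μ * m i)          ≈⟨ +-congˡ (-‿+-comm _ _) ⟨
      κ * m i + v i + (- (κ * m i) - μ * m i)      ≈⟨ +ₛ.interchange _ _ _ _ ⟩
      κ * m i - κ * m i + (v i - μ * m i)          ≈⟨ +-congʳ (-‿inverseʳ _) ⟩
      0# + (v i - μ * m i)                         ≈⟨ +-identityˡ _ ⟩
      v i - μ * m i                                ∎)) s
      where
      m : Fin N → Carrier
      m i = ⟦ α ⟧ᴹ (rep i)
    term-spanned (there {xs = βs} α∈βs) κ (μ , s) = μ ,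
      spanned-resp βs (λ i → sym (+-assoc _ _ _)) (term-spanned α∈βs κ s)

    form⇒spanned : (f : Poly K r) → Form d f → Spanned (monomials r d) (⟦ f ⟧ ∘ rep)
    form⇒spanned []            []                = zero-spanned (monomials r _) λ _ → refl
    form⇒spanned ((κ , α) ∷ f) (≡.refl ∷ f-form) = term-spanned (∈-monomials α) κ (form⇒spanned f f-form)

    interpolating? : ∀ d → Dec (Interpolating d)
    interpolating? d = map′
      (λ spanned j → spanned⇒form (monomials-degree r d) (spanned j))
      (λ interpolating j → case interpolating j of λ (f , f-form , f≈) →
        spanned-resp (monomials r d) f≈ (form⇒spanned f f-form))
      (Finₚ.all? λ j → spanned? (monomials r d) (kronecker j))

    separated⇒regularity : ∀ d → Separated d Z → (∀ d′ → Separated d′ Z → d ℕ.≤ d′) → IsRegularityIndex K Z d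
    separated⇒regularity d separated d-least = N , Z-card ,
      interpolating⇒hilbert (separated⇒interpolating separated) ,
      λ d′ → d-least d′ ∘ interpolating⇒separated ∘ hilbert⇒interpolating

    separated⇒∃regularity : Separated d Z → ∃[ ρ ] Separated ρ Z × IsRegularityIndex K Z ρ
    separated⇒∃regularity {d} separated
      with least Interpolating interpolating? d (separated⇒interpolating separated)
    ... | ρ , interpolating , ρ-least = ρ , interpolating⇒separated interpolating ,
      separated⇒regularity ρ (interpolating⇒separated interpolating)
        (λ d′ → ρ-least d′ ∘ separated⇒interpolating)

-- Weighted sums over the torus and products of linear factors.

module Torus {c ℓ₁ ℓ₂} (K : HeytingField c ℓ₁ ℓ₂) (n : ℕ)
             (card : HasCardinality (HeytingField.setoid K) (suc (suc n))) where

  open Finite K n card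
  open Polynomial K
  open Hilbert K n card

  private
    variable
      r d k : ℕ

  Units : Vector Carrier r → Set ℓ₂
  Units x = ∀ i → x i # 0#

  module _ {m : ℕ} (u : Vector Carrier m) where

    -- The weighted sum Σ t₁⋯tₖ φ(t) over tuples of entries of `u`, nested one variable at a time so
    -- that monomials factor.
    ∫ : ∀ k → (Vector Carrier k → Carrier) → Carrier
    ∫ zero    φ = φ VF.[]
    ∫ (suc k) φ = sum λ i → u i * ∫ k (λ t → φ (u i VF.∷ t))

    ∫-cong : ∀ k {φ ψ} → (∀ t → φ t ≈ ψ t) → ∫ k φ ≈ ∫ k ψ
    ∫-cong zero    φ≈ψ = φ≈ψ VF.[]
    ∫-cong (suc k) φ≈ψ = Sum.sum-cong-≋ {m} λ i → *-congˡ (∫-cong k λ t → φ≈ψ (u i VF.∷ t))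

    ∫-+ : ∀ k φ ψ → ∫ k (λ t → φ t + ψ t) ≈ ∫ k φ + ∫ k ψ
    ∫-+ zero    φ ψ = refl
    ∫-+ (suc k) φ ψ = trans
      (Sum.sum-cong-≋ {m} λ i → trans (*-congˡ (∫-+ k (λ t → φ (u i VF.∷ t)) (λ t → ψ (u i VF.∷ t)))) (distribˡ _ _ _))
      (Sum.∑-distrib-+ (λ i → u i * ∫ k (λ t → φ (u i VF.∷ t))) (λ i → u i * ∫ k (λ t → ψ (u i VF.∷ t))))

    ∫-* : ∀ k κ φ → ∫ k (λ t → κ * φ t) ≈ κ * ∫ k φ
    ∫-* zero    κ φ = refl
    ∫-* (suc k) κ φ = trans
      (Sum.sum-cong-≋ {m} λ i → trans (*-congˡ (∫-* k κ λ t → φ (u i VF.∷ t))) (*ₛ.x∙yz≈y∙xz _ _ _))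
      (sym (*-distribˡ-sum κ (λ i → u i * ∫ k (λ t → φ (u i VF.∷ t)))))

    ∫-zero : Units u → ∀ k {φ} → (∀ t → Units t → φ t ≈ 0#) → ∫ k φ ≈ 0#
    ∫-zero u#0 zero        φ≈0 = φ≈0 VF.[] λ ()
    ∫-zero u#0 (suc k) {φ} φ≈0 = sum-zero (λ i → u i * ∫ k (λ t → φ (u i VF.∷ t))) λ i → trans
      (*-congˡ (∫-zero u#0 k λ t t#0 → φ≈0 (u i VF.∷ t) λ { zero → u#0 i ; (suc j) → t#0 j }))
      (zeroʳ _)

    -- All tuples except (1,...,1) contribute 0, and at that one the weight is 1. Agreement with
    -- (1,...,1) is asked pointwise because the tuples are functions built entry by entry.
    ∫-single : Units u → (∀ {i j} → u i ≈ u j → i ≡ j) → ∀ o → u o ≈ 1# → ∀ k {φ y} →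
      (∀ t → Units t → ∀ i → ¬ t i ≈ 1# → φ t ≈ 0#) → (∀ t → (∀ i → t i ≈ 1#) → φ t ≈ y) → ∫ k φ ≈ y
    ∫-single u#0 u-inj o uo≈1 zero            φ≈0 φ≈y = φ≈y VF.[] λ ()
    ∫-single u#0 u-inj o uo≈1 (suc k) {φ} {y} φ≈0 φ≈y = begin
      sum (λ i → u i * ∫ k (λ t → φ (u i VF.∷ t)))   ≈⟨ sum-single (λ i → u i * ∫ k (λ t → φ (u i VF.∷ t))) o others ⟩
      u o * ∫ k (λ t → φ (u o VF.∷ t))               ≈⟨ *-cong uo≈1 (∫-single u#0 u-inj o uo≈1 k tail-0 tail-1) ⟩
      1# * y                                         ≈⟨ *-identityˡ y ⟩
      y                                              ∎
      where
      units : ∀ j {t} → Units {k} t → Units (u j VF.∷ t)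
      units j t#0 zero    = u#0 j
      units j t#0 (suc i) = t#0 i
      others : ∀ j → j ≢ o → u j * ∫ k (λ t → φ (u j VF.∷ t)) ≈ 0#
      others j j≢o = trans
        (*-congˡ (∫-zero u#0 k λ t t#0 → φ≈0 (u j VF.∷ t) (units j t#0) zero
          λ uj≈1 → j≢o (u-inj (trans uj≈1 (sym uo≈1)))))
        (zeroʳ _)
      tail-0 : ∀ t → Units t → ∀ i → ¬ t i ≈ 1# → φ (u o VF.∷ t) ≈ 0#
      tail-0 t t#0 i = φ≈0 (u o VF.∷ t) (units o t#0) (suc i)
      tail-1 : ∀ t → (∀ i → t i ≈ 1#) → φ (u o VF.∷ t) ≈ y
      tail-1 t t≈1 = φ≈y (u o VF.∷ t) λ { zero → uo≈1 ; (suc i) → t≈1 i }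

    -- The weight u i raises every exponent by one, so that an exponent
    -- below e is killed by its power sum.
    ∫-monomial : ∀ {e} → (∀ {a} → a ℕ.< e → sum (λ i → u i ^ suc a) ≈ 0#) →
      ∀ k (α : Vec ℕ k) → Vec.sum α ℕ.< k ℕ.* e → ∫ k ⟦ α ⟧ᴹ ≈ 0#
    ∫-monomial {e} power-sum (suc k) (a ∷ α) |α|<ke = begin
      sum (λ i → u i * ∫ k (λ t → u i ^ a * ⟦ α ⟧ᴹ t))   ≈⟨ Sum.sum-cong-≋ {m} (λ i → trans (*-congˡ (∫-* k (u i ^ a) ⟦ α ⟧ᴹ)) (sym (*-assoc _ _ _))) ⟩
      sum (λ i → u i ^ suc a * ∫ k ⟦ α ⟧ᴹ)               ≈⟨ *-distribʳ-sum (∫ k ⟦ α ⟧ᴹ) (λ i → u i ^ suc a) ⟨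
      sum (λ i → u i ^ suc a) * ∫ k ⟦ α ⟧ᴹ               ≈⟨ product≈0 (ℕₚ.<-≤-connex a e) ⟩
      0#                                                 ∎
      where
      -- If the first exponent is below e, its power sum is 0; otherwise it uses up at least e of
      -- the total, and the remaining exponents sum to less than k e.
      product≈0 : a ℕ.< e ⊎ e ℕ.≤ a → sum (λ i → u i ^ suc a) * ∫ k ⟦ α ⟧ᴹ ≈ 0#
      product≈0 (inj₁ a<e) = trans (*-congʳ (power-sum a<e)) (zeroˡ _)
      product≈0 (inj₂ e≤a) = trans (*-congˡ (∫-monomial power-sum k α
        (ℕₚ.+-cancelˡ-< e _ _ (ℕₚ.≤-<-trans (ℕₚ.+-monoˡ-≤ (Vec.sum α) e≤a) |α|<ke)))) (zeroʳ _)

    ∫-form : ∀ {e} → (∀ {a} → a ℕ.< e → sum (λ i → u i ^ suc a) ≈ 0#) →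
      ∀ k (f : Poly K (suc k)) → Form d f → d ℕ.< k ℕ.* e → ∫ k (λ t → ⟦ f ⟧ (1# VF.∷ t)) ≈ 0#
    ∫-form power-sum k []                []                d<ke = trans
      (∫-cong k λ _ → sym (zeroʳ 0#)) (trans (∫-* k 0# (λ _ → 0#)) (zeroˡ _))
    ∫-form power-sum k ((κ , a ∷ α) ∷ f) (≡.refl ∷ f-form) d<ke = begin
      ∫ k (λ t → κ * (1# ^ a * ⟦ α ⟧ᴹ t) + ⟦ f ⟧ (1# VF.∷ t))              ≈⟨ ∫-+ k (λ t → κ * (1# ^ a * ⟦ α ⟧ᴹ t)) (λ t → ⟦ f ⟧ (1# VF.∷ t)) ⟩
      ∫ k (λ t → κ * (1# ^ a * ⟦ α ⟧ᴹ t)) + ∫ k (λ t → ⟦ f ⟧ (1# VF.∷ t))  ≈⟨ +-cong term (∫-form power-sum k f f-form d<ke) ⟩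
      0# + 0#                                                              ≈⟨ +-identityˡ 0# ⟩
      0#                                                                   ∎
      where
      term : ∫ k (λ t → κ * (1# ^ a * ⟦ α ⟧ᴹ t)) ≈ 0#
      term = begin
        ∫ k (λ t → κ * (1# ^ a * ⟦ α ⟧ᴹ t))  ≈⟨ ∫-cong k (λ t → sym (*-assoc _ _ _)) ⟩
        ∫ k (λ t → κ * 1# ^ a * ⟦ α ⟧ᴹ t)    ≈⟨ ∫-* k (κ * 1# ^ a) ⟦ α ⟧ᴹ ⟩
        κ * 1# ^ a * ∫ k ⟦ α ⟧ᴹ              ≈⟨ *-congˡ (∫-monomial power-sum k α (ℕₚ.≤-<-trans (ℕₚ.m≤n+m _ a) d<ke)) ⟩
        κ * 1# ^ a * 0#                      ≈⟨ zeroʳ _ ⟩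
        0#                                   ∎

  -- In a smaller degree the weighted sum of f(1, t) would be both f(1,...,1) and 0.
  isolating-degree : (f : Poly K (suc k)) → Form d f → ¬ ⟦ f ⟧ (λ _ → 1#) ≈ 0# →
    (∀ y → Units y → ¬ y ∼′ (λ _ → 1#) → ⟦ f ⟧ y ≈ 0#) → k ℕ.* n ℕ.≤ d
  isolating-degree {k} f f-form f1≉0 f≈0 = ℕₚ.≮⇒≥ λ d<kn → f1≉0 (trans
    (sym (∫-single unit unit-# unit-injective (index 1#0) (unit-index 1#0) k
      (λ t t#0 i ti≉1 → f≈0 (1# VF.∷ t) (λ { zero → 1#0 ; (suc j) → t#0 j })
        -- Coordinate 0 of y is 1, which determines the scalar; proportionality to (1,...,1) would
        -- then force every entry of t to be 1.
        λ (κ , _ , y≈κ) → ti≉1 (trans (y≈κ (suc i)) (sym (y≈κ zero))))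
      (λ t t≈1 → ⟦⟧-cong f λ { zero → refl ; (suc i) → t≈1 i })))
    (∫-form unit power-sum k f f-form d<kn))

  -- y ↦ y ∘ σ embeds the torus linearly in Z, so that separating forms
  -- pull back to the torus without change of degree.
  separated-degree : {Z : PointSet K r} (σ : Fin r → Fin (suc k)) → (∀ j → ∃[ i ] σ i ≡ j) →
    (∀ y (y#0 : Units y) i → Z (y ∘ σ , i , y#0 (σ i))) → Separated d Z → k ℕ.* n ℕ.≤ d
  separated-degree {k = k} {Z = Z} σ σ-surj Z-torus separated
    with separated ((λ _ → 1#) , proj₁ (σ-surj zero) , 1#0) (Z-torus (λ _ → 1#) (λ _ → 1#0) _)
  ... | f , f-form , f1≉0 , f≈0
    with replaceMonomials (_∘ σ) Units
      (λ α |α|≡d → substitute σ α , ≡.trans (sum-substitute σ α) |α|≡d , λ x _ → ⟦⟧ᴹ-substitute σ α x) f f-form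
  ... | g , g-form , g≈f = isolating-degree g g-form (f1≉0 ∘ trans (sym (g≈f _ λ _ → 1#0)))
    λ y y#0 y≁1 → trans (g≈f y y#0) (f≈0 (y ∘ σ , i₀ , y#0 (σ i₀)) (Z-torus y y#0 i₀)
      λ (κ , κ#0 , y≈κ) → y≁1 (κ , κ#0 , λ j → let (i , σi≡j) = σ-surj j in
        ≡.subst (λ j → y j ≈ κ * 1#) σi≡j (y≈κ i)))
    where
    i₀ = proj₁ (σ-surj zero)

  all⊎∃¬ : ∀ {p m} {P : Fin m → Set p} → (∀ i → Dec (P i)) → (∀ i → P i) ⊎ (∃[ i ] ¬ P i)
  all⊎∃¬ P? with Finₚ.all? P?
  ... | yes all = inj₁ all
  ... | no ¬all = inj₂ (Finₚ.¬∀⟶∃¬ _ _ P? ¬all)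

  -- `punchIn l` runs through the indices other than l, so the n linear factors exclude every ratio
  -- of units except `unit l`.
  factor-# : ∀ l {y z} → z # 0# → y ≈ unit l * z → ∀ j → ¬ y - unit (punchIn l j) * z ≈ 0#
  factor-# l z#0 y≈lz j y-z≈0 = Finₚ.punchInᵢ≢i l j (unit-injective
    (*-cancelʳ-# z#0 (trans (sym (x∙y⁻¹≈ε⇒x≈y _ _ y-z≈0)) y≈lz)))

  ratio : ∀ {y z} → y # 0# → z # 0# → ∃[ l ] y ≈ unit l * z
  ratio {y} {z} y#0 z#0 with inverse z#0
  ... | w , wz≈1 = index yw#0 , (begin
    y                        ≈⟨ *-identityʳ y ⟨
    y * 1#                   ≈⟨ *-congˡ wz≈1 ⟨
    y * (w * z)              ≈⟨ *-assoc _ _ _ ⟨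
    y * w * z                ≈⟨ *-congʳ (unit-index yw#0) ⟨
    unit (index yw#0) * z    ∎)
    where
    yw#0 : y * w # 0#
    yw#0 = x#0y#0→xy#0 y#0 (inverse-# wz≈1)

  factor-0 : ∀ l {y z} → y # 0# → z # 0# → ¬ y ≈ unit l * z → ∃[ j ] y - unit (punchIn l j) * z ≈ 0#
  factor-0 l {y} {z} y#0 z#0 y≉lz = punchOut l≢l′ , x≈y⇒x∙y⁻¹≈ε
    (trans y≈l′z (reflexive (≡.cong (λ l → unit l * z) (≡.sym (Finₚ.punchIn-punchOut l≢l′)))))
    where
    l′ : Fin (suc n)
    l′ = proj₁ (ratio y#0 z#0)
    y≈l′z : y ≈ unit l′ * z
    y≈l′z = proj₂ (ratio y#0 z#0)
    l≢l′ : l ≢ l′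
    l≢l′ l≡l′ = y≉lz (trans y≈l′z (*-congʳ (reflexive (≡.cong unit (≡.sym l≡l′)))))

  same-ratios⇒∼ : {x y : Vector Carrier (suc k)} (l : Fin k → Fin (suc n)) → x zero # 0# → y zero # 0# →
    (∀ i → x (suc i) ≈ unit (l i) * x zero) → (∀ i → y (suc i) ≈ unit (l i) * y zero) → x ∼′ y
  same-ratios⇒∼ {k} l x₀#0 y₀#0 x≈lx y≈ly =
    ∼-trans K (normalize x₀#0 x≈lx) (∼-sym K (normalize y₀#0 y≈ly))
    where
    normalize : ∀ {z} → z zero # 0# → (∀ i → z (suc i) ≈ unit (l i) * z zero) → z ∼′ (1# VF.∷ (unit ∘ l))
    normalize z₀#0 z≈lz = _ , z₀#0 , λ
      { zero → sym (*-identityʳ _) ; (suc i) → trans (z≈lz i) (*-comm _ _) }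

  representable⇒separates : {Z : PointSet K r} {x : Vector Carrier r} {φ : Vector Carrier r → Carrier} →
    Representable d φ → ¬ φ x ≈ 0# → (∀ Q → Z Q → ¬ proj₁ Q ∼′ x → φ (proj₁ Q) ≈ 0#) → Separates d Z x
  representable⇒separates (f , f-form , f≈φ) φx≉0 φ≈0 = f , f-form ,
    φx≉0 ∘ trans (sym (f≈φ _)) , λ Q Q∈Z Q≁x → trans (f≈φ _) (φ≈0 Q Q∈Z Q≁x)

  -- ∏ (Xᵢ₊₁ − c X₀) over i and over the units c other than xᵢ₊₁ / x₀.
  subtorus-separated : {Z : PointSet K (suc k)} → (∀ P → Z P → Units (proj₁ P)) → Separated (k ℕ.* n) Z
  subtorus-separated {k} {Z} Z-units P@(x , _) P∈Z =
    representable⇒separates (≡.subst (λ d → Representable (k ℕ.* d) φ) (ℕₚ.*-identityʳ n) φ-rep) φP≉0 φQ≈0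
    where
    x#0 : Units x
    x#0 = Z-units P P∈Z
    l : Fin k → Fin (suc n)
    l i = proj₁ (ratio (x#0 (suc i)) (x#0 zero))
    x≈lx : ∀ i → x (suc i) ≈ unit (l i) * x zero
    x≈lx i = proj₂ (ratio (x#0 (suc i)) (x#0 zero))
    φ : Vector Carrier (suc k) → Carrier
    φ y = prod λ i → prod λ j → y (suc i) - unit (punchIn (l i) j) * y zero
    φ-rep : Representable (k ℕ.* (n ℕ.* 1)) φ
    φ-rep = representable-∏ λ i → representable-∏ λ j → representable--
      (representable-var (suc i)) (representable-· (unit (punchIn (l i) j)) (representable-var zero))
    φP≉0 : ¬ φ x ≈ 0#
    φP≉0 = #⇒≉0 (prod-# {k} _ λ i → prod-# {n} _ λ j → ≉0⇒# (factor-# (l i) (x#0 zero) (x≈lx i) j))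
    φQ≈0 : ∀ Q → Z Q → ¬ proj₁ Q ∼′ x → φ (proj₁ Q) ≈ 0#
    φQ≈0 (y , y₀) Q∈Z Q≁P = case all⊎∃¬ (λ i → y (suc i) ≟ unit (l i) * y zero) of λ
      { (inj₁ y≈ly)       → contradiction (same-ratios⇒∼ l (y#0 zero) (x#0 zero) y≈ly x≈lx) Q≁P
      ; (inj₂ (i , y≉ly)) → prod-zero (λ i → prod λ j → y (suc i) - unit (punchIn (l i) j) * y zero) i
          (let (j , factor≈0) = factor-0 (l i) (y#0 (suc i)) (y#0 zero) y≉ly in
            prod-zero (λ j → y (suc i) - unit (punchIn (l i) j) * y zero) j factor≈0) }
      where
      y#0 : Units y
      y#0 = Z-units (y , y₀) Q∈Z

  parametrized⇒cardinality : {Z : PointSet K r} {m : ℕ}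
    (point : (t : Vector Carrier m) → Units t → Σ (Point K r) Z) →
    (∀ {t u} t#0 u#0 → (∀ i → t i ≈ u i) → proj₁ (proj₁ (point t t#0)) ∼′ proj₁ (proj₁ (point u u#0))) →
    (∀ P → Z P → ∃₂ λ t t#0 → proj₁ (proj₁ (point t t#0)) ∼′ proj₁ P) →
    ∃[ N ] HasCardinality (pointSetoid K Z) N
  parametrized⇒cardinality {Z = Z} {m} point point-cong point-hits =
    enumerated⇒cardinality (pointSetoid K Z) (λ P Q → ∼? (proj₁ (proj₁ P)) (proj₁ (proj₁ Q)))
      (λ c → point (toUnits (decode c)) (toUnits-# (decode c)))
      λ (P , P∈Z) → let (t , t#0 , t∼P) = point-hits P P∈Z in
        encode t , ∼-trans K (point-cong _ t#0 (λ i → toUnits-id t#0 i)) t∼P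
    where
    -- Codes range over all of K^m; the default 1 in place of 0 makes every code name a point, while
    -- tuples of units are unchanged.
    toUnit : Carrier → Carrier
    toUnit x with #? x
    ... | yes _ = x
    ... | no  _ = 1#
    toUnits : Vector Carrier m → Vector Carrier m
    toUnits x i = toUnit (x i)
    toUnits-# : ∀ x → Units (toUnits x)
    toUnits-# x i with #? (x i)
    ... | yes xi#0 = xi#0
    ... | no  _    = 1#0
    toUnits-id : ∀ {t} → Units t → ∀ i → toUnits (decode (encode t)) i ≈ t i
    toUnits-id {t} t#0 i with #? (decode (encode t) i)
    ... | yes _   = decode-encode t i
    ... | no ¬x#0 = contradiction (#-resp-≈ (sym (decode-encode t i)) (t#0 i)) ¬x#0

  torus-units : ∀ P → projectiveTorus K r P → Units (proj₁ P)
  torus-units P (t , t#0 , κ , κ#0 , x≈κt) i = #-resp-≈ (sym (x≈κt i)) (x#0y#0→xy#0 κ#0 (t#0 i))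

  torus-cardinality : ∀ k → ∃[ N ] HasCardinality (pointSetoid K (projectiveTorus K (suc k))) N
  torus-cardinality k = parametrized⇒cardinality
    (λ t t#0 → (t , zero , t#0 zero) , t , t#0 , ∼-refl K)
    (λ _ _ t≈u → 1# , 1#0 , λ i → trans (t≈u i) (sym (*-identityˡ _)))
    (λ P (t , t#0 , P∼t) → t , t#0 , ∼-sym K P∼t)

  torus-regularity : ∀ k → IsRegularityIndex K (projectiveTorus K (suc k)) (k ℕ.* n)
  torus-regularity k = separated⇒regularity (proj₂ (torus-cardinality k)) (k ℕ.* n)
    (subtorus-separated torus-units)
    (λ d → separated-degree id (λ j → j , ≡.refl) (λ y y#0 i → y , y#0 , ∼-refl K))

  module _ {v s : ℕ} (G : SimpleGraph v s) where

    open SimpleGraph G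

    edgeProduct : Vector Carrier v → Vector Carrier s
    edgeProduct t e = t (end₁ e) * t (end₂ e)

    edgeProduct-# : ∀ {t} → Units t → Units (edgeProduct t)
    edgeProduct-# t#0 e = x#0y#0→xy#0 (t#0 (end₁ e)) (t#0 (end₂ e))

    toric-units : ∀ P → toricSet K G P → Units (proj₁ P)
    toric-units P (t , t#0 , κ , κ#0 , x≈κt) e =
      #-resp-≈ (sym (x≈κt e)) (x#0y#0→xy#0 κ#0 (edgeProduct-# t#0 e))

    toric-cardinality : Fin s → ∃[ N ] HasCardinality (pointSetoid K (toricSet K G)) N
    toric-cardinality e = parametrized⇒cardinality
      (λ t t#0 → (edgeProduct t , e , edgeProduct-# t#0 e) , t , t#0 , ∼-refl K)
      (λ _ _ t≈u → 1# , 1#0 , λ e → trans (*-cong (t≈u (end₁ e)) (t≈u (end₂ e))) (sym (*-identityˡ _)))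
      (λ P (t , t#0 , P∼t) → t , t#0 , ∼-sym K P∼t)

-- Decidable edge sets and the sides of a bipartition.

subset : ∀ {p n} {P : Fin n → Set p} → (∀ i → Dec (P i)) → Subset n
subset P? = Vec.tabulate (λ i → does (P? i))

∈-subset⁺ : ∀ {p n} {P : Fin n → Set p} (P? : ∀ i → Dec (P i)) {i} → P i → i ∈ subset P?
∈-subset⁺ P? {i} p = Vecₚ.lookup⇒[]= i _ (≡.trans (Vecₚ.lookup∘tabulate _ i) (dec-true (P? i) p))

∈-subset⁻ : ∀ {p n} {P : Fin n → Set p} (P? : ∀ i → Dec (P i)) {i} → i ∈ subset P? → P i
∈-subset⁻ P? {i} i∈ with P? i | ≡.trans (≡.sym (Vecₚ.lookup∘tabulate (λ i → does (P? i)) i)) (Vecₚ.[]=⇒lookup i∈)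
... | yes p | _ = p

-- An injection instead of a count: it can be restricted to the required number of vertices and then
-- labels the torus coordinates.
EmbeddedIn : ∀ {n} → (Fin n → Bool) → Bool → ℕ → Set
EmbeddedIn {n} side b a = Σ (Fin a → Fin n) λ g → (∀ {i j} → g i ≡ g j → i ≡ j) × (∀ i → side (g i) ≡ b)

module _ {n} (side : Fin (suc n) → Bool) {b : Bool} {a : ℕ} where

  embed-zero : side zero ≡ b → EmbeddedIn (side ∘ suc) b a → EmbeddedIn side b (suc a)
  embed-zero side₀≡b (g , g-inj , g-side) = zero VF.∷ (suc ∘ g) , inj , λ { zero → side₀≡b ; (suc i) → g-side i }
    where
    inj : ∀ {i j} → (zero VF.∷ (suc ∘ g)) i ≡ (zero VF.∷ (suc ∘ g)) j → i ≡ j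
    inj {zero}  {zero}  _  = ≡.refl
    inj {zero}  {suc j} ()
    inj {suc i} {zero}  ()
    inj {suc i} {suc j} eq = ≡.cong suc (g-inj (Finₚ.suc-injective eq))

  embed-suc : EmbeddedIn (side ∘ suc) b a → EmbeddedIn side b a
  embed-suc (g , g-inj , g-side) = suc ∘ g , g-inj ∘ Finₚ.suc-injective , g-side

sides : ∀ {n} (side : Fin n → Bool) →
  ∃₂ λ a a′ → a ℕ.+ a′ ≡ n × EmbeddedIn side true a × EmbeddedIn side false a′
sides {zero}  side = 0 , 0 , ≡.refl , ((λ ()) , (λ {i} → case i of λ ()) , λ ()) , ((λ ()) , (λ {i} → case i of λ ()) , λ ())
sides {suc n} side with side zero in eq | sides (side ∘ suc)
... | true  | a , a′ , a+a′≡n , left , right = suc a , a′ , ≡.cong suc a+a′≡n , embed-zero side eq left , embed-suc side right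
... | false | a , a′ , a+a′≡n , left , right =
  a , suc a′ , ≡.trans (ℕₚ.+-suc a a′) (≡.cong suc a+a′≡n) , embed-suc side left , embed-zero side eq right

-- The sides together have 2k vertices, so one of them has at least k; surplus vertices are dropped.
large-side : ∀ {k} (side : Fin (2 ℕ.* k) → Bool) → ∃[ b ] EmbeddedIn side b k
large-side {k} side = case sides side of λ (a , a′ , a+a′≡2k , left , right) →
  case ℕₚ.<-≤-connex a k of λ
    { (inj₁ a<k) → false , shrink right (ℕₚ.+-cancelˡ-≤ k k a′ (begin
        k ℕ.+ k          ≡⟨ ≡.cong (k ℕ.+_) (ℕₚ.+-identityʳ k) ⟨
        2 ℕ.* k          ≡⟨ a+a′≡2k ⟨
        a ℕ.+ a′         ≤⟨ ℕₚ.+-monoˡ-≤ a′ (ℕₚ.<⇒≤ a<k) ⟩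
        k ℕ.+ a′         ∎))
    ; (inj₂ k≤a) → true , shrink left k≤a }
  where
  open ℕₚ.≤-Reasoning
  shrink : ∀ {b a} → EmbeddedIn side b a → k ℕ.≤ a → EmbeddedIn side b k
  shrink (g , g-inj , g-side) k≤a = (λ i → g (Fin.inject≤ i k≤a)) ,
    Finₚ.inject≤-injective k≤a k≤a _ _ ∘ g-inj , λ i → g-side _

-- Toric sets of bipartite and of complete bipartite graphs.

module Toric {c ℓ₁ ℓ₂} (K : HeytingField c ℓ₁ ℓ₂) (n : ℕ)
             (card : HasCardinality (HeytingField.setoid K) (suc (suc n))) where

  open Finite K n card
  open Polynomial K
  open Hilbert K n card
  open Torus K n card

  module _ {v s : ℕ} (G : SimpleGraph v s) where

    open SimpleGraph G

    -- Give the vertices outside side b the value 1: each edge then takes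
    -- the value of its end on side b.
    toric-degree : ∀ {k d} → Bipartite G → (∀ u → ∃[ e ] Incident e u) →
      (∀ (side : Fin v → Bool) → ∃[ b ] EmbeddedIn side b (suc k)) →
      Separated d (toricSet K G) → k ℕ.* n ℕ.≤ d
    toric-degree {k} (side , bipartite) incident large = go (large side)
      where
      go : ∀ {d} → ∃[ b ] EmbeddedIn side b (suc k) → Separated d (toricSet K G) → k ℕ.* n ℕ.≤ d
      go (b , g , g-inj , g-side) = separated-degree σ σ-surj λ y y#0 i →
        t y , t-# y#0 , 1# , 1#0 , λ e → trans (sym (edgeProduct-t y e)) (sym (*-identityˡ _))
        where
        -- Vertices outside the chosen ones default to coordinate 0; the points stay in the toric
        -- set, and `σ` stays onto thanks to the chosen vertices.
        preimage : Fin v → Fin (suc k)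
        preimage u with Finₚ.any? (λ j → g j Finₚ.≟ u)
        ... | yes (j , _) = j
        ... | no _        = zero
        preimage-g : ∀ j → preimage (g j) ≡ j
        preimage-g j with Finₚ.any? (λ i → g i Finₚ.≟ g j)
        ... | yes (_ , gi≡gj) = g-inj gi≡gj
        ... | no miss         = contradiction (j , ≡.refl) miss
        σ : Fin s → Fin (suc k)
        σ e = if does (side (end₁ e) Boolₚ.≟ b) then preimage (end₁ e) else preimage (end₂ e)
        t : Vector Carrier (suc k) → Vector Carrier v
        t y u = if does (side u Boolₚ.≟ b) then y (preimage u) else 1#
        t-# : ∀ {y} → Units y → Units (t y)
        t-# y#0 u with side u Boolₚ.≟ b
        ... | yes _ = y#0 (preimage u)
        ... | no _  = 1#0
        edgeProduct-t : ∀ y e → edgeProduct G (t y) e ≈ y (σ e)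
        edgeProduct-t y e with side (end₁ e) Boolₚ.≟ b | side (end₂ e) Boolₚ.≟ b
        ... | yes p | yes q = contradiction (≡.trans p (≡.sym q)) (bipartite e)
        ... | yes p | no ¬q = *-identityʳ _
        ... | no ¬p | yes q = *-identityˡ _
        ... | no ¬p | no ¬q = contradiction
          (≡.trans (Boolₚ.¬-not ¬p) (≡.sym (Boolₚ.¬-not ¬q))) (bipartite e)
        σ-end : ∀ e u → Incident e u → side u ≡ b → σ e ≡ preimage u
        σ-end e u incident u-side with side (end₁ e) Boolₚ.≟ b | incident
        ... | yes p | inj₁ ≡.refl = ≡.refl
        ... | yes p | inj₂ ≡.refl = contradiction (≡.trans p (≡.sym u-side)) (bipartite e)
        ... | no ¬p | inj₁ ≡.refl = contradiction u-side ¬p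
        ... | no ¬p | inj₂ ≡.refl = ≡.refl
        σ-surj : ∀ j → ∃[ e ] σ e ≡ j
        σ-surj j = let (e , e-incident) = incident (g j) in
          e , ≡.trans (σ-end e (g j) e-incident (g-side j)) (preimage-g j)

    edgeProduct-joins : ∀ t e {u w} → Joins e u w → edgeProduct G t e ≈ t u * t w
    edgeProduct-joins t e (inj₁ (≡.refl , ≡.refl)) = refl
    edgeProduct-joins t e (inj₂ (≡.refl , ≡.refl)) = *-comm _ _

  module _ {k s : ℕ} (G : SimpleGraph (2 ℕ.* suc k) s) where

    toric-regularity : Bipartite G → HasPerfectMatching G → Separated (k ℕ.* n) (toricSet K G) →
      IsRegularityIndex K (toricSet K G) (k ℕ.* n)
    toric-regularity bipartite (_ , matching) separated =
      separated⇒regularity (proj₂ (toric-cardinality G (proj₁ (matching zero)))) (k ℕ.* n) separated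
        λ d → toric-degree G bipartite (λ u → let (e , (_ , e-incident) , _) = matching u in e , e-incident) large-side

  module _ {v s k : ℕ} (G : SimpleGraph v s) (complete : IsCompleteBipartite G (suc k) (suc k)) where

    open SimpleGraph G
    private
      module φ = Inverse (proj₁ complete)

      φ-injective : ∀ {x y} → φ.to x ≡ φ.to y → x ≡ y
      φ-injective = Injection.injective (Inverse⇒Injection (proj₁ complete))

      A B : Fin (suc k) → Fin v
      A i = φ.to (inj₁ i)
      B j = φ.to (inj₂ j)

      edge : Fin (suc k) → Fin (suc k) → Fin s
      edge i j = proj₁ (Equivalence.to (proj₂ complete _ _) (left-right {i = i} {j}))

      edge-joins : ∀ i j → Joins (edge i j) (A i) (B j)
      edge-joins i j = proj₂ (Equivalence.to (proj₂ complete _ _) (left-right {i = i} {j}))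

      edge-surjective : ∀ e → ∃₂ λ i j → edge i j ≡ e
      edge-surjective e = go _ _ (φ.strictlyInverseˡ (end₁ e)) (φ.strictlyInverseˡ (end₂ e))
        (Equivalence.from (proj₂ complete _ _) (e , inj₁ (≡.sym (φ.strictlyInverseˡ _) , ≡.sym (φ.strictlyInverseˡ _))))
        where
        go : ∀ x y → φ.to x ≡ end₁ e → φ.to y ≡ end₂ e → Across x y → ∃₂ λ i j → edge i j ≡ e
        go _ _ p q (left-right {i} {j}) = i , j , simple (edge-joins i j) (inj₁ (≡.sym p , ≡.sym q))
        go _ _ p q (right-left {i} {j}) = i , j , simple (edge-joins i j) (inj₂ (≡.sym p , ≡.sym q))

    complete⇒bipartite : Bipartite G
    complete⇒bipartite = isLeft ∘ φ.from , λ e → let (i , j , eq) = edge-surjective e in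
        ≡.subst (λ e → isLeft (φ.from (end₁ e)) ≢ isLeft (φ.from (end₂ e))) eq (differ (edge i j) (edge-joins i j))
      where
      isLeft : Fin (suc k) ⊎ Fin (suc k) → Bool
      isLeft (inj₁ _) = true
      isLeft (inj₂ _) = false
      differ : ∀ e {i j} → Joins e (A i) (B j) → isLeft (φ.from (end₁ e)) ≢ isLeft (φ.from (end₂ e))
      differ e {i} {j} (inj₁ (p , q)) eq rewrite p | q | φ.strictlyInverseʳ (inj₁ i) | φ.strictlyInverseʳ (inj₂ j) = case eq of λ ()
      differ e {i} {j} (inj₂ (p , q)) eq rewrite p | q | φ.strictlyInverseʳ (inj₁ i) | φ.strictlyInverseʳ (inj₂ j) = case eq of λ ()

    complete⇒matching : HasPerfectMatching G
    complete⇒matching = subset diagonal? , λ u → ≡.subst Matched (φ.strictlyInverseˡ u) (matched (φ.from u))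
      where
      Diagonal : Fin s → Set
      Diagonal e = ∃[ i ] edge i i ≡ e
      diagonal? : ∀ e → Dec (Diagonal e)
      diagonal? e = Finₚ.any? λ i → edge i i Finₚ.≟ e
      Matched : Fin v → Set
      Matched u = ∃[ e ] (e ∈ subset diagonal? × Incident e u) × (∀ {e′} → e′ ∈ subset diagonal? × Incident e′ u → e ≡ e′)
      ends : ∀ e {u w x} → Joins e u w → Incident e x → u ≡ x ⊎ w ≡ x
      ends e (inj₁ (≡.refl , ≡.refl)) inc = inc
      ends e (inj₂ (≡.refl , ≡.refl)) (inj₁ eq) = inj₂ eq
      ends e (inj₂ (≡.refl , ≡.refl)) (inj₂ eq) = inj₁ eq
      incident₁ : ∀ e {u w} → Joins e u w → Incident e u
      incident₁ e (inj₁ (p , q)) = inj₁ p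
      incident₁ e (inj₂ (p , q)) = inj₂ q
      incident₂ : ∀ e {u w} → Joins e u w → Incident e w
      incident₂ e (inj₁ (p , q)) = inj₂ q
      incident₂ e (inj₂ (p , q)) = inj₁ p
      uniqueᴬ : ∀ i {e} → Diagonal e → Incident e (A i) → edge i i ≡ e
      uniqueᴬ i (j , ≡.refl) inc = case ends (edge j j) (edge-joins j j) inc of λ
        { (inj₁ p) → case φ-injective {inj₁ j} {inj₁ i} p of λ { ≡.refl → ≡.refl }
        ; (inj₂ p) → case φ-injective {inj₂ j} {inj₁ i} p of λ () }
      uniqueᴮ : ∀ i {e} → Diagonal e → Incident e (B i) → edge i i ≡ e
      uniqueᴮ i (j , ≡.refl) inc = case ends (edge j j) (edge-joins j j) inc of λ
        { (inj₁ p) → case φ-injective {inj₁ j} {inj₂ i} p of λ ()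
        ; (inj₂ p) → case φ-injective {inj₂ j} {inj₂ i} p of λ { ≡.refl → ≡.refl } }
      matched : ∀ x → Matched (φ.to x)
      matched (inj₁ i) = edge i i , (∈-subset⁺ diagonal? (i , ≡.refl) , incident₁ (edge i i) (edge-joins i i)) ,
        λ (e∈ , inc) → uniqueᴬ i (∈-subset⁻ diagonal? e∈) inc
      matched (inj₂ i) = edge i i , (∈-subset⁺ diagonal? (i , ≡.refl) , incident₂ (edge i i) (edge-joins i i)) ,
        λ (e∈ , inc) → uniqueᴮ i (∈-subset⁻ diagonal? e∈) inc

    -- For each i the j-th wrong ratio in one part is paired with the j-th wrong ratio in the other.
    -- One factor thus excludes both, and k n factors serve the two parts together.
    complete-separated : Separated (k ℕ.* n) (toricSet K G)
    complete-separated P (t , t#0 , P∼t@(λₚ , λₚ#0 , x≈)) =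
      representable⇒separates (≡.subst (λ d → Representable (k ℕ.* d) φ) (ℕₚ.*-identityʳ n) φ-rep) φP≉0 φQ≈0
      where
      l m : Fin k → Fin (suc n)
      l i = proj₁ (ratio (t#0 (A (suc i))) (t#0 (A zero)))
      m i = proj₁ (ratio (t#0 (B (suc i))) (t#0 (B zero)))
      -- Four edges between two vertices of each part carry the expanded product; the scalar from
      -- `l` belongs to the first part, the one from `m` to the second.
      factor : Vector Carrier s → Fin k → Fin n → Carrier
      factor y i j = y (edge (suc i) (suc i)) - unit (punchIn (l i) j) * y (edge zero (suc i))
        - unit (punchIn (m i) j) * (y (edge (suc i) zero) - unit (punchIn (l i) j) * y (edge zero zero))
      φ : Vector Carrier s → Carrier
      φ y = prod λ i → prod λ j → factor y i j
      φ-rep : Representable (k ℕ.* (n ℕ.* 1)) φ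
      φ-rep = representable-∏ λ i → representable-∏ λ j → representable--
        (representable-- (representable-var (edge (suc i) (suc i)))
          (representable-· (unit (punchIn (l i) j)) (representable-var (edge zero (suc i)))))
        (representable-· (unit (punchIn (m i) j)) (representable-- (representable-var (edge (suc i) zero))
          (representable-· (unit (punchIn (l i) j)) (representable-var (edge zero zero)))))
      factor-out : ∀ c {y z} γ a b → y ≈ γ * a → z ≈ γ * b → y - c * z ≈ γ * (a - c * b)
      factor-out c {y} {z} γ a b y≈γa z≈γb = begin
        y - c * z                ≈⟨ +-cong y≈γa (-‿cong (trans (*-congˡ z≈γb) (*ₛ.x∙yz≈y∙xz c γ b))) ⟩
        γ * a - γ * (c * b)      ≈⟨ x[y-z]≈xy-xz γ a (c * b) ⟨
        γ * (a - c * b)          ∎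
      factor-value : ∀ y u μ → (∀ e → y e ≈ μ * edgeProduct G u e) → ∀ i j → factor y i j ≈
        (u (A (suc i)) - unit (punchIn (l i) j) * u (A zero)) * μ * (u (B (suc i)) - unit (punchIn (m i) j) * u (B zero))
      factor-value y u μ y≈ i j = factor-out _ _ _ _ (row (suc i)) (row zero)
        where
        a₀ = u (A (suc i)) - unit (punchIn (l i) j) * u (A zero)
        entry : ∀ i j → y (edge i j) ≈ μ * u (B j) * u (A i)
        entry i j = trans (y≈ (edge i j)) (trans (*-congˡ (trans (edgeProduct-joins G u (edge i j) (edge-joins i j)) (*-comm _ _))) (sym (*-assoc _ _ _)))
        row : ∀ i′ → y (edge (suc i) i′) - unit (punchIn (l i) j) * y (edge zero i′) ≈ a₀ * μ * u (B i′)
        row i′ = trans (factor-out _ _ _ _ (entry (suc i) i′) (entry zero i′)) (trans (*-comm _ _) (sym (*-assoc _ _ _)))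
      φP≉0 : ¬ φ (proj₁ P) ≈ 0#
      φP≉0 = #⇒≉0 (prod-# (λ i → prod λ j → factor (proj₁ P) i j) λ i → prod-# (factor (proj₁ P) i) λ j →
        #-resp-≈ (sym (factor-value (proj₁ P) t λₚ x≈ i j)) (x#0y#0→xy#0
          (x#0y#0→xy#0 (≉0⇒# (factor-# (l i) (t#0 (A zero)) (proj₂ (ratio (t#0 (A (suc i))) (t#0 (A zero)))) j)) λₚ#0)
          (≉0⇒# (factor-# (m i) (t#0 (B zero)) (proj₂ (ratio (t#0 (B (suc i))) (t#0 (B zero)))) j))))
      φQ≈0 : ∀ Q → toricSet K G Q → ¬ proj₁ Q ∼′ proj₁ P → φ (proj₁ Q) ≈ 0#
      φQ≈0 (y , _) (u , u#0 , Q∼u@(μ , μ#0 , y≈)) Q≁P =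
        -- A single wrong ratio annihilates a factor. If all ratios agree, each part is determined
        -- up to a scalar, and the product of the two scalars relates the edge coordinates.
        case all⊎∃¬ (λ i → u (A (suc i)) ≟ unit (l i) * u (A zero)) of λ
          { (inj₂ (i , u≉)) → let (j , eq) = factor-0 (l i) (u#0 (A (suc i))) (u#0 (A zero)) u≉ in
              vanish i j (trans (*-congʳ (trans (*-congʳ eq) (zeroˡ _))) (zeroˡ _))
          ; (inj₁ A-ratios) → case all⊎∃¬ (λ i → u (B (suc i)) ≟ unit (m i) * u (B zero)) of λ
            { (inj₂ (i , u≉)) → let (j , eq) = factor-0 (m i) (u#0 (B (suc i))) (u#0 (B zero)) u≉ in
                vanish i j (trans (*-congˡ eq) (zeroʳ _))
            ; (inj₁ B-ratios) → contradiction
                (∼-trans K Q∼u (∼-trans K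
                  (combine (same-ratios⇒∼ l (u#0 (A zero)) (t#0 (A zero)) A-ratios (λ i → proj₂ (ratio (t#0 (A (suc i))) (t#0 (A zero)))))
                    (same-ratios⇒∼ m (u#0 (B zero)) (t#0 (B zero)) B-ratios (λ i → proj₂ (ratio (t#0 (B (suc i))) (t#0 (B zero))))))
                  (∼-sym K P∼t))) Q≁P } }
        where
        vanish : ∀ i j → (u (A (suc i)) - unit (punchIn (l i) j) * u (A zero)) * μ * (u (B (suc i)) - unit (punchIn (m i) j) * u (B zero)) ≈ 0# → φ y ≈ 0#
        vanish i j eq = prod-zero (λ i → prod λ j → factor y i j) i (prod-zero (factor y i) j (trans (factor-value y u μ y≈ i j) eq))
        combine : (u ∘ A) ∼′ (t ∘ A) → (u ∘ B) ∼′ (t ∘ B) → edgeProduct G u ∼′ edgeProduct G t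
        combine (κ , κ#0 , uA≈) (κ′ , κ′#0 , uB≈) = κ * κ′ , x#0y#0→xy#0 κ#0 κ′#0 , λ e →
          let (i , j , eq) = edge-surjective e in
          ≡.subst (λ e → edgeProduct G u e ≈ κ * κ′ * edgeProduct G t e) eq (begin
            edgeProduct G u (edge i j)             ≈⟨ edgeProduct-joins G u (edge i j) (edge-joins i j) ⟩
            u (A i) * u (B j)                      ≈⟨ *-cong (uA≈ i) (uB≈ j) ⟩
            κ * t (A i) * (κ′ * t (B j))           ≈⟨ *ₛ.interchange _ _ _ _ ⟩
            κ * κ′ * (t (A i) * t (B j))           ≈⟨ *-congˡ (edgeProduct-joins G t (edge i j) (edge-joins i j)) ⟨
            κ * κ′ * edgeProduct G t (edge i j)    ∎)

-- Shifting exponents modulo q - 1.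

indicator : Bool → ℕ
indicator true  = 1
indicator false = 0

∑-rotate : ∀ m (f : ℕ → ℕ) → f 0 ℕ.+ ∑ {m} (λ i → f (suc (toℕ i))) ≡ ∑ {m} (f ∘ toℕ) ℕ.+ f m
∑-rotate zero    f = ℕₚ.+-identityʳ (f 0)
∑-rotate (suc m) f = ≡.trans (≡.cong (f 0 ℕ.+_) (∑-rotate m (f ∘ suc))) (≡.sym (ℕₚ.+-assoc (f 0) _ _))

module _ (n : ℕ) where

  private
    m = suc n

  -- Raising c by one drops the residue of c from the window and adds that of c + m, which is the
  -- same.
  ∑-residues : ∀ c → ∑ {m} (λ r → (c ℕ.+ toℕ r) % m) ≡ ∑ {m} (λ r → toℕ r % m)
  ∑-residues zero    = ≡.refl
  ∑-residues (suc c) = ≡.trans (ℕₚ.+-cancelˡ-≡ (c % m) _ _ (begin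
    c % m ℕ.+ ∑ {m} (λ r → (suc c ℕ.+ toℕ r) % m)          ≡⟨ ≡.cong₂ ℕ._+_ (≡.cong (_% m) (ℕₚ.+-identityʳ c)) (ℕΣ.sum-cong-≗ {m} λ r → ≡.cong (_% m) (ℕₚ.+-suc c (toℕ r))) ⟨
    f 0 ℕ.+ ∑ {m} (λ r → f (suc (toℕ r)))                  ≡⟨ ∑-rotate m f ⟩
    ∑ {m} (f ∘ toℕ) ℕ.+ f m                                ≡⟨ ≡.cong (∑ {m} (f ∘ toℕ) ℕ.+_) ([m+n]%n≡m%n c m) ⟩
    ∑ {m} (f ∘ toℕ) ℕ.+ c % m                              ≡⟨ ℕₚ.+-comm (∑ {m} (f ∘ toℕ)) (c % m) ⟩
    c % m ℕ.+ ∑ {m} (f ∘ toℕ)                              ∎)) (∑-residues c)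
    where
    open ≡.≡-Reasoning
    f : ℕ → ℕ
    f r = (c ℕ.+ r) % m

  ∑-mono-≤ : ∀ {s} {f g : Fin s → ℕ} → (∀ i → f i ℕ.≤ g i) → ∑ f ℕ.≤ ∑ g
  ∑-mono-≤ {zero}  f≤g = ℕ.z≤n
  ∑-mono-≤ {suc s} f≤g = ℕₚ.+-mono-≤ (f≤g zero) (∑-mono-≤ (f≤g ∘ suc))

  -- Equal totals exclude strict inequality everywhere; this is how an average yields one suitable
  -- shift.
  ∑-reflects-≤ : ∀ {s} (f g : Fin (suc s) → ℕ) → ∑ f ≡ ∑ g → ∃[ i ] f i ℕ.≤ g i
  ∑-reflects-≤ f g ∑f≡∑g with Finₚ.any? (λ i → f i ℕₚ.≤? g i)
  ... | yes found = found
  ... | no ¬found = contradiction (≡.sym ∑f≡∑g) (ℕₚ.<⇒≢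
    (ℕₚ.+-mono-<-≤ (g<f zero) (∑-mono-≤ (ℕₚ.<⇒≤ ∘ g<f ∘ suc))))
    where
    g<f : ∀ i → g i ℕ.< f i
    g<f i = ℕₚ.≰⇒> λ f≤g → ¬found (i , f≤g)

  even-congruent : ∀ a r → (a ℕ.+ r) % m ℕ.+ 0 ℕ.+ m ℕ.* ((a ℕ.+ r) / m) ≡ a ℕ.+ (r ℕ.+ 0) ℕ.+ m ℕ.* 0
  even-congruent a r = begin
    (a ℕ.+ r) % m ℕ.+ 0 ℕ.+ m ℕ.* ((a ℕ.+ r) / m)   ≡⟨ ≡.cong₂ ℕ._+_ (ℕₚ.+-identityʳ ((a ℕ.+ r) % m)) (ℕₚ.*-comm m ((a ℕ.+ r) / m)) ⟩
    (a ℕ.+ r) % m ℕ.+ (a ℕ.+ r) / m ℕ.* m           ≡⟨ m≡m%n+[m/n]*n (a ℕ.+ r) m ⟨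
    a ℕ.+ r                                         ≡⟨ ≡.cong (a ℕ.+_) (ℕₚ.+-identityʳ r) ⟨
    a ℕ.+ (r ℕ.+ 0)                                 ≡⟨ ℕₚ.+-identityʳ _ ⟨
    a ℕ.+ (r ℕ.+ 0) ℕ.+ 0                           ≡⟨ ≡.cong (a ℕ.+ (r ℕ.+ 0) ℕ.+_) (ℕₚ.*-zeroʳ m) ⟨
    a ℕ.+ (r ℕ.+ 0) ℕ.+ m ℕ.* 0                     ∎
    where open ≡.≡-Reasoning

  -- Modulo m = n + 1 the reflection x ↦ n - x is x ↦ -1 - x, and conjugating the shift by r with it
  -- gives the shift by -r. Multiples of m stand on both sides to avoid subtraction.
  odd-congruent : ∀ a r → let c = n ℕ.∸ a % m ℕ.+ r in
    n ℕ.∸ c % m ℕ.+ (r ℕ.+ 0) ℕ.+ m ℕ.* (a / m) ≡ a ℕ.+ 0 ℕ.+ m ℕ.* (c / m)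
  odd-congruent a r = ℕₚ.+-cancelʳ-≡ (c % m) _ _ (begin
    n ℕ.∸ c % m ℕ.+ (r ℕ.+ 0) ℕ.+ m ℕ.* (a / m) ℕ.+ c % m    ≡⟨ solve 4 (λ x r y z → x :+ (r :+ con 0) :+ y :+ z := x :+ z :+ r :+ y) ≡.refl (n ℕ.∸ c % m) r (m ℕ.* (a / m)) (c % m) ⟩
    n ℕ.∸ c % m ℕ.+ c % m ℕ.+ r ℕ.+ m ℕ.* (a / m)            ≡⟨ ≡.cong (λ x → x ℕ.+ r ℕ.+ m ℕ.* (a / m)) (≡.trans (ℕₚ.m∸n+n≡m (≤n c)) (≡.sym (ℕₚ.m∸n+n≡m (≤n a)))) ⟩
    n ℕ.∸ a % m ℕ.+ a % m ℕ.+ r ℕ.+ m ℕ.* (a / m)            ≡⟨ solve 4 (λ x y r z → x :+ y :+ r :+ z := x :+ r :+ (y :+ z)) ≡.refl (n ℕ.∸ a % m) (a % m) r (m ℕ.* (a / m)) ⟩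
    c ℕ.+ (a % m ℕ.+ m ℕ.* (a / m))                          ≡⟨ ≡.cong₂ ℕ._+_ (divMod c) (≡.sym (divMod a)) ⟩
    c % m ℕ.+ m ℕ.* (c / m) ℕ.+ a                            ≡⟨ solve 3 (λ x y z → x :+ y :+ z := z :+ con 0 :+ y :+ x) ≡.refl (c % m) (m ℕ.* (c / m)) a ⟩
    a ℕ.+ 0 ℕ.+ m ℕ.* (c / m) ℕ.+ c % m                      ∎)
    where
    open ≡.≡-Reasoning
    open +-*-Solver
    c = n ℕ.∸ a % m ℕ.+ r
    ≤n : ∀ a → a % m ℕ.≤ n
    ≤n a = ℕ.s≤s⁻¹ (m%n<n a m)
    divMod : ∀ a → a ≡ a % m ℕ.+ m ℕ.* (a / m)
    divMod a = ≡.trans (m≡m%n+[m/n]*n a m) (≡.cong (a % m ℕ.+_) (ℕₚ.*-comm (a / m) m))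

  -- Exponents on odd edges are reflected before the shift and reflected back afterwards, so that
  -- all edges are shifted by the same r in the same direction.
  start : Bool → ℕ → ℕ
  start true  a = a
  start false a = n ℕ.∸ a % m

  reflect : Bool → ℕ → ℕ
  reflect true  z = z
  reflect false z = n ℕ.∸ z

  reflect-sum : ∀ b {z} → z ℕ.≤ n →
    reflect b z ℕ.+ indicator (not b) ℕ.* z ≡ indicator b ℕ.* z ℕ.+ indicator (not b) ℕ.* n
  reflect-sum true  {z} _   = ≡.cong (ℕ._+ 0) (≡.sym (ℕₚ.+-identityʳ z))
  reflect-sum false {z} z≤  = ≡.trans (≡.cong (n ℕ.∸ z ℕ.+_) (ℕₚ.+-identityʳ z))
    (≡.trans (ℕₚ.m∸n+n≡m z≤) (≡.sym (ℕₚ.+-identityʳ n)))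

  reflect-congruent : ∀ b a r → ∃₂ λ p p′ →
    reflect b ((start b a ℕ.+ r) % m) ℕ.+ indicator (not b) ℕ.* r ℕ.+ m ℕ.* p ≡ a ℕ.+ indicator b ℕ.* r ℕ.+ m ℕ.* p′
  reflect-congruent true  a r = (a ℕ.+ r) / m , 0 , even-congruent a r
  reflect-congruent false a r = a / m , (n ℕ.∸ a % m ℕ.+ r) / m , odd-congruent a r

  module _ {s k : ℕ} (sign : Fin s → Bool) where

    ev od : Fin s → ℕ
    ev = indicator ∘ sign
    od = indicator ∘ not ∘ sign

    module _ (∑ev≡k : ∑ ev ≡ k) (∑od≡k : ∑ od ≡ k) where

      module _ (c : Fin s → ℕ) where

        residue : Fin s → Fin m → ℕ
        residue e r = (c e ℕ.+ toℕ r) % m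

        -- Over all shifts each edge contributes the same residue sum, so the total depends on the
        -- weights only through their sum.
        ∑∑-residues : (w : Fin s → ℕ) → ∑ w ≡ k →
          ∑ (λ r → ∑ λ e → w e ℕ.* residue e r) ≡ k ℕ.* ∑ {m} (λ r → toℕ r % m)
        ∑∑-residues w ∑w≡k = begin
          ∑ (λ r → ∑ λ e → w e ℕ.* residue e r)            ≡⟨ ℕΣ.∑-comm (λ r e → w e ℕ.* residue e r) ⟩
          ∑ (λ e → ∑ λ r → w e ℕ.* residue e r)            ≡⟨ ℕΣ.sum-cong-≗ (λ e → ℕΣ.*-distribˡ-sum (w e) (residue e)) ⟨
          ∑ (λ e → w e ℕ.* ∑ (residue e))                  ≡⟨ ℕΣ.sum-cong-≗ (λ e → ≡.cong (w e ℕ.*_) (∑-residues (c e))) ⟩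
          ∑ (λ e → w e ℕ.* ∑ {m} (λ r → toℕ r % m))        ≡⟨ ℕΣ.*-distribʳ-sum (∑ {m} (λ r → toℕ r % m)) w ⟨
          ∑ w ℕ.* ∑ {m} (λ r → toℕ r % m)                  ≡⟨ ≡.cong (ℕ._* ∑ {m} (λ r → toℕ r % m)) ∑w≡k ⟩
          k ℕ.* ∑ {m} (λ r → toℕ r % m)                    ∎
          where open ≡.≡-Reasoning

        balanced-shift : ∃[ r ] ∑ (λ e → ev e ℕ.* residue e r) ℕ.≤ ∑ (λ e → od e ℕ.* residue e r)
        balanced-shift = ∑-reflects-≤ (λ r → ∑ λ e → ev e ℕ.* residue e r) (λ r → ∑ λ e → od e ℕ.* residue e r)
          (≡.trans (∑∑-residues ev ∑ev≡k) (≡.sym (∑∑-residues od ∑od≡k)))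

      -- Modulo m, the exponents β are α shifted by r on the even edges and
      -- by −r on the odd ones; some r makes their sum at most average.
      shifted-exponents : (α : Fin s → ℕ) →
        ∃₂ λ β r → ∑ β ℕ.≤ k ℕ.* n ×
          (∀ e → ∃₂ λ p p′ → β e ℕ.+ od e ℕ.* r ℕ.+ m ℕ.* p ≡ α e ℕ.+ ev e ℕ.* r ℕ.+ m ℕ.* p′)
      shifted-exponents α = β , toℕ r , ∑β≤kn , congruent
        where
        c : Fin s → ℕ
        c e = start (sign e) (α e)
        shift = balanced-shift c
        r = proj₁ shift
        Z : Fin s → ℕ
        Z e = residue c e r
        β : Fin s → ℕ
        β e = reflect (sign e) (Z e)
        β+odZ : ∀ e → β e ℕ.+ od e ℕ.* Z e ≡ ev e ℕ.* Z e ℕ.+ od e ℕ.* n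
        β+odZ e = reflect-sum (sign e) (ℕ.s≤s⁻¹ (m%n<n (c e ℕ.+ toℕ r) m))
        -- The sum of β consists of the even residues and of n minus each odd residue. By the choice
        -- of r the even residues total at most the odd ones, which leaves at most n for each odd
        -- edge.
        ∑β≤kn : ∑ β ℕ.≤ k ℕ.* n
        ∑β≤kn = ℕₚ.+-cancelˡ-≤ (∑ λ e → od e ℕ.* Z e) _ _ (begin
          ∑ (λ e → od e ℕ.* Z e) ℕ.+ ∑ β                          ≡⟨ ℕₚ.+-comm (∑ λ e → od e ℕ.* Z e) (∑ β) ⟩
          ∑ β ℕ.+ ∑ (λ e → od e ℕ.* Z e)                          ≡⟨ ℕΣ.∑-distrib-+ β (λ e → od e ℕ.* Z e) ⟨
          ∑ (λ e → β e ℕ.+ od e ℕ.* Z e)                          ≡⟨ ℕΣ.sum-cong-≗ β+odZ ⟩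
          ∑ (λ e → ev e ℕ.* Z e ℕ.+ od e ℕ.* n)                   ≡⟨ ℕΣ.∑-distrib-+ (λ e → ev e ℕ.* Z e) (λ e → od e ℕ.* n) ⟩
          ∑ (λ e → ev e ℕ.* Z e) ℕ.+ ∑ (λ e → od e ℕ.* n)         ≤⟨ ℕₚ.+-monoˡ-≤ _ (proj₂ shift) ⟩
          ∑ (λ e → od e ℕ.* Z e) ℕ.+ ∑ (λ e → od e ℕ.* n)         ≡⟨ ≡.cong (∑ (λ e → od e ℕ.* Z e) ℕ.+_) (≡.trans (≡.sym (ℕΣ.*-distribʳ-sum n od)) (≡.cong (ℕ._* n) ∑od≡k)) ⟩
          ∑ (λ e → od e ℕ.* Z e) ℕ.+ k ℕ.* n                      ∎)
          where open ℕₚ.≤-Reasoning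
        congruent : ∀ e → ∃₂ λ p p′ → β e ℕ.+ od e ℕ.* toℕ r ℕ.+ m ℕ.* p ≡ α e ℕ.+ ev e ℕ.* toℕ r ℕ.+ m ℕ.* p′
        congruent e = reflect-congruent (sign e) (α e) (toℕ r)

      -- ∑ β ≤ d + n and ∑ β ≡ d modulo n + 1 force ∑ β ≤ d.
      balanced-exponents : ∀ {d l} (α : Fin s → ℕ) → k ℕ.* n ≡ d ℕ.+ n → ∑ α ≡ d ℕ.+ m ℕ.* l →
        ∃₂ λ β r → (∃[ p ] m ℕ.* p ℕ.+ ∑ β ≡ d) ×
          (∀ e → ∃₂ λ p p′ → β e ℕ.+ od e ℕ.* r ℕ.+ m ℕ.* p ≡ α e ℕ.+ ev e ℕ.* r ℕ.+ m ℕ.* p′)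
      balanced-exponents {d} {l} α kn≡d+n ∑α≡d+ml = β , r , padding (ℕₚ.≤-<-connex (∑ β) d) , congruent
        where
        shifted = shifted-exponents α
        β = proj₁ shifted
        r = proj₁ (proj₂ shifted)
        congruent = proj₂ (proj₂ (proj₂ shifted))
        P P′ : Fin s → ℕ
        P e = proj₁ (congruent e)
        P′ e = proj₁ (proj₂ (congruent e))
        ∑-linear : ∀ (f w g : Fin s → ℕ) → ∑ w ≡ k → ∑ (λ e → f e ℕ.+ w e ℕ.* r ℕ.+ m ℕ.* g e) ≡ ∑ f ℕ.+ k ℕ.* r ℕ.+ m ℕ.* ∑ g
        ∑-linear f w g ∑w≡k = begin
          ∑ (λ e → f e ℕ.+ w e ℕ.* r ℕ.+ m ℕ.* g e)              ≡⟨ ℕΣ.∑-distrib-+ (λ e → f e ℕ.+ w e ℕ.* r) (λ e → m ℕ.* g e) ⟩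
          ∑ (λ e → f e ℕ.+ w e ℕ.* r) ℕ.+ ∑ (λ e → m ℕ.* g e)    ≡⟨ ≡.cong₂ ℕ._+_ (ℕΣ.∑-distrib-+ f (λ e → w e ℕ.* r)) (≡.sym (ℕΣ.*-distribˡ-sum m g)) ⟩
          ∑ f ℕ.+ ∑ (λ e → w e ℕ.* r) ℕ.+ m ℕ.* ∑ g              ≡⟨ ≡.cong (λ x → ∑ f ℕ.+ x ℕ.+ m ℕ.* ∑ g) (≡.trans (≡.sym (ℕΣ.*-distribʳ-sum r w)) (≡.cong (ℕ._* r) ∑w≡k)) ⟩
          ∑ f ℕ.+ k ℕ.* r ℕ.+ m ℕ.* ∑ g                          ∎
          where open ≡.≡-Reasoning
        ∑β≡d : ∑ β ℕ.+ m ℕ.* ∑ P ≡ d ℕ.+ m ℕ.* (l ℕ.+ ∑ P′)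
        ∑β≡d = ℕₚ.+-cancelʳ-≡ (k ℕ.* r) _ _ (begin
          ∑ β ℕ.+ m ℕ.* ∑ P ℕ.+ k ℕ.* r                 ≡⟨ ℕ₊.xy∙z≈xz∙y (∑ β) _ _ ⟩
          ∑ β ℕ.+ k ℕ.* r ℕ.+ m ℕ.* ∑ P                 ≡⟨ ∑-linear β od P ∑od≡k ⟨
          ∑ (λ e → β e ℕ.+ od e ℕ.* r ℕ.+ m ℕ.* P e)    ≡⟨ ℕΣ.sum-cong-≗ (λ e → proj₂ (proj₂ (congruent e))) ⟩
          ∑ (λ e → α e ℕ.+ ev e ℕ.* r ℕ.+ m ℕ.* P′ e)   ≡⟨ ∑-linear α ev P′ ∑ev≡k ⟩
          ∑ α ℕ.+ k ℕ.* r ℕ.+ m ℕ.* ∑ P′                ≡⟨ ≡.cong (λ x → x ℕ.+ k ℕ.* r ℕ.+ m ℕ.* ∑ P′) ∑α≡d+ml ⟩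
          d ℕ.+ m ℕ.* l ℕ.+ k ℕ.* r ℕ.+ m ℕ.* ∑ P′      ≡⟨ ℕ₊.xy∙z≈xz∙y (d ℕ.+ m ℕ.* l) _ _ ⟩
          d ℕ.+ m ℕ.* l ℕ.+ m ℕ.* ∑ P′ ℕ.+ k ℕ.* r      ≡⟨ ≡.cong (ℕ._+ k ℕ.* r) (≡.trans (ℕₚ.+-assoc d _ _) (≡.cong (d ℕ.+_) (≡.sym (ℕₚ.*-distribˡ-+ m l (∑ P′))))) ⟩
          d ℕ.+ m ℕ.* (l ℕ.+ ∑ P′) ℕ.+ k ℕ.* r          ∎)
          where open ≡.≡-Reasoning
        -- The degree missing from d is a multiple of m and is returned as an exponent m p,
        -- invisible on units.
        padding : ∑ β ℕ.≤ d ⊎ d ℕ.< ∑ β → ∃[ p ] m ℕ.* p ℕ.+ ∑ β ≡ d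
        padding (inj₁ ∑β≤d) = case m∣δ of λ { (divides p δ≡pm) → p , (begin
            m ℕ.* p ℕ.+ ∑ β    ≡⟨ ≡.cong (ℕ._+ ∑ β) (≡.trans (ℕₚ.*-comm m p) (≡.sym δ≡pm)) ⟩
            δ ℕ.+ ∑ β          ≡⟨ ℕₚ.m∸n+n≡m ∑β≤d ⟩
            d                  ∎) }
          where
          open ≡.≡-Reasoning
          δ = d ℕ.∸ ∑ β
          m∣δ : m ∣ δ
          m∣δ = ∣m+n∣m⇒∣n (≡.subst (m ∣_) (ℕₚ.+-cancelˡ-≡ (∑ β) _ _ (begin
            ∑ β ℕ.+ m ℕ.* ∑ P                             ≡⟨ ∑β≡d ⟩
            d ℕ.+ m ℕ.* (l ℕ.+ ∑ P′)                      ≡⟨ ≡.cong (ℕ._+ m ℕ.* (l ℕ.+ ∑ P′)) (ℕₚ.m+[n∸m]≡n ∑β≤d) ⟨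
            ∑ β ℕ.+ δ ℕ.+ m ℕ.* (l ℕ.+ ∑ P′)              ≡⟨ ℕₚ.+-assoc (∑ β) δ _ ⟩
            ∑ β ℕ.+ (δ ℕ.+ m ℕ.* (l ℕ.+ ∑ P′))            ≡⟨ ≡.cong (∑ β ℕ.+_) (ℕₚ.+-comm δ _) ⟩
            ∑ β ℕ.+ (m ℕ.* (l ℕ.+ ∑ P′) ℕ.+ δ)            ∎)) (m∣m*n (∑ P))) (m∣m*n (l ℕ.+ ∑ P′))
        padding (inj₂ d<∑β) = contradiction (∣⇒≤ {{ℕ.>-nonZero (ℕₚ.m<n⇒0<n∸m d<∑β)}} m∣δ) (ℕₚ.<⇒≱ (ℕ.s≤s δ≤n))
          where
          open ≡.≡-Reasoning
          δ = ∑ β ℕ.∸ d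
          δ≤n : δ ℕ.≤ n
          δ≤n = ℕₚ.m≤n+o⇒m∸n≤o _ d (≡.subst (∑ β ℕ.≤_) kn≡d+n (proj₁ (proj₂ (proj₂ shifted))))
          m∣δ : m ∣ δ
          m∣δ = ∣m+n∣m⇒∣n (≡.subst (m ∣_) (≡.sym (ℕₚ.+-cancelˡ-≡ d _ _ (begin
            d ℕ.+ (m ℕ.* ∑ P ℕ.+ δ)            ≡⟨ ≡.cong (d ℕ.+_) (ℕₚ.+-comm _ δ) ⟩
            d ℕ.+ (δ ℕ.+ m ℕ.* ∑ P)            ≡⟨ ℕₚ.+-assoc d δ _ ⟨
            d ℕ.+ δ ℕ.+ m ℕ.* ∑ P              ≡⟨ ≡.cong (ℕ._+ m ℕ.* ∑ P) (ℕₚ.m+[n∸m]≡n (ℕₚ.<⇒≤ d<∑β)) ⟩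
            ∑ β ℕ.+ m ℕ.* ∑ P                  ≡⟨ ∑β≡d ⟩
            d ℕ.+ m ℕ.* (l ℕ.+ ∑ P′)           ∎))) (m∣m*n (l ℕ.+ ∑ P′))) (m∣m*n (∑ P))

-- Exponent sums and parity of positions.

sum-lookup : ∀ {s} (α : Vec ℕ s) → ∑ (lookup α) ≡ Vec.sum α
sum-lookup []      = ≡.refl
sum-lookup (a ∷ α) = ≡.cong (a ℕ.+_) (sum-lookup α)

sum-tabulate : ∀ {s} (β : Fin s → ℕ) → Vec.sum (Vec.tabulate β) ≡ ∑ β
sum-tabulate {zero}  β = ≡.refl
sum-tabulate {suc s} β = ≡.cong (β zero ℕ.+_) (sum-tabulate (β ∘ suc))

even : ℕ → Bool
even zero          = true
even (suc zero)    = false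
even (suc (suc i)) = even i

even-suc : ∀ i → even (suc i) ≡ not (even i)
even-suc zero          = ≡.refl
even-suc (suc zero)    = ≡.refl
even-suc (suc (suc i)) = even-suc i

even-double : ∀ k → even (2 ℕ.* k) ≡ true
even-double k = ≡.trans (≡.cong even (ℕₚ.*-comm 2 k)) (go k)
  where
  go : ∀ k → even (k ℕ.* 2) ≡ true
  go zero    = ≡.refl
  go (suc k) = go k

-- A general g covers both indicators; the recursion runs on `k * 2`, which unfolds two positions at
-- a time.
∑-parity : (g : Bool → ℕ) → g true ℕ.+ g false ≡ 1 → ∀ k → ∑ {2 ℕ.* k} (λ i → g (even (toℕ i))) ≡ k
∑-parity g g₁ k = ≡.subst (λ N → ∑ {N} (λ i → g (even (toℕ i))) ≡ k) (ℕₚ.*-comm k 2) (go k)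
  where
  go : ∀ k → ∑ {k ℕ.* 2} (λ i → g (even (toℕ i))) ≡ k
  go zero    = ≡.refl
  go (suc k) = ≡.trans (≡.sym (ℕₚ.+-assoc (g true) (g false) _)) (≡.cong₂ ℕ._+_ g₁ (go k))

-- Monomial functions on points with equal even and odd products.

module Balanced {c ℓ₁ ℓ₂} (K : HeytingField c ℓ₁ ℓ₂) (n : ℕ)
                (card : HasCardinality (HeytingField.setoid K) (suc (suc n))) where

  open Finite K n card
  open Polynomial K
  open Torus K n card

  prod-^ : ∀ {s} (f : Vector Carrier s) r → prod (λ i → f i ^ r) ≈ prod f ^ r
  prod-^ {zero}  f r = sym (1^n≈1 r)
  prod-^ {suc s} f r = trans (*-congˡ (prod-^ (f ∘ suc) r)) (sym (^-distrib-* (f zero) _ r))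

  ^-multiple : ∀ {x} → x # 0# → ∀ p → x ^ (suc n ℕ.* p) ≈ 1#
  ^-multiple {x} x#0 p = trans (sym (^-assocʳ x (suc n) p)) (trans (^-congˡ p (fermat x#0)) (1^n≈1 p))

  -- Fermat removes the multiple of q - 1, turning congruences between exponents into equations
  -- between powers.
  ^-expand : ∀ {x} → x # 0# → ∀ a b r p → x ^ (a ℕ.+ b ℕ.* r ℕ.+ suc n ℕ.* p) ≈ x ^ a * (x ^ b) ^ r
  ^-expand {x} x#0 a b r p = begin
    x ^ (a ℕ.+ b ℕ.* r ℕ.+ suc n ℕ.* p)          ≈⟨ ^-homo-* x (a ℕ.+ b ℕ.* r) (suc n ℕ.* p) ⟩
    x ^ (a ℕ.+ b ℕ.* r) * x ^ (suc n ℕ.* p)      ≈⟨ *-congˡ (^-multiple x#0 p) ⟩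
    x ^ (a ℕ.+ b ℕ.* r) * 1#                     ≈⟨ *-identityʳ _ ⟩
    x ^ (a ℕ.+ b ℕ.* r)                          ≈⟨ ^-homo-* x a (b ℕ.* r) ⟩
    x ^ a * x ^ (b ℕ.* r)                        ≈⟨ *-congˡ (^-assocʳ x b r) ⟨
    x ^ a * (x ^ b) ^ r                          ∎

  module _ {s k : ℕ} (sign : Fin (suc s) → Bool)
           (∑ev≡k : ∑ (indicator ∘ sign) ≡ k) (∑od≡k : ∑ (indicator ∘ not ∘ sign) ≡ k) where

    Alternating : Vector Carrier (suc s) → Set (ℓ₁ ⊔ ℓ₂)
    Alternating x = Units x × prod (λ e → x e ^ indicator (sign e)) ≈ prod (λ e → x e ^ indicator (not (sign e)))

    -- Multiplying the congruences over all edges gives X^β O^r = X^α E^r with E and O the even and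
    -- odd products. On alternating points E = O is a unit, so O^r cancels.
    balanced-monomial : ∀ {d l} → k ℕ.* n ≡ d ℕ.+ n → (α : Vec ℕ (suc s)) → Vec.sum α ≡ d ℕ.+ suc n ℕ.* l →
      ∃[ γ ] Vec.sum γ ≡ d × (∀ x → Alternating x → ⟦ γ ⟧ᴹ x ≈ ⟦ α ⟧ᴹ x)
    balanced-monomial {d} {l} kn≡d+n α |α|≡d+ml = γ , |γ|≡d , γ≈α
      where
      balanced = balanced-exponents n sign ∑ev≡k ∑od≡k {d} {l} (lookup α) kn≡d+n (≡.trans (sum-lookup α) |α|≡d+ml)
      β : Fin (suc s) → ℕ
      β = proj₁ balanced
      r = proj₁ (proj₂ balanced)
      p = proj₁ (proj₁ (proj₂ (proj₂ balanced)))
      congruent = proj₂ (proj₂ (proj₂ balanced))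
      -- The missing degree goes to one variable, whose power with exponent (q - 1) p is 1 on units.
      γ : Vec ℕ (suc s)
      γ = Vec.updateAt (Vec.tabulate β) zero (suc n ℕ.* p ℕ.+_)
      |γ|≡d : Vec.sum γ ≡ d
      |γ|≡d = ≡.trans (sum-raise (Vec.tabulate β) zero (suc n ℕ.* p))
        (≡.trans (≡.cong (suc n ℕ.* p ℕ.+_) (sum-tabulate β)) (proj₂ (proj₁ (proj₂ (proj₂ balanced)))))
      γ≈α : ∀ x → Alternating x → ⟦ γ ⟧ᴹ x ≈ ⟦ α ⟧ᴹ x
      γ≈α x (x#0 , X-ev≈X-od) = begin
        ⟦ γ ⟧ᴹ x                                              ≈⟨ ⟦⟧ᴹ-raise (Vec.tabulate β) zero (suc n ℕ.* p) x ⟩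
        x zero ^ (suc n ℕ.* p) * ⟦ Vec.tabulate β ⟧ᴹ x        ≈⟨ *-cong (^-multiple (x#0 zero) p) (Prod.sum-cong-≋ {suc s} λ e → ^-congʳ (x e) (Vecₚ.lookup∘tabulate β e)) ⟩
        1# * X β                                              ≈⟨ *-identityˡ _ ⟩
        X β                                                   ≈⟨ *-cancelʳ-# (^-# r (prod-# _ λ e → ^-# (indicator (not (sign e))) (x#0 e))) balance ⟩
        X (lookup α)                                          ∎
        where
        X : (Fin (suc s) → ℕ) → Carrier
        X a = prod λ e → x e ^ a e
        X-expand : ∀ (a b : Fin (suc s) → ℕ) (q : Fin (suc s) → ℕ) →
          X (λ e → a e ℕ.+ b e ℕ.* r ℕ.+ suc n ℕ.* q e) ≈ X a * X b ^ r
        X-expand a b q = begin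
          X (λ e → a e ℕ.+ b e ℕ.* r ℕ.+ suc n ℕ.* q e)     ≈⟨ Prod.sum-cong-≋ {suc s} (λ e → ^-expand (x#0 e) (a e) (b e) r (q e)) ⟩
          prod (λ e → x e ^ a e * (x e ^ b e) ^ r)          ≈⟨ Prod.∑-distrib-+ (λ e → x e ^ a e) (λ e → (x e ^ b e) ^ r) ⟩
          X a * prod (λ e → (x e ^ b e) ^ r)                ≈⟨ *-congˡ (prod-^ (λ e → x e ^ b e) r) ⟩
          X a * X b ^ r                                     ∎
        balance : X β * X (indicator ∘ not ∘ sign) ^ r ≈ X (lookup α) * X (indicator ∘ not ∘ sign) ^ r
        balance = begin
          X β * X (indicator ∘ not ∘ sign) ^ r              ≈⟨ X-expand β (indicator ∘ not ∘ sign) (proj₁ ∘ congruent) ⟨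
          X (λ e → β e ℕ.+ indicator (not (sign e)) ℕ.* r ℕ.+ suc n ℕ.* proj₁ (congruent e))
            ≈⟨ Prod.sum-cong-≋ {suc s} (λ e → ^-congʳ (x e) (proj₂ (proj₂ (congruent e)))) ⟩
          X (λ e → lookup α e ℕ.+ indicator (sign e) ℕ.* r ℕ.+ suc n ℕ.* proj₁ (proj₂ (congruent e)))
            ≈⟨ X-expand (lookup α) (indicator ∘ sign) (proj₁ ∘ proj₂ ∘ congruent) ⟩
          X (lookup α) * X (indicator ∘ sign) ^ r           ≈⟨ *-congˡ (^-congˡ r X-ev≈X-od) ⟩
          X (lookup α) * X (indicator ∘ not ∘ sign) ^ r     ∎

  -- Along a walk w₀, ..., w₂ₖ the even edges meet w₀ to w₂ₖ₋₁ once each and the odd edges w₁ to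
  -- w₂ₖ. With the missing endpoint supplied, both sides are κ^k w₀⋯w₂ₖ.
  telescope : ∀ κ k (w : ℕ → Carrier) →
    prod {k ℕ.* 2} (λ i → (κ * (w (toℕ i) * w (suc (toℕ i)))) ^ indicator (even (toℕ i))) * w (k ℕ.* 2) ≈
    w 0 * prod {k ℕ.* 2} (λ i → (κ * (w (toℕ i) * w (suc (toℕ i)))) ^ indicator (not (even (toℕ i))))
  telescope κ zero    w = trans (*-identityˡ _) (sym (*-identityʳ _))
  telescope κ (suc k) w = begin
    e₀ ^ 1 * (e₁ ^ 0 * E) * w (2 ℕ.+ k ℕ.* 2)      ≈⟨ *-congʳ (*-cong (*-identityʳ e₀) (*-identityˡ E)) ⟩
    e₀ * E * w (2 ℕ.+ k ℕ.* 2)                     ≈⟨ *-assoc _ _ _ ⟩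
    e₀ * (E * w (2 ℕ.+ k ℕ.* 2))                   ≈⟨ *-congˡ (telescope κ k (λ i → w (2 ℕ.+ i))) ⟩
    κ * (w 0 * w 1) * (w 2 * O)                    ≈⟨ *-congʳ (*ₛ.x∙yz≈y∙xz _ _ _) ⟩
    w 0 * (κ * w 1) * (w 2 * O)                    ≈⟨ *-assoc _ _ _ ⟩
    w 0 * (κ * w 1 * (w 2 * O))                    ≈⟨ *-congˡ (*-assoc _ _ _) ⟨
    w 0 * (κ * w 1 * w 2 * O)                      ≈⟨ *-congˡ (*-congʳ (*-assoc _ _ _)) ⟩
    w 0 * (e₁ * O)                                 ≈⟨ *-congˡ (*-congʳ (*-identityʳ e₁)) ⟨
    w 0 * (e₁ ^ 1 * O)                             ≈⟨ *-congˡ (*-identityˡ _) ⟨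
    w 0 * (e₀ ^ 0 * (e₁ ^ 1 * O))                  ∎
    where
    e₀ = κ * (w 0 * w 1)
    e₁ = κ * (w 1 * w 2)
    E = prod {k ℕ.* 2} (λ i → (κ * (w (2 ℕ.+ toℕ i) * w (3 ℕ.+ toℕ i))) ^ indicator (even (toℕ i)))
    O = prod {k ℕ.* 2} (λ i → (κ * (w (2 ℕ.+ toℕ i) * w (3 ℕ.+ toℕ i))) ^ indicator (not (even (toℕ i))))

  closed-telescope : ∀ κ k (w : ℕ → Carrier) → (∀ i → w i # 0#) → w (2 ℕ.* k) ≈ w 0 →
    prod {2 ℕ.* k} (λ i → (κ * (w (toℕ i) * w (suc (toℕ i)))) ^ indicator (even (toℕ i))) ≈
    prod {2 ℕ.* k} (λ i → (κ * (w (toℕ i) * w (suc (toℕ i)))) ^ indicator (not (even (toℕ i))))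
  closed-telescope κ k w w#0 closed = *-cancelʳ-# (w#0 0)
    (trans (trans (*-congˡ (sym closed))
      (≡.subst (λ N → prod {N} (λ i → (κ * (w (toℕ i) * w (suc (toℕ i)))) ^ indicator (even (toℕ i))) * w N ≈
        w 0 * prod {N} (λ i → (κ * (w (toℕ i) * w (suc (toℕ i)))) ^ indicator (not (even (toℕ i))))) (ℕₚ.*-comm k 2) (telescope κ k w)))
      (*-comm _ _))

-- Cyclic successors.

module Cyclic {N : ℕ} .{{_ : ℕ.NonZero N}} where

  at : ℕ → Fin N
  at i = i mod N

  toℕ-at : ∀ i → toℕ (at i) ≡ i % N
  toℕ-at i = Finₚ.toℕ-fromℕ< (m%n<n i N)

  at-toℕ : ∀ i → at (toℕ i) ≡ i
  at-toℕ i = Finₚ.toℕ-injective (≡.trans (toℕ-at (toℕ i)) (m<n⇒m%n≡m (Finₚ.toℕ<n i)))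

  at-N : at N ≡ at 0
  at-N = Finₚ.toℕ-injective (≡.trans (toℕ-at N) (≡.trans (n%n≡0 N) (≡.sym (≡.trans (toℕ-at 0) (m<n⇒m%n≡m (ℕ.>-nonZero⁻¹ N))))))

  next : Fin N → Fin N
  next i = at (suc (toℕ i))

  successor-next : ∀ i → CyclicSuccessor i (next i)
  successor-next i = case ℕₚ.m≤n⇒m<n∨m≡n (Finₚ.toℕ<n i) of λ
    { (inj₁ si<N) → inj₁ (≡.trans (toℕ-at (suc (toℕ i))) (m<n⇒m%n≡m si<N))
    ; (inj₂ si≡N) → inj₂ (si≡N , ≡.trans (toℕ-at (suc (toℕ i))) (≡.trans (≡.cong (_% N) si≡N) (n%n≡0 N))) }

  successor-functional : ∀ {i j j′ : Fin N} → CyclicSuccessor i j → CyclicSuccessor i j′ → j ≡ j′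
  successor-functional (inj₁ p)       (inj₁ q)       = Finₚ.toℕ-injective (≡.trans p (≡.sym q))
  successor-functional (inj₂ (_ , p)) (inj₂ (_ , q)) = Finₚ.toℕ-injective (≡.trans p (≡.sym q))
  successor-functional {j = j} (inj₁ p) (inj₂ (si≡N , _)) =
    contradiction (≡.trans p si≡N) (ℕₚ.<⇒≢ (Finₚ.toℕ<n j))
  successor-functional {j′ = j′} (inj₂ (si≡N , _)) (inj₁ q) =
    contradiction (≡.trans q si≡N) (ℕₚ.<⇒≢ (Finₚ.toℕ<n j′))

  successor-injective : ∀ {i i′ j : Fin N} → CyclicSuccessor i j → CyclicSuccessor i′ j → i ≡ i′
  successor-injective (inj₁ p)       (inj₁ q)       = Finₚ.toℕ-injective (ℕₚ.suc-injective (≡.trans (≡.sym p) q))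
  successor-injective (inj₂ (p , _)) (inj₂ (q , _)) = Finₚ.toℕ-injective (ℕₚ.suc-injective (≡.trans p (≡.sym q)))
  successor-injective (inj₁ p)       (inj₂ (_ , q)) = case ≡.trans (≡.sym p) q of λ ()
  successor-injective (inj₂ (_ , p)) (inj₁ q)       = case ≡.trans (≡.sym p) q of λ ()

  -- Two steps lead back to the start only on a cycle of length at most 2.
  successor-asymmetric : 3 ℕ.≤ N → ∀ {i j : Fin N} → CyclicSuccessor i j → ¬ CyclicSuccessor j i
  successor-asymmetric 3≤N {i} {j} (inj₁ p) (inj₁ q) = ℕₚ.<-asym (ℕₚ.≤-reflexive (≡.sym p)) (ℕₚ.≤-reflexive (≡.sym q))
  successor-asymmetric 3≤N {i} {j} (inj₁ p) (inj₂ (sj≡N , i≡0)) =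
    ℕₚ.<⇒≢ 3≤N (≡.trans (≡.cong suc (≡.sym (≡.trans p (≡.cong suc i≡0)))) sj≡N)
  successor-asymmetric 3≤N {i} {j} (inj₂ (si≡N , j≡0)) (inj₁ q) =
    ℕₚ.<⇒≢ 3≤N (≡.trans (≡.cong suc (≡.sym (≡.trans q (≡.cong suc j≡0)))) si≡N)
  successor-asymmetric 3≤N {i} {j} (inj₂ (si≡N , j≡0)) (inj₂ (sj≡N , i≡0)) =
    ℕₚ.<⇒≢ (ℕₚ.<-trans (ℕ.s≤s (ℕ.s≤s ℕ.z≤n)) 3≤N) (≡.trans (≡.cong suc (≡.sym i≡0)) si≡N)

  -- The wrap from N - 1 to 0 also changes parity because N is even.
  successor-parity : even N ≡ true → ∀ {i j : Fin N} → CyclicSuccessor i j → even (toℕ j) ≡ not (even (toℕ i))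
  successor-parity N-even {i} (inj₁ p) = ≡.trans (≡.cong even p) (even-suc (toℕ i))
  successor-parity N-even {i} (inj₂ (si≡N , j≡0)) = ≡.trans (≡.cong even j≡0)
    (≡.trans (≡.sym N-even) (≡.trans (≡.cong even (≡.sym si≡N)) (even-suc (toℕ i))))

-- Edges of an even cycle in cyclic order.

module Cycle {N s : ℕ} .{{_ : ℕ.NonZero N}} (G : SimpleGraph N s) (N-even : even N ≡ true) (cycle : IsCycle G) where

  open SimpleGraph G
  open Cyclic {N}
  private
    3≤N = proj₁ cycle
    iso = proj₂ (proj₂ cycle)
    module φ = Inverse (proj₁ (proj₂ cycle))

  φ-injective : ∀ {i j} → φ.to i ≡ φ.to j → i ≡ j
  φ-injective = Injection.injective (Inverse⇒Injection (proj₁ (proj₂ cycle)))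

  edge : Fin N → Fin s
  edge i = proj₁ (Equivalence.to (iso i (next i)) (inj₁ (successor-next i)))

  edge-joins : ∀ i → Joins (edge i) (φ.to i) (φ.to (next i))
  edge-joins i = proj₂ (Equivalence.to (iso i (next i)) (inj₁ (successor-next i)))

  edge-surjective : ∀ e → ∃[ i ] edge i ≡ e
  edge-surjective e = go (φ.strictlyInverseˡ (end₁ e)) (φ.strictlyInverseˡ (end₂ e))
    (Equivalence.from (iso _ _) (e , inj₁ (≡.sym (φ.strictlyInverseˡ _) , ≡.sym (φ.strictlyInverseˡ _))))
    where
    go : ∀ {i j} → φ.to i ≡ end₁ e → φ.to j ≡ end₂ e → CyclicSuccessor i j ⊎ CyclicSuccessor j i → ∃[ i ] edge i ≡ e
    go {i} {j} p q (inj₁ i→j) = i , simple (edge-joins i) (inj₁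
      (≡.sym p , ≡.trans (≡.sym q) (≡.cong φ.to (successor-functional i→j (successor-next i)))))
    go {i} {j} p q (inj₂ j→i) = j , simple (edge-joins j) (inj₂
      (≡.trans (≡.sym p) (≡.cong φ.to (successor-functional j→i (successor-next j))) , ≡.sym q))

  edge-ends : ∀ i u → Incident (edge i) u → φ.to i ≡ u ⊎ φ.to (next i) ≡ u
  edge-ends i u = go (edge-joins i)
    where
    go : Joins (edge i) (φ.to i) (φ.to (next i)) → Incident (edge i) u → φ.to i ≡ u ⊎ φ.to (next i) ≡ u
    go (inj₁ (p , q)) (inj₁ r) = inj₁ (≡.trans (≡.sym p) r)
    go (inj₁ (p , q)) (inj₂ r) = inj₂ (≡.trans (≡.sym q) r)
    go (inj₂ (p , q)) (inj₁ r) = inj₂ (≡.trans (≡.sym p) r)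
    go (inj₂ (p , q)) (inj₂ r) = inj₁ (≡.trans (≡.sym q) r)

  edge-incident : ∀ i → Incident (edge i) (φ.to i) × Incident (edge i) (φ.to (next i))
  edge-incident i = go (edge-joins i)
    where
    go : Joins (edge i) (φ.to i) (φ.to (next i)) → Incident (edge i) (φ.to i) × Incident (edge i) (φ.to (next i))
    go (inj₁ (p , q)) = inj₁ p , inj₂ q
    go (inj₂ (p , q)) = inj₂ q , inj₁ p

  -- Equal edges share both ends, so the positions coincide or each is the successor of the other;
  -- asymmetry excludes the latter.
  edge-injective : ∀ {i j} → edge i ≡ edge j → i ≡ j
  edge-injective {i} {j} eq =
    case edge-ends j (φ.to i) (incident i eq (proj₁ (edge-incident i))) , edge-ends j (φ.to (next i)) (incident (next i) eq (proj₂ (edge-incident i))) of λ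
      { (inj₁ p , _)      → ≡.sym (φ-injective p)
      ; (_      , inj₂ q) → ≡.sym (successor-injective (≡.subst (CyclicSuccessor j) (φ-injective q) (successor-next j)) (successor-next i))
      ; (inj₂ p , inj₁ q) → contradiction (≡.subst (CyclicSuccessor j) (φ-injective p) (successor-next j))
          (successor-asymmetric 3≤N (≡.subst (CyclicSuccessor i) (≡.sym (φ-injective q)) (successor-next i))) }
    where
    incident : ∀ l {e e′} → e ≡ e′ → Incident e (φ.to l) → Incident e′ (φ.to l)
    incident l ≡.refl inc = inc

  position : Fin s → Fin N
  position e = proj₁ (edge-surjective e)

  position-edge : ∀ i → position (edge i) ≡ i
  position-edge i = edge-injective (proj₂ (edge-surjective (edge i)))

  edges : Perm.Permutation N s
  edges = Perm.permutation edge position (λ e → proj₂ (edge-surjective e)) position-edge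

  sign : Fin s → Bool
  sign e = even (toℕ (position e))

  sign-edge : ∀ i → sign (edge i) ≡ even (toℕ i)
  sign-edge i = ≡.cong (even ∘ toℕ) (position-edge i)

  ∑-sign : ∀ k → 2 ℕ.* k ≡ N → (g : Bool → ℕ) → g true ℕ.+ g false ≡ 1 → ∑ (g ∘ sign) ≡ k
  ∑-sign k ≡.refl g g₁ = ≡.trans (ℕΣ.sum-permute (g ∘ sign) edges)
    (≡.trans (ℕΣ.sum-cong-≗ (≡.cong g ∘ sign-edge)) (∑-parity g g₁ k))

  next-parity : ∀ i → even (toℕ (next i)) ≡ not (even (toℕ i))
  next-parity i = successor-parity N-even (successor-next i)

  cycle-bipartite : Bipartite G
  cycle-bipartite = side , λ e → let (i , eq) = edge-surjective e in
      ≡.subst (λ e → side (end₁ e) ≢ side (end₂ e)) eq (differ i (edge-joins i))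
    where
    side : Fin N → Bool
    side u = even (toℕ (φ.from u))
    side-φ : ∀ i → side (φ.to i) ≡ even (toℕ i)
    side-φ i = ≡.cong (even ∘ toℕ) (φ.strictlyInverseʳ i)
    parity-differs : ∀ i → side (φ.to i) ≢ side (φ.to (next i))
    parity-differs i eq = Boolₚ.not-¬ (≡.sym (≡.trans (≡.sym (side-φ i)) (≡.trans eq (side-φ (next i))))) (next-parity i)
    differ : ∀ i → Joins (edge i) (φ.to i) (φ.to (next i)) → side (end₁ (edge i)) ≢ side (end₂ (edge i))
    differ i (inj₁ (p , q)) eq = parity-differs i (≡.trans (≡.cong side (≡.sym p)) (≡.trans eq (≡.cong side q)))
    differ i (inj₂ (p , q)) eq = parity-differs i (≡.trans (≡.cong side (≡.sym q)) (≡.trans (≡.sym eq) (≡.cong side p)))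

  -- The edges in even position are taken: an even vertex is matched by its own edge, an odd one by
  -- the edge of its predecessor.
  cycle-matching : HasPerfectMatching G
  cycle-matching = subset even? , λ u → ≡.subst Matched (φ.strictlyInverseˡ u) (matched (φ.from u) (even (toℕ (φ.from u))) ≡.refl)
    where
    even? : ∀ e → Dec (sign e ≡ true)
    even? e = sign e Boolₚ.≟ true
    Matched : Fin N → Set
    Matched u = ∃[ e ] (e ∈ subset even? × Incident e u) × (∀ {e′} → e′ ∈ subset even? × Incident e′ u → e ≡ e′)
    unique : ∀ {i j l} → even (toℕ i) ≡ true → even (toℕ j) ≡ true →
      l ≡ i ⊎ l ≡ next i → φ.to j ≡ φ.to l ⊎ φ.to (next j) ≡ φ.to l → i ≡ j
    unique {i} {j} {l} i-even j-even (inj₁ ≡.refl) (inj₁ q) = ≡.sym (φ-injective q)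
    unique {i} {j} {l} i-even j-even (inj₂ ≡.refl) (inj₂ q) =
      successor-injective (successor-next i) (≡.subst (CyclicSuccessor j) (φ-injective q) (successor-next j))
    -- The mixed cases would make one even position the successor of another.
    unique {i} {j} {l} i-even j-even (inj₁ ≡.refl) (inj₂ q) = contradiction
      (≡.trans (≡.sym i-even) (≡.trans (≡.cong (even ∘ toℕ) (≡.sym (φ-injective q))) (≡.trans (next-parity j) (≡.cong not j-even)))) λ ()
    unique {i} {j} {l} i-even j-even (inj₂ ≡.refl) (inj₁ q) = contradiction
      (≡.trans (≡.sym j-even) (≡.trans (≡.cong (even ∘ toℕ) (φ-injective q)) (≡.trans (next-parity i) (≡.cong not i-even)))) λ ()
    match : ∀ {i l} → even (toℕ i) ≡ true → l ≡ i ⊎ l ≡ next i → Matched (φ.to l)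
    match {i} {l} i-even l-end = edge i , (∈-subset⁺ even? (≡.trans (sign-edge i) i-even) , incident l-end) ,
      λ {e′} (e′∈ , inc) → go (edge-surjective e′) (∈-subset⁻ even? e′∈) inc
      where
      incident : l ≡ i ⊎ l ≡ next i → Incident (edge i) (φ.to l)
      incident (inj₁ ≡.refl) = proj₁ (edge-incident i)
      incident (inj₂ ≡.refl) = proj₂ (edge-incident i)
      go : ∀ {e′} → ∃[ j ] edge j ≡ e′ → sign e′ ≡ true → Incident e′ (φ.to l) → edge i ≡ e′
      go (j , ≡.refl) e′-even inc = ≡.cong edge
        (unique i-even (≡.trans (≡.sym (sign-edge j)) e′-even) l-end (edge-ends j (φ.to l) inc))
    matched : ∀ l b → even (toℕ l) ≡ b → Matched (φ.to l)
    matched l true  l-even = match l-even (inj₁ ≡.refl)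
    matched l false l-odd  = predecessor (toℕ l) ≡.refl
      where
      predecessor : ∀ p → toℕ l ≡ p → Matched (φ.to l)
      predecessor zero    l≡0  = contradiction (≡.trans (≡.sym l-odd) (≡.cong even l≡0)) λ ()
      predecessor (suc p) l≡sp = match {at p} {l}
        (≡.trans (≡.cong even at-p) (Boolₚ.not-injective (≡.trans (≡.sym (even-suc p)) (≡.trans (≡.cong even (≡.sym l≡sp)) l-odd))))
        (inj₂ (≡.trans (≡.sym (at-toℕ l)) (≡.cong at (≡.trans l≡sp (≡.cong suc (≡.sym at-p))))))
        where
        at-p : toℕ (at p) ≡ p
        at-p = ≡.trans (toℕ-at p) (m<n⇒m%n≡m (ℕₚ.<-trans (ℕₚ.≤-reflexive (≡.sym l≡sp)) (Finₚ.toℕ<n l)))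

-- Separation on even cycles and the regularity indices.

module CycleSeparation {c ℓ₁ ℓ₂} (K : HeytingField c ℓ₁ ℓ₂) (n : ℕ)
                       (card : HasCardinality (HeytingField.setoid K) (suc (suc n))) where

  open Finite K n card
  open Polynomial K
  open Hilbert K n card
  open Torus K n card
  open Toric K n card
  open Balanced K n card

  module _ {k s : ℕ} (G : SimpleGraph (2 ℕ.* suc k) (suc s)) (cycle : IsCycle G) where

    open SimpleGraph G
    open Cyclic {2 ℕ.* suc k}
    open Cycle G (even-double (suc k)) cycle
    private
      module φ = Inverse (proj₁ (proj₂ cycle))

    ∑ev≡k : ∑ (indicator ∘ sign) ≡ suc k
    ∑ev≡k = ∑-sign (suc k) ≡.refl indicator ≡.refl

    ∑od≡k : ∑ (indicator ∘ not ∘ sign) ≡ suc k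
    ∑od≡k = ∑-sign (suc k) ≡.refl (indicator ∘ not) ≡.refl

    -- Reordering the edges along the cycle presents a toric point as a closed walk of vertex
    -- values, scaled by κ.
    toric-alternating : ∀ P → toricSet K G P → Alternating sign ∑ev≡k ∑od≡k (proj₁ P)
    toric-alternating P@(x , _) P∈X@(t , t#0 , κ , κ#0 , x≈) = toric-units G P P∈X ,
      trans (walk-product indicator) (trans (closed-telescope κ (suc k) w (λ i → t#0 _) (reflexive (≡.cong (t ∘ φ.to) at-N)))
        (sym (walk-product (indicator ∘ not))))
      where
      w : ℕ → Carrier
      w i = t (φ.to (at i))
      x-edge : ∀ i → x (edge i) ≈ κ * (w (toℕ i) * w (suc (toℕ i)))
      x-edge i = trans (x≈ (edge i)) (*-congˡ (trans (edgeProduct-joins G t (edge i) (edge-joins i))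
        (*-congʳ (reflexive (≡.cong (t ∘ φ.to) (≡.sym (at-toℕ i)))))))
      walk-product : (g : Bool → ℕ) → prod (λ e → x e ^ g (sign e)) ≈
        prod {2 ℕ.* suc k} (λ i → (κ * (w (toℕ i) * w (suc (toℕ i)))) ^ g (even (toℕ i)))
      walk-product g = trans (Prod.sum-permute (λ e → x e ^ g (sign e)) edges)
        (Prod.sum-cong-≋ {2 ℕ.* suc k} λ i → ^-cong (x-edge i) (≡.cong g (sign-edge i)))

    edge-count : suc s ≡ 2 ℕ.* suc k
    edge-count = ≡.sym (Perm.↔⇒≡ edges)

    -- There are 2k + 2 edges, so the ambient degree (2k + 1) n exceeds k n by (k + 1) n; adding k +
    -- 1 makes the excess a multiple of n + 1. This fixes the exponent of the auxiliary variable.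
    degrees : s ℕ.* n ℕ.+ suc k ℕ.* 1 ≡ k ℕ.* n ℕ.+ suc n ℕ.* suc k
    degrees = ≡.trans (≡.cong (λ s → s ℕ.* n ℕ.+ suc k ℕ.* 1) (ℕₚ.suc-injective edge-count))
      (solve 2 (λ k n → (k :+ (con 1 :+ k :+ con 0)) :* n :+ (con 1 :+ k) :* con 1 := k :* n :+ (con 1 :+ n) :* (con 1 :+ k)) ≡.refl k n)
      where
        open +-*-Solver

    -- The separating forms of the ambient torus, times X₀^(k+1), have degree
    -- congruent to k n modulo n + 1, so their monomials can be lowered.
    cycle-separated : Separated (k ℕ.* n) (toricSet K G)
    cycle-separated P P∈X = loweredDegree (subtorus-separated (toric-units G) P P∈X)
      where
      loweredDegree : Separates (s ℕ.* n) (toricSet K G) (proj₁ P) → Separates (k ℕ.* n) (toricSet K G) (proj₁ P)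
      loweredDegree (f , f-form , fP≉0 , f≈0) = proj₁ lowered , proj₁ (proj₂ lowered) ,
        (λ hP≈0 → fP≉0 (xy≈0⇒y≈0 (power-# P P∈X) (trans (*-comm _ _) (trans (sym (value P P∈X)) hP≈0)))) ,
        λ Q Q∈X Q≁P → trans (value Q Q∈X) (trans (*-congʳ (f≈0 Q Q∈X Q≁P)) (zeroˡ _))
        where
        power : Vector Carrier (suc s) → Carrier
        power y = prod {suc k} λ _ → y zero
        product : Representable (s ℕ.* n ℕ.+ suc k ℕ.* 1) (λ y → ⟦ f ⟧ y * power y)
        product = representable-* (f , f-form , λ _ → refl) (representable-∏ {m = suc k} λ _ → representable-var zero)
        lowered : Σ (Poly K (suc s)) λ h → Form (k ℕ.* n) h ×
          (∀ y → Alternating sign ∑ev≡k ∑od≡k y → ⟦ h ⟧ y ≈ ⟦ proj₁ product ⟧ y)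
        lowered = replaceMonomials id (Alternating sign ∑ev≡k ∑od≡k)
          (λ α |α|≡ → balanced-monomial sign ∑ev≡k ∑od≡k (ℕₚ.+-comm n (k ℕ.* n)) α (≡.trans |α|≡ degrees))
          (proj₁ product) (proj₁ (proj₂ product))
        value : ∀ Q → toricSet K G Q → ⟦ proj₁ lowered ⟧ (proj₁ Q) ≈ ⟦ f ⟧ (proj₁ Q) * power (proj₁ Q)
        value Q Q∈X = trans (proj₂ (proj₂ lowered) (proj₁ Q) (toric-alternating Q Q∈X)) (proj₂ (proj₂ product) (proj₁ Q))
        power-# : ∀ Q → toricSet K G Q → power (proj₁ Q) # 0#
        power-# Q Q∈X = prod-# {suc k} (λ _ → proj₁ Q zero) λ _ → toric-units G Q Q∈X zero

  -- Toric points lie in the ambient torus, whose linear factors already separate them; this crude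
  -- degree bounds the search for the least one.
  toric-separated : ∀ {v s} (G : SimpleGraph v s) → Fin s → ∃[ d ] Separated d (toricSet K G)
  toric-separated {s = suc s} G _ = s ℕ.* n , subtorus-separated (toric-units G)

  module _ {k s : ℕ} (G : SimpleGraph (2 ℕ.* suc k) s) where

    open SimpleGraph G

    bipartite-regularity : Bipartite G → HasPerfectMatching G →
      ∃[ ρ ] IsRegularityIndex K (toricSet K G) ρ × k ℕ.* n ℕ.≤ ρ
    bipartite-regularity bipartite (_ , matching) =
      let (ρ , ρ-separated , ρ-regularity) = separated⇒∃regularity (proj₂ (toric-cardinality G e)) (proj₂ (toric-separated G e))
      in ρ , ρ-regularity , toric-degree G bipartite covered large-side ρ-separated
      where
      covered : ∀ u → ∃[ e ] Incident e u
      covered u = let (e , (_ , e-incident) , _) = matching u in e , e-incident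
      e : Fin s
      e = proj₁ (covered zero)

    complete-regularity : IsCompleteBipartite G (suc k) (suc k) →
      Bipartite G × HasPerfectMatching G × IsRegularityIndex K (toricSet K G) (k ℕ.* n)
    complete-regularity complete = complete⇒bipartite G complete , complete⇒matching G complete ,
      toric-regularity G (complete⇒bipartite G complete) (complete⇒matching G complete) (complete-separated G complete)

  cycle-regularity : ∀ {k s} (G : SimpleGraph (2 ℕ.* suc k) s) → IsCycle G →
    Bipartite G × HasPerfectMatching G × IsRegularityIndex K (toricSet K G) (k ℕ.* n)
  cycle-regularity {k} {zero}  G cycle = case Cycle.edge G (even-double (suc k)) cycle zero of λ ()
  cycle-regularity {k} {suc s} G cycle = cyc.cycle-bipartite , cyc.cycle-matching ,
    toric-regularity G cyc.cycle-bipartite cyc.cycle-matching (cycle-separated G cycle)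
    where module cyc = Cycle G (even-double (suc k)) cycle

-- Assembly of the bound and the two tight cases.

open import Data.Nat using (_*_; _∸_; _≤_; _≥_)

mainTheorem5 : ∀ {c ℓ₁ ℓ₂} (K : HeytingField c ℓ₁ ℓ₂) (q : ℕ) →
    HasCardinality (HeytingField.setoid K) q →
    ∀ (k s : ℕ) → 1 ≤ k → (G : SimpleGraph (2 * k) s) →
    (Bipartite G → HasPerfectMatching G →
    ∃[ ρ ] ∃[ τ ]
    IsRegularityIndex K (toricSet K G) ρ ×
    IsRegularityIndex K (projectiveTorus K k) τ ×
    ρ ≥ τ × τ ≡ (q ∸ 2) * (k ∸ 1)) ×
    (IsCycle G →
    Bipartite G × HasPerfectMatching G ×
    IsRegularityIndex K (toricSet K G) ((q ∸ 2) * (k ∸ 1))) ×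
    (IsCompleteBipartite G k k →
    Bipartite G × HasPerfectMatching G ×
    IsRegularityIndex K (toricSet K G) ((q ∸ 2) * (k ∸ 1)))
mainTheorem5 K zero card k s 1≤k G = case Inverse.to card (HeytingField.0# K) of λ ()
mainTheorem5 K (suc zero) card k s 1≤k G = contradiction
  (Injection.injective (Inverse⇒Injection card) (subsingleton _ _)) (#⇒≉0 1#0)
  where
  open Field K using (#⇒≉0; 1#0)
  subsingleton : (i j : Fin 1) → i ≡ j
  subsingleton zero zero = ≡.refl
-- With q = n + 2 and a successor for k both truncated subtractions compute, and only the order of
-- the two factors remains to be exchanged.
mainTheorem5 K (suc (suc n)) card (suc k) s 1≤k G =
  (λ bipartite matching →
    let (ρ , ρ-regularity , kn≤ρ) = bipartite-regularity G bipartite matching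
    in ρ , k ℕ.* n , ρ-regularity , torus-regularity k , kn≤ρ , ℕₚ.*-comm k n) ,
  (λ cycle → let (bipartite , matching , regularity) = cycle-regularity G cycle
    in bipartite , matching , ≡.subst (IsRegularityIndex K (toricSet K G)) (ℕₚ.*-comm k n) regularity) ,
  (λ complete → let (bipartite , matching , regularity) = complete-regularity G complete
    in bipartite , matching , ≡.subst (IsRegularityIndex K (toricSet K G)) (ℕₚ.*-comm k n) regularity)
  where
  open Torus K n card using (torus-regularity)
  open CycleSeparation K n card
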